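{- Let $t>1$ be an integer, and for each positive integer $n$ let $\delta_t^e(n) := p_t^e(n)/p(n)$ and $\delta_t^o(n) := p_t^o(n)/p(n)$. 1) If $t$ is even, then $$\lim_{n\to\infty}\delta_t^e(n)=\lim_{n\to\infty}\delta_t^o(n)=\frac12.$$ 2) If $t$ is odd, then, as $n\to\infty$ through integers of a fixed parity, $$\lim_{n\to\infty}\delta_t^e(n)=\begin{cases}\dfrac12+\dfrac{1}{2^{(t+1)/2}} & \text{if } 2\mid n,\\[2mm] \dfrac12-\dfrac{1}{2^{(t+1)/2}} & \text{if } 2\nmid n,\end{cases}\qquad \lim_{n\to\infty}\delta_t^o(n)=\begin{cases}\dfrac12-\dfrac{1}{2^{(t+1)/2}} & \text{if } 2\mid n,\\[2mm] \dfrac12+\dfrac{1}{2^{(t+1)/2}} & \text{if } 2\nmid n.\end{cases}$$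
   Context: A partition $\lambda$ of $n$ is a weakly decreasing sequence of positive integers $\lambda_1\ge\cdots\ge\lambda_k$ summing to $n$; $p(n)$ is the number of partitions of $n$. In the Ferrers–Young diagram of $\lambda$ (row $i$ has $\lambda_i$ left-aligned cells), the hook number $H_\lambda(i,j)$ of cell $(i,j)$ is the number of cells $(a,b)$ of the diagram with $a=i, b\ge j$ or $b=j, a\ge i$ (i.e. the usual hook length: the cell itself plus the cells to its right in its row and below it in its column). For an integer $t\ge 2$, $\mathcal{H}_t(\lambda)$ is the multiset of hook numbers of $\lambda$ that are multiples of $t$. Define $p_t^e(n)$ (resp. $p_t^o(n)$) as the number of partitions $\lambda$ of $n$ with $\#\mathcal{H}_t(\lambda)$ even (resp. odd). -}

module Defs where

open import Data.Nat as ℕ using (ℕ; zero; suc; _+_; _∸_; _≤_; _≥_; _≤?_; _≟_)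
open import Data.Nat.Divisibility using (_∣_; _∣?_)
open import Data.List using (List; []; _∷_; _++_; length; filter; map; concatMap; upTo)
open import Data.Nat.ListAction using (sum)
open import Data.Unit using (⊤)
open import Data.List.Relation.Unary.Linked using (Linked)
open import Data.List.Relation.Unary.Linked.Properties using ()
open import Data.List.Relation.Unary.All using (All)
open import Data.Integer using (+_)
open import Data.Rational using (ℚ; 0ℚ; 1ℚ; ½; _*_; _-_; _<_; ∣_∣) renaming (_/_ to _/ℚ_)
open import Data.Product using (_×_; ∃-syntax)
open import Relation.Binary.PropositionalEquality using (_≡_)
open import Relation.Nullary using (Dec; yes; no; ¬_; ¬?)
open import Relation.Nullary.Decidable using (_×-dec_)
import Data.List.Relation.Unary.Linked as Linked
import Data.List.Relation.Unary.All as All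

IsPartition : ℕ → List ℕ → Set
IsPartition n λs = Linked (λ a b → b ≤ a) λs × All (λ a → 1 ≤ a) λs × sum λs ≡ n

isPartition? : (n : ℕ) (λs : List ℕ) → Dec (IsPartition n λs)
isPartition? n λs =
  Linked.linked? (λ a b → b ≤? a) λs ×-dec All.all? (λ a → 1 ≤? a) λs ×-dec (sum λs ≟ n)

lists : ℕ → ℕ → List (List ℕ)
lists m zero    = [] ∷ []
lists m (suc k) = [] ∷ concatMap (λ a → map (a ∷_) (lists m k)) (map suc (upTo m))

-- Every partition of n has at most n parts, each at most n, so this list
-- enumerates (without repetition) all partitions of n.
partitions : ℕ → List (List ℕ)
partitions n = filter (isPartition? n) (lists n n)

p : ℕ → ℕ
p n = length (partitions n)

-- λ'_j = number of parts ≥ j (column length j, 1-indexed)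
conj : List ℕ → ℕ → ℕ
conj λs j = length (filter (λ a → j ≤? a) λs)

-- multiset of hook lengths of the cells (i,j), 1 ≤ i ≤ k, 1 ≤ j ≤ λ_i:
-- H(i,j) = (λ_i - j) + (λ'_j - i) + 1
hooksFrom : List ℕ → ℕ → List ℕ → List ℕ
hooksFrom full i []        = []
hooksFrom full i (a ∷ as) =
  map (λ j → (a ∸ j) + (conj full j ∸ i) + 1) (map suc (upTo a))
  ++ hooksFrom full (suc i) as

hooks : List ℕ → List ℕ
hooks λs = hooksFrom λs 1 λs

numHt : ℕ → List ℕ → ℕ
numHt t λs = length (filter (λ h → t ∣? h) (hooks λs))

pe : ℕ → ℕ → ℕ
pe t n = length (filter (λ λs → 2 ∣? numHt t λs) (partitions n))

po : ℕ → ℕ → ℕ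
po t n = length (filter (λ λs → ¬? (2 ∣? numHt t λs)) (partitions n))

-- Densities (p(n) ≥ 1 always; the zero branch is never used)

ratio : ℕ → ℕ → ℚ
ratio a zero    = 0ℚ
ratio a (suc d) = (+ a) /ℚ (suc d)

δe : ℕ → ℕ → ℚ
δe t n = ratio (pe t n) (p n)

δo : ℕ → ℕ → ℚ
δo t n = ratio (po t n) (p n)

halfPow : ℕ → ℚ
halfPow zero    = 1ℚ
halfPow (suc k) = ½ * halfPow k

ConvergesAlong : (ℕ → Set) → (ℕ → ℚ) → ℚ → Set
ConvergesAlong P f L =
  ∀ (ε : ℚ) → 0ℚ < ε → ∃[ N ] (∀ n → N ≤ n → P n → ∣ f n - L ∣ < ε)

ConvergesTo : (ℕ → ℚ) → ℚ → Set
ConvergesTo f L = ConvergesAlong (λ _ → ⊤) f L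

{-# OPTIONS --safe #-}
module Submission where

-- Read off its boundary, a partition becomes a word of beads and gaps, its hooks the pairs of a bead and a
-- gap below it. Distributing the positions over t runners according to their residue mod t, the hooks
-- divisible by t are those within a runner, and the size n is t times their number S plus an energy Q(c) depending
-- only on the charges c of the runners, a quadratic form. Hence p(n) is a sum over a lattice of charges c,
-- weighted by a nondecreasing function of S, with t S = n - Q(c), and the parity of S is a function of c.
--
-- Moving m beads from one runner to another along a line in the lattice changes Q quadratically, so the weights
-- are unimodal on the line; hence the total variation of the weights under such a transfer is at most
-- p(n) / J + p(n) - p(n - O(J)) for every J, which is o(p(n)) because p(n - 1) / p(n) → 1.
-- So two sets of charges exchanged by a transfer carry asymptotically the same share of p(n).
--
-- For even t, moving two beads between runners half a period apart flips the parity of S. For odd t, S ≡ n + Σ x_i x_{i+1}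
-- (mod 2), where x_1, …, x_{t-1} are the parities of the partial sums of the charges; transfers
-- between neighbouring runners flip the x_i one at a time, so these are asymptotically independent fair bits
-- and the sum is even with probability 1/2 + 1/2^((t+1)/2).

-- No asymptotic formula for p(n) enters: every limit is an inequality between natural numbers, with
-- an error of p(n) / J for arbitrary `J`. Two obstacles shape the argument. The lattice of charges
-- is infinite; for each n it is cut down to runners of length 8 n with about 4 n beads each. The
-- energy keeps every charge within 2 n of the balanced one, so no runner feels its ends and
-- translations of the finite box lose nothing. Secondly, weights at neighbouring lattice points are
-- not compared one by one. A window of `J` moves on a line either has increasing energy, and then
-- its losses telescope to a single weight, or no move raises the energy by more than O(J), and p(n)
-- is compared with p(n - O(J)). Translating the window over the lattice uses each move `J` times,
-- whence the factor 1 / J. The ratio p(n - 1) / p(n) is treated combinatorially: p(n) - p(n - 1)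
-- counts the partitions without ones, and these are few because their parts can be traded for twos
-- and ones in many ways. The constant for odd t: the bias of the sum starts at 1/2 for the empty
-- form and is halved by each of the (t - 1) / 2 pairs of bits.

open import Defs
open import Data.Bool using (Bool; true; false; not; _xor_; _∧_)
open import Data.Bool.Properties using (not-involutive; xor-assoc; xor-same; xor-comm; xor-identityʳ; ∧-comm; ∧-idem; not-distribˡ-xor; not-distribʳ-xor; ∧-distribʳ-xor; ∧-zeroʳ)
open import Data.Bool.Solver using (module xor-∧-Solver)
open import Data.Empty using (⊥; ⊥-elim)
open import Data.Fin as Fin using (Fin; toℕ)
import Data.Fin.Properties as Fin
import Data.Integer.Properties as ℤ
open import Data.Integer.Tactic.RingSolver using () renaming (solve-∀ to ℤ-solve-∀)
open import Data.List using (List; []; _∷_; _++_; map; concatMap; upTo; length; filter; cartesianProductWith)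
open import Data.List.Membership.Propositional using (_∈_)
open import Data.List.Membership.Propositional.Properties using (∈-cartesianProductWith⁺; ∈-cartesianProductWith⁻; ∈-map⁺; ∈-map⁻; ∈-upTo⁺; ∈-upTo⁻; ∈-filter⁺; ∈-filter⁻)
open import Data.List.Membership.Propositional.Properties.WithK using (unique∧set⇒bag)
open import Data.List.Properties using (∷-injectiveˡ; ∷-injectiveʳ; filter-++; length-++; ++-assoc; filter-all; filter-none; filter-accept; upTo-∷ʳ; map-upTo)
open import Data.List.Relation.Binary.BagAndSetEquality using (∼bag⇒↭)
open import Data.List.Relation.Binary.Permutation.Propositional as ↭ using (_↭_)
open import Data.List.Relation.Unary.All as All using (All; []; _∷_)
import Data.List.Relation.Unary.All.Properties as All
open import Data.List.Relation.Unary.AllPairs using ([]; _∷_)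
open import Data.List.Relation.Unary.Any using (here; there)
open import Data.List.Relation.Unary.Linked as Linked using (Linked; []; [-]; _∷_)
open import Data.List.Relation.Unary.Unique.Propositional using (Unique)
import Data.List.Relation.Unary.Unique.Propositional.Properties as Unique
open import Data.Nat hiding (_%_)
import Data.Nat as ℕ
open import Data.Nat.DivMod using (+-distrib-/-∣ʳ; m*n/n≡m)
open import Data.Nat.Divisibility using (_∣_; _∣?_; divides; ∣-refl; >⇒∤; ∣m+n∣m⇒∣n; ∣m∣n⇒∣m+n)
open import Data.Nat.Induction using (<-rec)
open import Data.Nat.ListAction using (sum)
open import Data.Nat.Properties
import Data.Nat.Properties as ℕ
open import Data.Nat.Tactic.RingSolver using (solve-∀)
open import Data.Product using (_×_; _,_; proj₁; proj₂; ∃-syntax; Σ-syntax)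
open import Data.Rational as ℚ using (ℚ; mkℚ; toℚᵘ)
import Data.Rational.Properties as ℚ
import Data.Rational.Unnormalised as ℚᵘ
open ℚᵘ using (mkℚᵘ; *≡*; *<*) renaming (_≃_ to _≃ᵘ_)
import Data.Rational.Unnormalised.Properties as ℚᵘ
open import Data.Sum using (_⊎_; inj₁; inj₂)
open import Data.Vec as Vec using (Vec; []; _∷_; head; tail; lookup) renaming (_++_ to _++ᵛ_; map to mapᵛ; sum to sumᵛ)
import Data.Vec.Properties as Vec
open import Function using (_∘_)
open import Function.Bundles using (mk⇔)
open import Relation.Binary.PropositionalEquality hiding (J)
open import Relation.Nullary using (¬_; Dec; yes; no; does)
open import Relation.Nullary.Decidable using (dec-true; dec-false; _×-dec_)

-- Sums over lists

private
  variable
    A B : Set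

∑ : List A → (A → ℕ) → ℕ
∑ []       f = 0
∑ (x ∷ xs) f = f x + ∑ xs f

infix 8 ∑
syntax ∑ xs (λ x → e) = ∑[ x ∈ xs ] e

∑-cong-∈ : ∀ (xs : List A) {f g : A → ℕ} → (∀ x → x ∈ xs → f x ≡ g x) → ∑ xs f ≡ ∑ xs g
∑-cong-∈ []       e = refl
∑-cong-∈ (x ∷ xs) e = cong₂ _+_ (e x (here refl)) (∑-cong-∈ xs (λ y i → e y (there i)))

∑-cong : ∀ (xs : List A) {f g : A → ℕ} → (∀ x → f x ≡ g x) → ∑ xs f ≡ ∑ xs g
∑-cong xs e = ∑-cong-∈ xs (λ x _ → e x)

∑-mono : ∀ (xs : List A) {f g : A → ℕ} → (∀ x → f x ≤ g x) → ∑ xs f ≤ ∑ xs g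
∑-mono []       e = z≤n
∑-mono (x ∷ xs) e = +-mono-≤ (e x) (∑-mono xs e)

+-interchange : ∀ a b c d → (a + b) + (c + d) ≡ (a + c) + (b + d)
+-interchange = solve-∀

∑-+ : ∀ (xs : List A) (f g : A → ℕ) → ∑[ x ∈ xs ] (f x + g x) ≡ ∑ xs f + ∑ xs g
∑-+ []       f g = refl
∑-+ (x ∷ xs) f g = trans (cong (f x + g x +_) (∑-+ xs f g)) (+-interchange (f x) (g x) _ _)

∑-0 : ∀ (xs : List A) → ∑[ x ∈ xs ] 0 ≡ 0
∑-0 []       = refl
∑-0 (x ∷ xs) = ∑-0 xs

∑-*ˡ : ∀ k (xs : List A) (f : A → ℕ) → ∑[ x ∈ xs ] (k * f x) ≡ k * ∑ xs f
∑-*ˡ k []       f = sym (*-zeroʳ k)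
∑-*ˡ k (x ∷ xs) f = trans (cong (k * f x +_) (∑-*ˡ k xs f)) (sym (*-distribˡ-+ k (f x) _))

∑-*ʳ : ∀ (xs : List A) (f : A → ℕ) k → ∑[ x ∈ xs ] (f x * k) ≡ ∑ xs f * k
∑-*ʳ xs f k = trans (∑-cong xs (λ x → *-comm (f x) k)) (trans (∑-*ˡ k xs f) (*-comm k _))

∑-swap : ∀ (xs : List A) (ys : List B) (f : A → B → ℕ) →
         ∑[ x ∈ xs ] ∑[ y ∈ ys ] f x y ≡ ∑[ y ∈ ys ] ∑[ x ∈ xs ] f x y
∑-swap []       ys f = sym (∑-0 ys)
∑-swap (x ∷ xs) ys f = trans (cong (∑ ys (f x) +_) (∑-swap xs ys f)) (sym (∑-+ ys (f x) _))

∑-++ : ∀ (xs ys : List A) f → ∑ (xs ++ ys) f ≡ ∑ xs f + ∑ ys f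
∑-++ []       ys f = refl
∑-++ (x ∷ xs) ys f = trans (cong (f x +_) (∑-++ xs ys f)) (sym (+-assoc (f x) _ _))

∑-map : ∀ (g : A → B) (xs : List A) f → ∑ (map g xs) f ≡ ∑ xs (f ∘ g)
∑-map g []       f = refl
∑-map g (x ∷ xs) f = cong (f (g x) +_) (∑-map g xs f)

∑-↭ : ∀ {xs ys : List A} (f : A → ℕ) → xs ↭ ys → ∑ xs f ≡ ∑ ys f
∑-↭ f ↭.refl         = refl
∑-↭ f (↭.prep x p)   = cong (f x +_) (∑-↭ f p)
∑-↭ f (↭.swap x y p) = trans (cong (λ s → f x + (f y + s)) (∑-↭ f p)) (lemma (f x) (f y) _)
  where
  lemma : ∀ a b c → a + (b + c) ≡ b + (a + c)
  lemma = solve-∀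
∑-↭ f (↭.trans p q)  = trans (∑-↭ f p) (∑-↭ f q)

∑-cartesianProductWith : ∀ {C : Set} (g : A → B → C) (xs : List A) (ys : List B) (f : C → ℕ) →
  ∑ (cartesianProductWith g xs ys) f ≡ ∑[ x ∈ xs ] ∑[ y ∈ ys ] f (g x y)
∑-cartesianProductWith g []       ys f = refl
∑-cartesianProductWith g (x ∷ xs) ys f =
  trans (∑-++ (map (g x) ys) _ f) (cong₂ _+_ (∑-map (g x) ys f) (∑-cartesianProductWith g xs ys f))

𝟙 : Bool → ℕ
𝟙 true  = 1
𝟙 false = 0

𝟙+𝟙-not : ∀ b → 𝟙 b + 𝟙 (not b) ≡ 1
𝟙+𝟙-not true  = refl
𝟙+𝟙-not false = refl

∑-filter : ∀ {P : A → Set} (P? : ∀ x → Dec (P x)) (xs : List A) (f : A → ℕ) →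
           ∑ (filter P? xs) f ≡ ∑[ x ∈ xs ] (𝟙 (does (P? x)) * f x)
∑-filter P? []       f = refl
∑-filter P? (x ∷ xs) f with does (P? x)
... | true  = cong₂ _+_ (sym (+-identityʳ (f x))) (∑-filter P? xs f)
... | false = ∑-filter P? xs f

length≡∑ : ∀ (xs : List A) → length xs ≡ ∑[ x ∈ xs ] 1
length≡∑ []       = refl
length≡∑ (x ∷ xs) = cong suc (length≡∑ xs)

length-filter : ∀ {P : A → Set} (P? : ∀ x → Dec (P x)) (xs : List A) →
                length (filter P? xs) ≡ ∑[ x ∈ xs ] 𝟙 (does (P? x))
length-filter P? xs = trans (length≡∑ (filter P? xs))
  (trans (∑-filter P? xs (λ _ → 1)) (∑-cong xs (λ x → *-identityʳ _)))

δ : ℕ → ℕ → ℕ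
δ m n = 𝟙 (m ≡ᵇ n)

δ-refl : ∀ n → δ n n ≡ 1
δ-refl zero    = refl
δ-refl (suc n) = δ-refl n

δ-≡ : ∀ {m n} → m ≡ n → δ m n ≡ 1
δ-≡ {m} refl = δ-refl m

δ-≢ : ∀ {m n} → m ≢ n → δ m n ≡ 0
δ-≢ {zero}  {zero}  ne = ⊥-elim (ne refl)
δ-≢ {zero}  {suc n} ne = refl
δ-≢ {suc m} {zero}  ne = refl
δ-≢ {suc m} {suc n} ne = δ-≢ {m} {n} (ne ∘ cong suc)

δ-comm : ∀ m n → δ m n ≡ δ n m
δ-comm zero    zero    = refl
δ-comm zero    (suc n) = refl
δ-comm (suc m) zero    = refl
δ-comm (suc m) (suc n) = δ-comm m n

-- Lets a factor be rewritten under the equation tested by the indicator before it; the charge and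
-- energy constraints are used pointwise in this way.
δ-guard : ∀ m n {x y} → (m ≡ n → x ≡ y) → δ m n * x ≡ δ m n * y
δ-guard m n e with m ≟ n
... | yes m≡n = cong (δ m n *_) (e m≡n)
... | no  m≢n rewrite δ-≢ m≢n = refl

δ-iff : ∀ {m n m′ n′} → (m ≡ n → m′ ≡ n′) → (m′ ≡ n′ → m ≡ n) → δ m n ≡ δ m′ n′
δ-iff {m} {n} f g with m ≟ n
... | yes e = trans (δ-≡ e) (sym (δ-≡ (f e)))
... | no ne = trans (δ-≢ ne) (sym (δ-≢ (ne ∘ g)))

∑-upTo-last : ∀ n f → ∑ (upTo (suc n)) f ≡ ∑ (upTo n) f + f n
∑-upTo-last n f = trans (cong (λ l → ∑ l f) (sym (upTo-∷ʳ n)))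
  (trans (∑-++ (upTo n) (n ∷ []) f) (cong (∑ (upTo n) f +_) (+-identityʳ (f n))))

∑-upTo-first : ∀ n f → ∑ (upTo (suc n)) f ≡ f 0 + ∑ (upTo n) (f ∘ suc)
∑-upTo-first n f = cong (f 0 +_)
  (trans (cong (λ l → ∑ l f) (sym (map-upTo suc n))) (∑-map suc (upTo n) f))

∑-upTo-cong : ∀ n {f g : ℕ → ℕ} → (∀ i → i < n → f i ≡ g i) → ∑ (upTo n) f ≡ ∑ (upTo n) g
∑-upTo-cong n e = ∑-cong-∈ (upTo n) (λ i i∈ → e i (∈-upTo⁻ i∈))

∑-upTo-mono : ∀ n {f g : ℕ → ℕ} → (∀ i → i < n → f i ≤ g i) → ∑ (upTo n) f ≤ ∑ (upTo n) g
∑-upTo-mono zero    e = z≤n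
∑-upTo-mono (suc n) {f} {g} e rewrite ∑-upTo-last n f | ∑-upTo-last n g =
  +-mono-≤ (∑-upTo-mono n (λ i i<n → e i (m≤n⇒m≤1+n i<n))) (e n ≤-refl)

∑-upTo-const : ∀ n k → ∑[ _ ∈ upTo n ] k ≡ n * k
∑-upTo-const zero    k = refl
∑-upTo-const (suc n) k = trans (∑-upTo-first n (λ _ → k)) (cong (k +_) (∑-upTo-const n k))

∑-δ : ∀ {x X} (h : ℕ → ℕ) → x < X → ∑[ c ∈ upTo X ] (δ x c * h c) ≡ h x
∑-δ {zero}  {suc X} h _ = trans (∑-upTo-first X (λ c → δ 0 c * h c))
  (trans (cong₂ _+_ (+-identityʳ (h 0)) (∑-0 (upTo X))) (+-identityʳ (h 0)))
∑-δ {suc x} {suc X} h (s≤s x<X) =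
  trans (∑-upTo-first X (λ c → δ (suc x) c * h c)) (∑-δ (h ∘ suc) x<X)

-- The terms lost at the bottom of the range and those gained at its top all vanish.
∑-upTo-shift : ∀ X m {f : ℕ → ℕ} → (∀ x → x < m ⊎ X ≤ x → f x ≡ 0) →
               ∑ (upTo X) f ≡ ∑[ x ∈ upTo X ] f (m + x)
∑-upTo-shift X zero    z = refl
∑-upTo-shift X (suc m) {f} z = begin
  ∑ (upTo X) f                    ≡⟨ +-identityʳ _ ⟨
  ∑ (upTo X) f + 0                ≡⟨ cong (∑ (upTo X) f +_) (z X (inj₂ ≤-refl)) ⟨
  ∑ (upTo X) f + f X              ≡⟨ ∑-upTo-last X f ⟨
  ∑ (upTo (suc X)) f              ≡⟨ ∑-upTo-first X f ⟩
  f 0 + ∑ (upTo X) (f ∘ suc)      ≡⟨ cong (_+ ∑ (upTo X) (f ∘ suc)) (z 0 (inj₁ (s≤s z≤n))) ⟩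
  ∑ (upTo X) (f ∘ suc)            ≡⟨ ∑-upTo-shift X m z′ ⟩
  (∑[ x ∈ upTo X ] f (suc m + x)) ∎
  where
  open ≡-Reasoning
  z′ : ∀ x → x < m ⊎ X ≤ x → f (suc x) ≡ 0
  z′ x (inj₁ x<m) = z (suc x) (inj₁ (s≤s x<m))
  z′ x (inj₂ X≤x) = z (suc x) (inj₂ (m≤n⇒m≤1+n X≤x))

vecs : List A → ∀ n → List (Vec A n)
vecs xs zero    = [] ∷ []
vecs xs (suc n) = cartesianProductWith _∷_ xs (vecs xs n)

∑-vecs : ∀ (xs : List A) n (F : Vec A (suc n) → ℕ) →
         ∑ (vecs xs (suc n)) F ≡ ∑[ x ∈ xs ] ∑[ v ∈ vecs xs n ] F (x ∷ v)
∑-vecs xs n F = ∑-cartesianProductWith _∷_ xs (vecs xs n) F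

-- Sequences as generating functions

-- A sequence ℕ → ℕ stands for its generating function; shift a is multiplication by q^a.
shift : ℕ → (ℕ → ℕ) → ℕ → ℕ
shift zero    f n       = f n
shift (suc a) f zero    = 0
shift (suc a) f (suc n) = shift a f n

shift-+ : ∀ a f n → shift a f (a + n) ≡ f n
shift-+ zero    f n = refl
shift-+ (suc a) f n = shift-+ a f n

shift-< : ∀ {a n} f → n < a → shift a f n ≡ 0
shift-< {suc a} {zero}  f _         = refl
shift-< {suc a} {suc n} f (s≤s n<a) = shift-< f n<a

shift-∸ : ∀ {a n} f → a ≤ n → shift a f n ≡ f (n ∸ a)
shift-∸ {a} f a≤n = trans (cong (shift a f) (sym (m+[n∸m]≡n a≤n))) (shift-+ a f _)

shift-cong : ∀ a {f g} n → (∀ m → a + m ≡ n → f m ≡ g m) → shift a f n ≡ shift a g n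
shift-cong a {f} {g} n e with a ≤? n
... | yes a≤n = trans (shift-∸ f a≤n) (trans (e (n ∸ a) (m+[n∸m]≡n a≤n)) (sym (shift-∸ g a≤n)))
... | no  a≰n = trans (shift-< f (≰⇒> a≰n)) (sym (shift-< g (≰⇒> a≰n)))

shift-mono : ∀ a {f g} n → (∀ m → f m ≤ g m) → shift a f n ≤ shift a g n
shift-mono zero    n       h = h n
shift-mono (suc a) zero    h = z≤n
shift-mono (suc a) (suc n) h = shift-mono a n h

shift-add : ∀ a f g n → shift a (λ m → f m + g m) n ≡ shift a f n + shift a g n
shift-add zero    f g n       = refl
shift-add (suc a) f g zero    = refl
shift-add (suc a) f g (suc n) = shift-add a f g n

shift-shift : ∀ a b f n → shift a (shift b f) n ≡ shift (a + b) f n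
shift-shift zero    b f n       = refl
shift-shift (suc a) b f zero    = refl
shift-shift (suc a) b f (suc n) = shift-shift a b f n

shift-comm : ∀ a b f n → shift a (shift b f) n ≡ shift b (shift a f) n
shift-comm a b f n = trans (shift-shift a b f n)
  (trans (cong (λ c → shift c f n) (+-comm a b)) (sym (shift-shift b a f n)))

private
  -- The first argument is fuel: each unfolding lowers the degree, but only inside `shift`, where
  -- structural recursion cannot see it. Any fuel above `n` gives the same coefficient at `n`.
  geomUpTo : ℕ → ℕ → (ℕ → ℕ) → ℕ → ℕ
  geomUpTo zero    a f n = 0
  geomUpTo (suc k) a f n = f n + shift (suc a) (geomUpTo k a f) n

  geomUpTo-stable : ∀ k k′ a f n → n < k → n < k′ → geomUpTo k a f n ≡ geomUpTo k′ a f n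
  geomUpTo-stable (suc k) (suc k′) a f n (s≤s n≤k) (s≤s n≤k′) = cong (f n +_) (shift-cong (suc a) n step)
    where
    step : ∀ m → suc a + m ≡ n → geomUpTo k a f m ≡ geomUpTo k′ a f m
    step m refl = geomUpTo-stable k k′ a f m (≤-trans (s≤s (m≤n+m m a)) n≤k) (≤-trans (s≤s (m≤n+m m a)) n≤k′)

-- Multiplication by 1 / (1 - q^(suc a)).
geom : ℕ → (ℕ → ℕ) → ℕ → ℕ
geom a f n = geomUpTo (suc n) a f n

geom-unfold : ∀ a f n → geom a f n ≡ f n + shift (suc a) (geom a f) n
geom-unfold a f n = cong (f n +_) (shift-cong (suc a) n step)
  where
  step : ∀ m → suc a + m ≡ n → geomUpTo n a f m ≡ geom a f m
  step m refl = geomUpTo-stable n (suc m) a f m (s≤s (m≤n+m m a)) ≤-refl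

geom-≥ : ∀ a f n → f n ≤ geom a f n
geom-≥ a f n = subst (f n ≤_) (sym (geom-unfold a f n)) (m≤m+n (f n) _)

geom-small : ∀ {a n} f → n < suc a → geom a f n ≡ f n
geom-small {a} {n} f h = trans (geom-unfold a f n) (trans (cong (f n +_) (shift-< (geom a f) h)) (+-identityʳ (f n)))

geom-step : ∀ a f n → geom a f (suc a + n) ≡ f (suc a + n) + geom a f n
geom-step a f n = trans (geom-unfold a f (suc a + n)) (cong (f (suc a + n) +_) (shift-+ (suc a) (geom a f) n))

-- The right side at `n` involves `g` only below `n`, so the functional equation has one solution.
-- Identities between products of geometric series reduce to checking it.
geom-unique : ∀ a f {g} → (∀ n → g n ≡ f n + shift (suc a) g n) → ∀ n → g n ≡ geom a f n
geom-unique a f {g} h = <-rec _ step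
  where
  step : ∀ n → (∀ {m} → m < n → g m ≡ geom a f m) → g n ≡ geom a f n
  step n ih = trans (h n) (trans (cong (f n +_) (shift-cong (suc a) n
    (λ m e → ih (subst (m <_) e (s≤s (m≤n+m m a)))))) (sym (geom-unfold a f n)))

geom-cong : ∀ a {f g} → (∀ n → f n ≡ g n) → ∀ n → geom a f n ≡ geom a g n
geom-cong a {f} {g} e = geom-unique a g (λ n → trans (geom-unfold a f n) (cong (_+ _) (e n)))

geom-comm : ∀ a b f n → geom a (geom b f) n ≡ geom b (geom a f) n
geom-comm a b f = geom-unique b (geom a f) (<-rec _ step)
  where
  open ≡-Reasoning
  g = geom a (geom b f)
  shuffle : ∀ x y z w → x + y + (z + w) ≡ x + z + (y + w)
  shuffle = solve-∀
  step : ∀ n → (∀ {m} → m < n → g m ≡ geom a f m + shift (suc b) g m) → g n ≡ geom a f n + shift (suc b) g n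
  step n ih = begin
    g n                                                       ≡⟨ geom-unfold a (geom b f) n ⟩
    geom b f n + shift (suc a) g n                            ≡⟨ cong (geom b f n +_) (shift-cong (suc a) n (λ m e → ih (subst (m <_) e (s≤s (m≤n+m m a))))) ⟩
    geom b f n + shift (suc a) (λ m → geom a f m + shift (suc b) g m) n
                                                              ≡⟨ cong₂ _+_ (geom-unfold b f n) (shift-add (suc a) (geom a f) (shift (suc b) g) n) ⟩
    (f n + shift (suc b) (geom b f) n) + (shift (suc a) (geom a f) n + shift (suc a) (shift (suc b) g) n)
                                                              ≡⟨ shuffle (f n) _ _ _ ⟩
    (f n + shift (suc a) (geom a f) n) + (shift (suc b) (geom b f) n + shift (suc a) (shift (suc b) g) n)
                                                              ≡⟨ cong₂ (λ x y → x + (shift (suc b) (geom b f) n + y)) (sym (geom-unfold a f n)) (shift-comm (suc a) (suc b) g n) ⟩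
    geom a f n + (shift (suc b) (geom b f) n + shift (suc b) (shift (suc a) g) n)
                                                              ≡⟨ cong (geom a f n +_) (shift-add (suc b) (geom b f) (shift (suc a) g) n) ⟨
    geom a f n + shift (suc b) (λ m → geom b f m + shift (suc a) g m) n
                                                              ≡⟨ cong (geom a f n +_) (shift-cong (suc b) n (λ m _ → sym (geom-unfold a (geom b f) m))) ⟩
    geom a f n + shift (suc b) g n ∎

-- Partitions into parts of size at most z.
pp : ℕ → ℕ → ℕ
pp zero    = δ 0
pp (suc z) = geom z (pp z)

pp-stable : ∀ z d e → e ≤ z → pp (z + d) e ≡ pp z e
pp-stable z zero    e e≤z = cong (λ y → pp y e) (+-identityʳ z)
pp-stable z (suc d) e e≤z = trans (cong (λ y → pp y e) (+-suc z d))
  (trans (geom-small (pp (z + d)) (s≤s (≤-trans e≤z (m≤m+n z d)))) (pp-stable z d e e≤z))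

P : ℕ → ℕ
P e = pp e e

pp≡P : ∀ {z e} → e ≤ z → pp z e ≡ P e
pp≡P {z} {e} e≤z = trans (cong (λ y → pp y e) (sym (m+[n∸m]≡n e≤z))) (pp-stable e (z ∸ e) e ≤-refl)

-- With ones alone the sequence is constant, and a further geometric factor preserves monotonicity.
-- The bound is `suc z` because `pp zero` drops from 1 to 0.
pp-mono : ∀ z e → pp (suc z) e ≤ pp (suc z) (suc e)
pp-mono zero e = ≤-reflexive (trans (one e) (sym (one (suc e))))
  where
  one : ∀ e → pp 1 e ≡ 1
  one zero    = refl
  one (suc e) = trans (geom-step 0 (δ 0) e) (one e)
pp-mono (suc z) = <-rec _ step
  where
  step : ∀ e → (∀ {m} → m < e → pp (suc (suc z)) m ≤ pp (suc (suc z)) (suc m)) → pp (suc (suc z)) e ≤ pp (suc (suc z)) (suc e)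
  step e ih with suc (suc z) ≤? e
  ... | no  z≰e = ≤-trans (≤-reflexive (geom-small (pp (suc z)) (≰⇒> z≰e)))
                    (≤-trans (pp-mono z e) (geom-≥ (suc z) (pp (suc z)) (suc e)))
  ... | yes z≤e with d ← e ∸ suc (suc z) | refl ← sym (m+[n∸m]≡n z≤e) = subst₂ _≤_
    (sym (geom-step (suc z) (pp (suc z)) d))
    (trans (sym (geom-step (suc z) (pp (suc z)) (suc d))) (cong (pp (suc (suc z))) (+-suc (suc (suc z)) d)))
    (+-mono-≤ (subst (λ m → pp (suc z) (suc (suc z) + d) ≤ pp (suc z) m) (sym (+-suc (suc (suc z)) d)) (pp-mono z (suc (suc z) + d)))
              (ih (s≤s (m≤n+m d (suc z)))))

P-mono-suc : ∀ e → P e ≤ P (suc e)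
P-mono-suc zero    = ≤-refl
P-mono-suc (suc e) = ≤-trans (pp-mono e (suc e)) (geom-≥ (suc e) (pp (suc e)) (suc (suc e)))

P-mono : ∀ d e → P e ≤ P (d + e)
P-mono zero    e = ≤-refl
P-mono (suc d) e = ≤-trans (P-mono d e) (P-mono-suc (d + e))

-- Partitions as words

-- A word lists the boundary steps of a Young diagram, topmost bead position first;
-- a bead (true) contributes a part equal to the number of gaps (false) below it.
Word : ℕ → Set
Word = Vec Bool

ones zeros inv : ∀ {n} → Word n → ℕ
ones []          = 0
ones (true ∷ w)  = suc (ones w)
ones (false ∷ w) = ones w
zeros []          = 0
zeros (true ∷ w)  = zeros w
zeros (false ∷ w) = suc (zeros w)
inv []          = 0
inv (true ∷ w)  = zeros w + inv w
inv (false ∷ w) = inv w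

ones+zeros : ∀ {n} (w : Word n) → ones w + zeros w ≡ n
ones+zeros []          = refl
ones+zeros (true ∷ w)  = cong suc (ones+zeros w)
ones+zeros (false ∷ w) = trans (+-suc (ones w) (zeros w)) (cong suc (ones+zeros w))

-- Beads without a gap below them stand for parts of size zero, which a partition does not list.
_∷⁺_ : ℕ → List ℕ → List ℕ
zero  ∷⁺ l = l
suc a ∷⁺ l = suc a ∷ l

shape : ∀ {n} → Word n → List ℕ
shape []          = []
shape (true ∷ w)  = zeros w ∷⁺ shape w
shape (false ∷ w) = shape w

shape-≤zeros : ∀ {n} (w : Word n) → All (_≤ zeros w) (shape w)
shape-≤zeros []          = []
shape-≤zeros (false ∷ w) = All.map m≤n⇒m≤1+n (shape-≤zeros w)
shape-≤zeros (true ∷ w) with zeros w | shape-≤zeros w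
... | zero  | h = h
... | suc z | h = ≤-refl ∷ h

∷-linked : ∀ {a l} → All (_≤ a) l → Linked (λ x y → y ≤ x) l → Linked (λ x y → y ≤ x) (a ∷ l)
∷-linked []      []       = [-]
∷-linked (h ∷ _) l = h ∷ l

shape-linked : ∀ {n} (w : Word n) → Linked (λ x y → y ≤ x) (shape w)
shape-linked []          = []
shape-linked (false ∷ w) = shape-linked w
shape-linked (true ∷ w) with zeros w | shape-≤zeros w
... | zero  | h = shape-linked w
... | suc z | h = ∷-linked h (shape-linked w)

shape-positive : ∀ {n} (w : Word n) → All (1 ≤_) (shape w)
shape-positive []          = []
shape-positive (false ∷ w) = shape-positive w
shape-positive (true ∷ w) with zeros w
... | zero  = shape-positive w
... | suc z = s≤s z≤n ∷ shape-positive w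

shape-sum : ∀ {n} (w : Word n) → sum (shape w) ≡ inv w
shape-sum []          = refl
shape-sum (false ∷ w) = shape-sum w
shape-sum (true ∷ w) with zeros w
... | zero  = shape-sum w
... | suc z = cong (suc z +_) (shape-sum w)

shape-isPartition : ∀ {n} (w : Word n) → IsPartition (inv w) (shape w)
shape-isPartition w = shape-linked w , shape-positive w , shape-sum w

-- The shape forgets leading gaps and trailing beads; the length together with `zeros` recovers
-- them. If the first letters differ, one shape starts with a part equal to the total number of
-- gaps, while all parts of the other are smaller.
shape-injective : ∀ {n} (w w′ : Word n) → zeros w ≡ zeros w′ → shape w ≡ shape w′ → w ≡ w′
shape-injective []          []           _  _  = refl
shape-injective (false ∷ w) (false ∷ w′) ez es = cong (false ∷_) (shape-injective w w′ (suc-injective ez) es)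
shape-injective (true ∷ w)  (true ∷ w′)  ez es = cong (true ∷_) (shape-injective w w′ ez (tails ez es))
  where
  tails : ∀ {a b l l′} → a ≡ b → a ∷⁺ l ≡ b ∷⁺ l′ → l ≡ l′
  tails {zero}  refl e = e
  tails {suc a} refl e = ∷-injectiveʳ e
shape-injective (true ∷ w)  (false ∷ w′) ez es with zeros w | ez
... | suc z | refl with () ← <⇒≱ (n<1+n _) (All.head (subst (All (_≤ z)) (sym es) (shape-≤zeros w′)))
shape-injective (false ∷ w) (true ∷ w′)  ez es with zeros w′ | ez
... | suc z | refl with () ← <⇒≱ (n<1+n _) (All.head (subst (All (_≤ z)) es (shape-≤zeros w)))

linked⇒all : ∀ {a l} → Linked (λ x y → y ≤ x) (a ∷ l) → All (_≤ a) l
linked⇒all [-]     = []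
linked⇒all (h ∷ l) = h ∷ All.map (λ y≤ → ≤-trans y≤ h) (linked⇒all l)

-- Reads the boundary from the top: a part equal to the number of gaps left becomes a bead,
-- otherwise a gap is spent. After the last part the leftover gaps precede the leftover beads.
shape-surjective : ∀ n l c z → c + z ≡ n → Linked (λ x y → y ≤ x) l → All (1 ≤_) l → All (_≤ z) l →
                   length l ≤ c → Σ[ w ∈ Word n ] (ones w ≡ c × zeros w ≡ z × shape w ≡ l)
shape-surjective zero [] zero zero refl lk pos bd len = [] , refl , refl , refl
shape-surjective (suc n) [] (suc c) zero e lk pos bd len
  with w , e₁ , e₂ , e₃ ← shape-surjective n [] c zero (suc-injective e) lk pos bd z≤n
  = true ∷ w , cong suc e₁ , e₂ , trans (cong (_∷⁺ shape w) e₂) e₃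
shape-surjective (suc n) [] c (suc z) e lk pos bd len
  with w , e₁ , e₂ , e₃ ← shape-surjective n [] c z (suc-injective (trans (sym (+-suc c z)) e)) lk pos [] z≤n
  = false ∷ w , e₁ , cong suc e₂ , e₃
shape-surjective n (_ ∷ _) zero z e lk pos bd ()
shape-surjective zero (_ ∷ _) (suc c) z () lk pos bd len
shape-surjective (suc n) (zero ∷ l) (suc c) z e lk (() ∷ _) bd len
shape-surjective (suc n) (suc a ∷ l) (suc c) zero e lk pos (() ∷ _) len
shape-surjective (suc n) (suc a ∷ l) (suc c) (suc z) e lk (p ∷ pos) (h ∷ bd) (s≤s len) with a ≟ z
... | yes refl with w , e₁ , e₂ , e₃ ← shape-surjective n l c (suc z) (suc-injective e)
                      (Linked.tail lk) pos bd len
  = true ∷ w , cong suc e₁ , e₂ , trans (cong (_∷⁺ shape w) e₂) (cong (suc z ∷_) e₃)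
... | no a≢z with a<z ← ≤∧≢⇒< (s≤s⁻¹ h) a≢z
             with w , e₁ , e₂ , e₃ ← shape-surjective n (suc a ∷ l) (suc c) z
                      (suc-injective (trans (sym (+-suc (suc c) z)) e)) lk (p ∷ pos)
                      (a<z ∷ All.map (λ y≤ → ≤-trans y≤ a<z) (linked⇒all lk)) (s≤s len)
  = false ∷ w , e₁ , cong suc e₂ , e₃

-- Sums `φ` over the distances to the gaps, seen from a bead `s` steps above the first letter.
dist : ∀ {n} → (ℕ → ℕ) → ℕ → Word n → ℕ
dist φ s []          = 0
dist φ s (true ∷ w)  = dist φ (suc s) w
dist φ s (false ∷ w) = φ s + dist φ (suc s) w

multiple : ℕ → ℕ → ℕ
multiple t h = 𝟙 (does (t ∣? h))

hooksOf : ∀ {n} → ℕ → Word n → ℕ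
hooksOf t []          = 0
hooksOf t (true ∷ w)  = dist (multiple t) 1 w + hooksOf t w
hooksOf t (false ∷ w) = hooksOf t w

conj-∷-≤ : ∀ {a j} l → j ≤ a → conj (a ∷ l) j ≡ suc (conj l j)
conj-∷-≤ {a} {j} l j≤a = cong length (filter-accept (j ≤?_) j≤a)

conj-++ : ∀ l l′ j → conj (l ++ l′) j ≡ conj l j + conj l′ j
conj-++ l l′ j = trans (cong length (filter-++ (j ≤?_) l l′)) (length-++ (filter (j ≤?_) l))

conj-all : ∀ {l j} → All (j ≤_) l → conj l j ≡ length l
conj-all {l} {j} h = cong length (filter-all (j ≤?_) h)

conj-none : ∀ {l j} → All (_< j) l → conj l j ≡ 0
conj-none {l} {j} h = cong length (filter-none (j ≤?_) (All.map <⇒≱ h))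

-- The hook lengths of a row are the distances from its bead to the gaps below.
row-hooks : ∀ {n} (φ : ℕ → ℕ) s (w : Word n) →
            ∑[ j ∈ upTo (zeros w) ] φ ((zeros w ∸ suc j) + conj (shape w) (suc j) + s) ≡ dist φ s w
row-hooks φ s []          = refl
row-hooks φ s (true ∷ w)  = trans (∑-upTo-cong (zeros w) step) (row-hooks φ (suc s) w)
  where
  conj-∷⁺ : ∀ z j l → j ≤ z → 1 ≤ j → conj (z ∷⁺ l) j ≡ suc (conj l j)
  conj-∷⁺ zero    (suc j) l () _
  conj-∷⁺ (suc z) j       l j≤z _ = conj-∷-≤ l j≤z
  shuffle : ∀ a b c → a + suc b + c ≡ a + b + suc c
  shuffle = solve-∀
  step : ∀ j → j < zeros w → φ ((zeros w ∸ suc j) + conj (zeros w ∷⁺ shape w) (suc j) + s)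
                           ≡ φ ((zeros w ∸ suc j) + conj (shape w) (suc j) + suc s)
  step j j<z = cong φ (trans (cong (λ c → (zeros w ∸ suc j) + c + s) (conj-∷⁺ (zeros w) (suc j) (shape w) j<z (s≤s z≤n)))
                 (shuffle (zeros w ∸ suc j) (conj (shape w) (suc j)) s))
row-hooks φ s (false ∷ w) = begin
  ∑ (upTo (suc (zeros w))) f   ≡⟨ ∑-upTo-last (zeros w) f ⟩
  ∑ (upTo (zeros w)) f + f (zeros w) ≡⟨ cong₂ _+_ (∑-upTo-cong (zeros w) step) last ⟩
  (∑[ j ∈ upTo (zeros w) ] φ ((zeros w ∸ suc j) + conj (shape w) (suc j) + suc s)) + φ s
                               ≡⟨ cong (_+ φ s) (row-hooks φ (suc s) w) ⟩
  dist φ (suc s) w + φ s       ≡⟨ +-comm _ (φ s) ⟩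
  φ s + dist φ (suc s) w       ∎
  where
  open ≡-Reasoning
  f : ℕ → ℕ
  f j = φ ((zeros w ∸ j) + conj (shape w) (suc j) + s)
  shuffle : ∀ a b c → suc a + b + c ≡ a + b + suc c
  shuffle = solve-∀
  step : ∀ j → j < zeros w → f j ≡ φ ((zeros w ∸ suc j) + conj (shape w) (suc j) + suc s)
  step j j<z = cong φ (trans (cong (λ d → d + conj (shape w) (suc j) + s) (∸-suc′ j<z))
                 (shuffle (zeros w ∸ suc j) (conj (shape w) (suc j)) s))
    where
    ∸-suc′ : ∀ {a j} → j < a → a ∸ j ≡ suc (a ∸ suc j)
    ∸-suc′ {suc a} {zero}  _         = refl
    ∸-suc′ {suc a} {suc j} (s≤s j<a) = ∸-suc′ j<a
  last : f (zeros w) ≡ φ s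
  last = cong φ (cong₂ (λ x y → x + y + s) (n∸n≡0 (zeros w)) (conj-none (All.map s≤s (shape-≤zeros w))))

dist-zeros≡0 : ∀ {n} φ s (w : Word n) → zeros w ≡ 0 → dist φ s w ≡ 0
dist-zeros≡0 φ s []         e = refl
dist-zeros≡0 φ s (true ∷ w) e = dist-zeros≡0 φ (suc s) w e

count : ℕ → List ℕ → ℕ
count t l = length (filter (t ∣?_) l)

-- `pre` holds the rows already passed. None is shorter than the number of gaps left, so each adds
-- exactly one to every column still in use, and the row index subtracts these again.
count-hooksFrom : ∀ {n} t (w : Word n) pre → All (zeros w ≤_) pre →
  count t (hooksFrom (pre ++ shape w) (suc (length pre)) (shape w)) ≡ hooksOf t w
count-hooksFrom t []          pre h = refl
count-hooksFrom t (false ∷ w) pre h = count-hooksFrom t w pre (All.map (≤-trans (n≤1+n _)) h)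
count-hooksFrom t (true ∷ w)  pre h with zeros w in ez
... | zero = trans (count-hooksFrom t w pre (subst (λ z → All (z ≤_) pre) (sym ez) h))
               (cong (_+ hooksOf t w) (sym (dist-zeros≡0 (multiple t) 1 w ez)))
... | suc z = begin
  count t (row ++ rest) ≡⟨ cong length (filter-++ (t ∣?_) row rest) ⟩
  length (filter (t ∣?_) row ++ filter (t ∣?_) rest)                    ≡⟨ length-++ (filter (t ∣?_) row) ⟩
  count t row + count t rest ≡⟨ cong₂ _+_ row≡ rest≡ ⟩
  dist (multiple t) 1 w + hooksOf t w ∎
  where
  open ≡-Reasoning
  full = pre ++ suc z ∷ shape w
  rest = hooksFrom full (suc (suc (length pre))) (shape w)
  hook : ℕ → ℕ
  hook j = (suc z ∸ j) + (conj full j ∸ suc (length pre)) + 1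
  row = map hook (map suc (upTo (suc z)))
  hook≡ : ∀ j → j < suc z → hook (suc j) ≡ (suc z ∸ suc j) + conj (shape w) (suc j) + 1
  hook≡ j j<z = cong (λ c → (suc z ∸ suc j) + c + 1) (begin
    conj full (suc j) ∸ suc (length pre)
      ≡⟨ cong (_∸ suc (length pre)) (trans (conj-++ pre _ (suc j))
           (cong₂ _+_ (conj-all (All.map (≤-trans j<z) h)) (conj-∷-≤ (shape w) j<z))) ⟩
    (length pre + suc (conj (shape w) (suc j))) ∸ suc (length pre)
      ≡⟨ cong (_∸ suc (length pre)) (+-suc (length pre) _) ⟩
    (length pre + conj (shape w) (suc j)) ∸ length pre
      ≡⟨ m+n∸m≡n (length pre) _ ⟩
    conj (shape w) (suc j) ∎)
  row≡ : count t row ≡ dist (multiple t) 1 w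
  row≡ = begin
    count t row                                              ≡⟨ length-filter (t ∣?_) row ⟩
    ∑ row (multiple t)                                       ≡⟨ ∑-map hook (map suc (upTo (suc z))) (multiple t) ⟩
    ∑ (map suc (upTo (suc z))) (multiple t ∘ hook)           ≡⟨ ∑-map suc (upTo (suc z)) (multiple t ∘ hook) ⟩
    (∑[ j ∈ upTo (suc z) ] multiple t (hook (suc j)))        ≡⟨ ∑-upTo-cong (suc z) (λ j j<z → cong (multiple t) (hook≡ j j<z)) ⟩
    (∑[ j ∈ upTo (suc z) ] multiple t ((suc z ∸ suc j) + conj (shape w) (suc j) + 1))
      ≡⟨ cong (λ a → ∑[ j ∈ upTo a ] multiple t ((a ∸ suc j) + conj (shape w) (suc j) + 1)) ez ⟨
    (∑[ j ∈ upTo (zeros w) ] multiple t ((zeros w ∸ suc j) + conj (shape w) (suc j) + 1))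
      ≡⟨ row-hooks (multiple t) 1 w ⟩
    dist (multiple t) 1 w ∎
  rest≡ : count t (hooksFrom full (suc (suc (length pre))) (shape w)) ≡ hooksOf t w
  rest≡ = trans (cong₂ (λ f m → count t (hooksFrom f (suc m) (shape w)))
                  (sym (++-assoc pre (suc z ∷ []) (shape w)))
                  (sym (trans (length-++ pre) (+-comm (length pre) 1))))
            (count-hooksFrom t w (pre ++ suc z ∷ []) (All.++⁺ (subst (λ y → All (y ≤_) pre) (sym ez) h) (≤-reflexive ez ∷ [])))

numHt-shape : ∀ {n} t (w : Word n) → numHt t (shape w) ≡ hooksOf t w
numHt-shape t w = count-hooksFrom t w [] []

concatMap≡cartesianProductWith : ∀ {A B C : Set} (f : A → B → C) xs ys →
  concatMap (λ x → map (f x) ys) xs ≡ cartesianProductWith f xs ys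
concatMap≡cartesianProductWith f []       ys = refl
concatMap≡cartesianProductWith f (x ∷ xs) ys = cong (map (f x) ys ++_) (concatMap≡cartesianProductWith f xs ys)

lists-unique : ∀ m k → Unique (lists m k)
lists-unique m zero    = [] ∷ []
lists-unique m (suc k) = All.tabulate fresh ∷ subst Unique (sym eq)
  (Unique.cartesianProductWith⁺ _∷_ (λ e → ∷-injectiveˡ e , ∷-injectiveʳ e)
    (Unique.map⁺ suc-injective (Unique.upTo⁺ m)) (lists-unique m k))
  where
  eq = concatMap≡cartesianProductWith _∷_ (map suc (upTo m)) (lists m k)
  fresh : ∀ {l} → l ∈ concatMap (λ a → map (a ∷_) (lists m k)) (map suc (upTo m)) → [] ≢ l
  fresh i e with _ , _ , _ , _ , refl ← ∈-cartesianProductWith⁻ _∷_ (map suc (upTo m)) (lists m k) (subst (_ ∈_) eq i)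
    with () ← e

∈-lists : ∀ m k l → All (1 ≤_) l → All (_≤ m) l → length l ≤ k → l ∈ lists m k
∈-lists m zero    []          _ _ _ = here refl
∈-lists m (suc k) []          _ _ _ = here refl
∈-lists m (suc k) (suc a ∷ l) (p ∷ ps) (h ∷ hs) (s≤s len) = there (subst (_ ∈_) (sym eq)
  (∈-cartesianProductWith⁺ _∷_ (∈-map⁺ suc (∈-upTo⁺ h)) (∈-lists m k l ps hs len)))
  where eq = concatMap≡cartesianProductWith _∷_ (map suc (upTo m)) (lists m k)

sum-≥ : ∀ l → All (_≤ sum l) l
sum-≥ []      = []
sum-≥ (a ∷ l) = m≤m+n a _ ∷ All.map (λ h → ≤-trans h (m≤n+m _ a)) (sum-≥ l)

length≤sum : ∀ {l} → All (1 ≤_) l → length l ≤ sum l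
length≤sum []       = z≤n
length≤sum (p ∷ ps) = +-mono-≤ p (length≤sum ps)

partitions-unique : ∀ n → Unique (partitions n)
partitions-unique n = Unique.filter⁺ (isPartition? n) (lists-unique n n)

∈-partitions⁻ : ∀ {n l} → l ∈ partitions n → IsPartition n l
∈-partitions⁻ {n} i = proj₂ (∈-filter⁻ (isPartition? n) {xs = lists n n} i)

∈-partitions⁺ : ∀ {n l} → IsPartition n l → l ∈ partitions n
∈-partitions⁺ {l = l} q@(_ , ps , refl) = ∈-filter⁺ (isPartition? _) (∈-lists _ _ l ps (sum-≥ l) (length≤sum ps)) q

-- Splitting a word into runners

-- Letters are dealt out row by row, one to each runner, so letters of the same runner lie at
-- distances divisible by `t`.
interleave : ∀ {L t} → Vec (Word L) t → Word (L * t)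
interleave {zero}  cs = []
interleave {suc L} cs = mapᵛ head cs ++ᵛ interleave (mapᵛ tail cs)

interleave-injective : ∀ {L t} (cs ds : Vec (Word L) t) → interleave cs ≡ interleave ds → cs ≡ ds
interleave-injective {zero}  cs ds e = words₀ cs ds
  where
  words₀ : ∀ {t} (cs ds : Vec (Word 0) t) → cs ≡ ds
  words₀ []        []        = refl
  words₀ ([] ∷ cs) ([] ∷ ds) = cong ([] ∷_) (words₀ cs ds)
interleave-injective {suc L} cs ds e with eh , et ← Vec.++-injective (mapᵛ head cs) (mapᵛ head ds) e =
  glue cs ds eh (interleave-injective (mapᵛ tail cs) (mapᵛ tail ds) et)
  where
  glue : ∀ {t} (cs ds : Vec (Word (suc L)) t) → mapᵛ head cs ≡ mapᵛ head ds → mapᵛ tail cs ≡ mapᵛ tail ds → cs ≡ ds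
  glue []              []              _  _  = refl
  glue ((x ∷ u) ∷ cs) ((y ∷ v) ∷ ds) eh et =
    cong₂ _∷_ (cong₂ _∷_ (Vec.∷-injectiveˡ eh) (Vec.∷-injectiveˡ et)) (glue cs ds (Vec.∷-injectiveʳ eh) (Vec.∷-injectiveʳ et))

interleave-surjective : ∀ {L t} (w : Word (L * t)) → Σ[ cs ∈ Vec (Word L) t ] (interleave cs ≡ w)
interleave-surjective {zero} {t} [] = Vec.replicate t [] , refl
interleave-surjective {suc L} {t} w with Vec.splitAt t w
... | ρ , w′ , refl with cs , refl ← interleave-surjective {L} {t} w′ = Vec.zipWith _∷_ ρ cs ,
  cong₂ (λ hs ts → hs ++ᵛ interleave ts) (heads ρ cs) (tails ρ cs)
  where
  heads : ∀ {t} (ρ : Word t) (cs : Vec (Word L) t) → mapᵛ head (Vec.zipWith _∷_ ρ cs) ≡ ρ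
  heads []      []       = refl
  heads (x ∷ ρ) (c ∷ cs) = cong (x ∷_) (heads ρ cs)
  tails : ∀ {t} (ρ : Word t) (cs : Vec (Word L) t) → mapᵛ tail (Vec.zipWith _∷_ ρ cs) ≡ cs
  tails []      []       = refl
  tails (x ∷ ρ) (c ∷ cs) = cong (c ∷_) (tails ρ cs)

tri : ℕ → ℕ
tri zero    = 0
tri (suc n) = n + tri n

pos : ∀ {n} → Word n → ℕ
pos []              = 0
pos {suc n} (x ∷ w) = 𝟙 x * n + pos w

ones-∷ : ∀ {n} x (w : Word n) → ones (x ∷ w) ≡ 𝟙 x + ones w
ones-∷ true  w = refl
ones-∷ false w = refl

zeros-∷ : ∀ {n} x (w : Word n) → zeros (x ∷ w) ≡ 𝟙 (not x) + zeros w
zeros-∷ true  w = refl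
zeros-∷ false w = refl

inv-∷ : ∀ {n} x (w : Word n) → inv (x ∷ w) ≡ 𝟙 x * zeros w + inv w
inv-∷ true  w = cong (_+ inv w) (sym (+-identityʳ (zeros w)))
inv-∷ false w = refl

-- With all beads at the bottom the heights are 0, 1, 2 and so on; every gap below a bead raises the
-- total by one.
pos≡inv+tri : ∀ {n} (w : Word n) → pos w ≡ inv w + tri (ones w)
pos≡inv+tri []          = refl
pos≡inv+tri (false ∷ w) = pos≡inv+tri w
pos≡inv+tri {suc n} (true ∷ w)  = trans (cong₂ (λ m q → 1 * m + q) (sym (ones+zeros w)) (pos≡inv+tri w))
  (lemma (ones w) (zeros w) (inv w) (tri (ones w)))
  where
  lemma : ∀ o z i q → 1 * (o + z) + (i + q) ≡ (z + i) + (o + q)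
  lemma = solve-∀

ones-++ : ∀ {m n} (u : Word m) (w : Word n) → ones (u ++ᵛ w) ≡ ones u + ones w
ones-++ []          w = refl
ones-++ (true ∷ u)  w = cong suc (ones-++ u w)
ones-++ (false ∷ u) w = ones-++ u w

pos-++ : ∀ {m n} (u : Word m) (w : Word n) → pos (u ++ᵛ w) ≡ (pos u + n * ones u) + pos w
pos-++ {n = n} []      w = cong (_+ pos w) (sym (*-zeroʳ n))
pos-++ {suc m} {n} (x ∷ u) w = begin
  𝟙 x * (m + n) + pos (u ++ᵛ w)                     ≡⟨ cong (𝟙 x * (m + n) +_) (pos-++ u w) ⟩
  𝟙 x * (m + n) + (pos u + n * ones u + pos w)      ≡⟨ lemma (𝟙 x) m n (pos u) (ones u) (pos w) ⟩
  𝟙 x * m + pos u + n * (𝟙 x + ones u) + pos w      ≡⟨ cong (λ o → 𝟙 x * m + pos u + n * o + pos w) (ones-∷ x u) ⟨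
  𝟙 x * m + pos u + n * ones (x ∷ u) + pos w        ∎
  where
  open ≡-Reasoning
  lemma : ∀ x m n p o q → x * (m + n) + (p + n * o + q) ≡ x * m + p + n * (x + o) + q
  lemma = solve-∀

-- Minimal total height of beads when runner i carries the i-th entry many beads (heights y at T y + residue).
ground : ∀ {t} → ℕ → Vec ℕ t → ℕ
ground T []              = 0
ground {suc t} T (c ∷ cs) = (T * tri c + t * c) + ground T cs

-- A bead at height `y` of a runner with `t` runners after it has height `T * y + t` in the
-- interleaved word.
runners : ∀ {L t} → ℕ → Vec (Word L) t → ℕ
runners T []              = 0
runners {t = suc t} T (u ∷ cs) = (T * pos u + t * ones u) + runners T cs

runners≡ : ∀ {L t} T (cs : Vec (Word L) t) →
           runners T cs ≡ T * sumᵛ (mapᵛ inv cs) + ground T (mapᵛ ones cs)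
runners≡ T []       = cong (_+ 0) (sym (*-zeroʳ T))
runners≡ {t = suc t} T (u ∷ cs) = trans (cong₂ (λ q r → (T * q + t * ones u) + r) (pos≡inv+tri u) (runners≡ T cs))
  (lemma T (inv u) (tri (ones u)) (t * ones u) _ _)
  where
  lemma : ∀ T i q s S g → (T * (i + q) + s) + (T * S + g) ≡ T * (i + S) + (T * q + s + g)
  lemma = solve-∀

runners-tails : ∀ {L t} T (cs : Vec (Word (suc L)) t) →
  runners T cs ≡ (runners T (mapᵛ tail cs) + T * L * ones (mapᵛ head cs)) + pos (mapᵛ head cs)
runners-tails {L} T [] = sym (trans (+-identityʳ _) (*-zeroʳ (T * L)))
runners-tails {L} {suc t} T ((x ∷ u) ∷ cs) = begin
  T * (𝟙 x * L + pos u) + t * ones (x ∷ u) + runners T cs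
    ≡⟨ cong₂ (λ o r → T * (𝟙 x * L + pos u) + t * o + r) (ones-∷ x u) (runners-tails T cs) ⟩
  T * (𝟙 x * L + pos u) + t * (𝟙 x + ones u) + (runners T (mapᵛ tail cs) + T * L * ones hs + pos hs)
    ≡⟨ lemma T (𝟙 x) L (pos u) t (ones u) (runners T (mapᵛ tail cs)) (ones hs) (pos hs) ⟩
  T * pos u + t * ones u + runners T (mapᵛ tail cs) + T * L * (𝟙 x + ones hs) + (𝟙 x * t + pos hs)
    ≡⟨ cong (λ o → T * pos u + t * ones u + runners T (mapᵛ tail cs) + T * L * o + (𝟙 x * t + pos hs)) (ones-∷ x hs) ⟨
  T * pos u + t * ones u + runners T (mapᵛ tail cs) + T * L * ones (x ∷ hs) + (𝟙 x * t + pos hs) ∎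
  where
  open ≡-Reasoning
  hs = mapᵛ head cs
  lemma : ∀ T x L p t o r h q → T * (x * L + p) + t * (x + o) + (r + T * L * h + q)
                              ≡ T * p + t * o + r + T * L * (x + h) + (x * t + q)
  lemma = solve-∀

pos-interleave : ∀ {L t} (cs : Vec (Word L) t) → pos (interleave cs) ≡ runners t cs
pos-interleave {zero} {t} cs = sym (none t cs)
  where
  none : ∀ {t} T (cs : Vec (Word 0) t) → runners T cs ≡ 0
  none T []        = refl
  none {suc t} T ([] ∷ cs) = cong₂ _+_ (cong₂ _+_ (*-zeroʳ T) (*-zeroʳ t)) (none T cs)
pos-interleave {suc L} {t} cs = begin
  pos (hs ++ᵛ interleave ts)                     ≡⟨ pos-++ hs (interleave ts) ⟩
  pos hs + L * t * ones hs + pos (interleave ts) ≡⟨ cong (pos hs + L * t * ones hs +_) (pos-interleave ts) ⟩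
  pos hs + L * t * ones hs + runners t ts        ≡⟨ lemma (pos hs) L t (ones hs) (runners t ts) ⟩
  runners t ts + t * L * ones hs + pos hs        ≡⟨ runners-tails t cs ⟨
  runners t cs                                   ∎
  where
  open ≡-Reasoning
  hs = mapᵛ head cs
  ts = mapᵛ tail cs
  lemma : ∀ p L t o r → p + L * t * o + r ≡ r + t * L * o + p
  lemma = solve-∀

ones-interleave : ∀ {L t} (cs : Vec (Word L) t) → ones (interleave cs) ≡ sumᵛ (mapᵛ ones cs)
ones-interleave {zero} cs = sym (none cs)
  where
  none : ∀ {t} (cs : Vec (Word 0) t) → sumᵛ (mapᵛ ones cs) ≡ 0
  none []        = refl
  none ([] ∷ cs) = none cs
ones-interleave {suc L} cs = trans (ones-++ (mapᵛ head cs) _)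
  (trans (cong (ones (mapᵛ head cs) +_) (ones-interleave (mapᵛ tail cs))) (split cs))
  where
  split : ∀ {t} (cs : Vec (Word (suc L)) t) →
          ones (mapᵛ head cs) + sumᵛ (mapᵛ ones (mapᵛ tail cs)) ≡ sumᵛ (mapᵛ ones cs)
  split []             = refl
  split ((x ∷ u) ∷ cs) = trans (cong (_+ _) (ones-∷ x (mapᵛ head cs)))
    (trans (+-interchange (𝟙 x) _ (ones u) _)
     (cong₂ _+_ (sym (ones-∷ x u)) (split cs)))

multiple-self : ∀ T → multiple T T ≡ 1
multiple-self T = cong 𝟙 (dec-true (T ∣? T) ∣-refl)

multiple-small : ∀ {T h} → 1 ≤ h → h < T → multiple T h ≡ 0
multiple-small {T} {suc h} _ h<T = cong 𝟙 (dec-false (T ∣? suc h) (>⇒∤ h<T))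

multiple-periodic : ∀ T h → multiple T (T + h) ≡ multiple T h
multiple-periodic T h with T ∣? h
... | yes d = cong 𝟙 (dec-true (T ∣? (T + h)) (∣m∣n⇒∣m+n ∣-refl d))
... | no nd = cong 𝟙 (dec-false (T ∣? (T + h)) (λ d → nd (∣m+n∣m⇒∣n d ∣-refl)))

dist-++ : ∀ {m n} φ s (u : Word m) (w : Word n) → dist φ s (u ++ᵛ w) ≡ dist φ s u + dist φ (m + s) w
dist-++ φ s []          w = refl
dist-++ {suc m} φ s (true ∷ u)  w = trans (dist-++ φ (suc s) u w) (cong (λ r → dist φ (suc s) u + dist φ r w) (+-suc m s))
dist-++ {suc m} φ s (false ∷ u) w = trans (cong (φ s +_) (trans (dist-++ φ (suc s) u w) (cong (λ r → dist φ (suc s) u + dist φ r w) (+-suc m s))))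
  (sym (+-assoc (φ s) _ _))

dist-∷ : ∀ {n} φ s x (w : Word n) → dist φ s (x ∷ w) ≡ 𝟙 (not x) * φ s + dist φ (suc s) w
dist-∷ φ s true  w = refl
dist-∷ φ s false w = cong (_+ dist φ (suc s) w) (sym (+-identityʳ (φ s)))

dist-periodic : ∀ {n} T s (w : Word n) → dist (multiple T) (T + s) w ≡ dist (multiple T) s w
dist-periodic T s []      = refl
dist-periodic T s (x ∷ w) = trans (dist-∷ _ (T + s) x w)
  (trans (cong₂ (λ h d → 𝟙 (not x) * h + d) (multiple-periodic T s)
           (trans (cong (λ r → dist (multiple T) r w) (sym (+-suc T s))) (dist-periodic T (suc s) w)))
   (sym (dist-∷ _ s x w)))

dist-short : ∀ {m T s} (u : Word m) → 1 ≤ s → s + m ≤ T → dist (multiple T) s u ≡ 0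
dist-short         []      1≤s h = refl
dist-short {suc m} {T} {s} (x ∷ u) 1≤s h =
  trans (dist-∷ _ s x u)
  (trans (cong₂ (λ a b → 𝟙 (not x) * a + b)
      (multiple-small 1≤s (≤-trans (s≤s (m≤m+n s m)) (subst (_≤ T) (+-suc s m) h)))
      (dist-short u (s≤s z≤n) (subst (_≤ T) (+-suc s m) h)))
   (trans (+-identityʳ _) (*-zeroʳ (𝟙 (not x)))))

-- A row of at most `T` letters covers at most `T` consecutive distances, so the letter `i` is the
-- only one at a multiple of `T`.
dist-row : ∀ {m T s} (u : Word m) (i : Fin m) → 1 ≤ s → s + toℕ i ≡ T → m ≤ T →
           dist (multiple T) s u ≡ 𝟙 (not (lookup u i))
dist-row {suc m} {T} {s} (x ∷ u) Fin.zero 1≤s e m≤T = trans (dist-∷ _ s x u)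
  (trans (cong₂ (λ a b → 𝟙 (not x) * a + b)
      (trans (cong (multiple T) (trans (sym (+-identityʳ s)) e)) (multiple-self T))
      (trans (cong (λ r → dist (multiple T) r u) (trans (cong suc (trans (sym (+-identityʳ s)) e)) (+-comm 1 T)))
        (trans (dist-periodic T 1 u) (dist-short u ≤-refl m≤T))))
   (trans (+-identityʳ _) (*-identityʳ _)))
dist-row {suc m} {T} {s} (x ∷ u) (Fin.suc i) 1≤s e m≤T = trans (dist-∷ _ s x u)
  (trans (cong₂ (λ a b → 𝟙 (not x) * a + b)
      (multiple-small 1≤s (≤-trans (s≤s (m≤m+n s (toℕ i))) (≤-reflexive (trans (sym (+-suc s (toℕ i))) e))))
      (dist-row u i (s≤s z≤n) (trans (sym (+-suc s (toℕ i))) e) (≤-trans (n≤1+n m) m≤T)))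
   (cong (_+ 𝟙 (not (lookup u i))) (*-zeroʳ (𝟙 (not x)))))

dist-interleave : ∀ {L T s} (cs : Vec (Word L) T) (i : Fin T) → 1 ≤ s → s + toℕ i ≡ T →
                  dist (multiple T) s (interleave cs) ≡ zeros (lookup cs i)
dist-interleave {zero} cs i 1≤s e with [] ← lookup cs i = refl
dist-interleave {suc L} {T} {s} cs i 1≤s e = begin
  dist (multiple T) s (mapᵛ head cs ++ᵛ interleave (mapᵛ tail cs))
    ≡⟨ dist-++ _ s (mapᵛ head cs) _ ⟩
  dist (multiple T) s (mapᵛ head cs) + dist (multiple T) (T + s) (interleave (mapᵛ tail cs))
    ≡⟨ cong₂ _+_ (dist-row (mapᵛ head cs) i 1≤s e ≤-refl)
         (trans (dist-periodic T s (interleave (mapᵛ tail cs))) (dist-interleave (mapᵛ tail cs) i 1≤s e)) ⟩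
  𝟙 (not (lookup (mapᵛ head cs) i)) + zeros (lookup (mapᵛ tail cs) i)
    ≡⟨ cong₂ (λ x u → 𝟙 (not x) + zeros u) (Vec.lookup-map i head cs) (Vec.lookup-map i tail cs) ⟩
  𝟙 (not (head (lookup cs i))) + zeros (tail (lookup cs i))
    ≡⟨ merge (lookup cs i) ⟩
  zeros (lookup cs i) ∎
  where
  open ≡-Reasoning
  merge : ∀ {n} (w : Word (suc n)) → 𝟙 (not (head w)) + zeros (tail w) ≡ zeros w
  merge (x ∷ w) = sym (zeros-∷ x w)

crossing : ∀ {m n} → ℕ → Word m → Word n → ℕ
crossing T []      w = 0
crossing {suc m} T (x ∷ u) w = 𝟙 x * dist (multiple T) (suc m) w + crossing T u w

hooksOf-∷ : ∀ {n} T x (w : Word n) → hooksOf T (x ∷ w) ≡ 𝟙 x * dist (multiple T) 1 w + hooksOf T w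
hooksOf-∷ T true  w = cong (_+ hooksOf T w) (sym (+-identityʳ _))
hooksOf-∷ T false w = refl

-- Letters of a word of length at most `T` are less than `T` apart, so no hook inside `u` counts.
hooksOf-++ : ∀ {m n T} (u : Word m) (w : Word n) → m ≤ T → hooksOf T (u ++ᵛ w) ≡ crossing T u w + hooksOf T w
hooksOf-++ []      w m≤T = refl
hooksOf-++ {suc m} {T = T} (x ∷ u) w m≤T = begin
  hooksOf T (x ∷ u ++ᵛ w)
    ≡⟨ hooksOf-∷ T x (u ++ᵛ w) ⟩
  𝟙 x * dist (multiple T) 1 (u ++ᵛ w) + hooksOf T (u ++ᵛ w)
    ≡⟨ cong₂ (λ d h → 𝟙 x * d + h)
         (trans (dist-++ _ 1 u w) (cong₂ (λ a r → a + dist (multiple T) r w) (dist-short u ≤-refl m≤T) (+-comm m 1)))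
         (hooksOf-++ u w (≤-trans (n≤1+n m) m≤T)) ⟩
  𝟙 x * dist (multiple T) (suc m) w + (crossing T u w + hooksOf T w)
    ≡⟨ +-assoc (𝟙 x * dist (multiple T) (suc m) w) (crossing T u w) _ ⟨
  crossing T (x ∷ u) w + hooksOf T w ∎
  where open ≡-Reasoning

crossing-heads : ∀ {L m n} T (ds : Vec (Word (suc L)) m) (w : Word n) →
  (∀ i → dist (multiple T) (m ∸ toℕ i) w ≡ zeros (lookup (mapᵛ tail ds) i)) →
  crossing T (mapᵛ head ds) w + sumᵛ (mapᵛ inv (mapᵛ tail ds)) ≡ sumᵛ (mapᵛ inv ds)
crossing-heads T []             w h = refl
crossing-heads {m = suc m} T ((x ∷ u) ∷ ds) w h = begin
  (𝟙 x * dist (multiple T) (suc m) w + crossing T (mapᵛ head ds) w) + (inv u + sumᵛ (mapᵛ inv (mapᵛ tail ds)))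
    ≡⟨ +-interchange (𝟙 x * dist (multiple T) (suc m) w) _ (inv u) _ ⟩
  (𝟙 x * dist (multiple T) (suc m) w + inv u) + (crossing T (mapᵛ head ds) w + sumᵛ (mapᵛ inv (mapᵛ tail ds)))
    ≡⟨ cong₂ (λ z r → (𝟙 x * z + inv u) + r) (h Fin.zero) (crossing-heads T ds w (λ i → h (Fin.suc i))) ⟩
  (𝟙 x * zeros u + inv u) + sumᵛ (mapᵛ inv ds)
    ≡⟨ cong (_+ sumᵛ (mapᵛ inv ds)) (inv-∷ x u) ⟨
  inv (x ∷ u) + sumᵛ (mapᵛ inv ds) ∎
  where open ≡-Reasoning

hooksOf-interleave : ∀ {L T} (cs : Vec (Word L) T) → hooksOf T (interleave cs) ≡ sumᵛ (mapᵛ inv cs)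
hooksOf-interleave {zero} cs = sym (none cs)
  where
  none : ∀ {t} (cs : Vec (Word 0) t) → sumᵛ (mapᵛ inv cs) ≡ 0
  none []        = refl
  none ([] ∷ cs) = none cs
hooksOf-interleave {suc L} {T} cs = begin
  hooksOf T (mapᵛ head cs ++ᵛ interleave ts)                       ≡⟨ hooksOf-++ (mapᵛ head cs) (interleave ts) ≤-refl ⟩
  crossing T (mapᵛ head cs) (interleave ts) + hooksOf T (interleave ts) ≡⟨ cong (crossing T (mapᵛ head cs) (interleave ts) +_) (hooksOf-interleave ts) ⟩
  -- The letter in column `i` of the top row lies `T - i` above the start of the next row, so its
  -- distances to column `i` of the later rows are the multiples of `T`.
  crossing T (mapᵛ head cs) (interleave ts) + sumᵛ (mapᵛ inv ts)   ≡⟨ crossing-heads T cs (interleave ts)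
      (λ i → dist-interleave ts i (m<n⇒0<n∸m (Fin.toℕ<n i)) (m∸n+n≡m (<⇒≤ (Fin.toℕ<n i)))) ⟩
  sumᵛ (mapᵛ inv cs) ∎
  where
  open ≡-Reasoning
  ts = mapᵛ tail cs

-- Counting words by charge and energy

vecs-unique : ∀ {xs : List A} n → Unique xs → Unique (vecs xs n)
vecs-unique zero    u = [] ∷ []
vecs-unique (suc n) u = Unique.cartesianProductWith⁺ _∷_ Vec.∷-injective u (vecs-unique n u)

∈-vecs : ∀ {xs : List A} → (∀ x → x ∈ xs) → ∀ {n} (v : Vec A n) → v ∈ vecs xs n
∈-vecs all []      = here refl
∈-vecs all (x ∷ v) = ∈-cartesianProductWith⁺ _∷_ (all x) (∈-vecs all v)

bits : List Bool
bits = false ∷ true ∷ []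

∈-bits : ∀ b → b ∈ bits
∈-bits false = here refl
∈-bits true  = there (here refl)

bits-unique : Unique bits
bits-unique = ((λ ()) ∷ []) ∷ [] ∷ []

map-unique : ∀ {f : A → B} {xs} → (∀ {x y} → x ∈ xs → y ∈ xs → f x ≡ f y → x ≡ y) → Unique xs → Unique (map f xs)
map-unique inj []       = []
map-unique {f = f} {x ∷ xs} inj (x≢ ∷ u) =
  All.map⁺ (All.tabulate (λ {y} y∈ e → All.lookup x≢ y∈ (inj (here refl) (there y∈) e)))
  ∷ map-unique (λ x∈ y∈ → inj (there x∈) (there y∈)) u

unique-↭ : ∀ {xs ys : List A} → Unique xs → Unique ys → (∀ {x} → x ∈ xs → x ∈ ys) → (∀ {x} → x ∈ ys → x ∈ xs) → xs ↭ ys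
unique-↭ u v f g = ∼bag⇒↭ (unique∧set⇒bag u v (mk⇔ f g))

words : ∀ L → List (Word L)
words = vecs bits

∑-words : ∀ L (F : Word (suc L) → ℕ) → ∑ (words (suc L)) F ≡ (∑[ w ∈ words L ] F (false ∷ w)) + (∑[ w ∈ words L ] F (true ∷ w))
∑-words L F = trans (∑-vecs bits L F) (cong (∑ (words L) (F ∘ (false ∷_)) +_) (+-identityʳ _))

runnerTuples : ∀ L t → List (Vec (Word L) t)
runnerTuples L = vecs (words L)

-- As `n ≤ k` there is a bead for each part, and as `n + k ≤ L * t` there are gaps enough for the
-- largest part; so every partition of `n` has exactly one word with `k` beads.
∑-partitions : ∀ {L t k n} (g : List ℕ → ℕ) → n ≤ k → n + k ≤ L * t →
  ∑ (partitions n) g ≡ ∑[ cs ∈ runnerTuples L t ] (δ (ones (interleave cs)) k * (δ (inv (interleave cs)) n * g (shape (interleave cs))))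
∑-partitions {L} {t} {k} {n} g n≤k n+k≤ = begin
  ∑ (partitions n) g             ≡⟨ ∑-↭ g (unique-↭ (partitions-unique n) image-unique to from) ⟩
  ∑ (map (shape ∘ interleave) good) g ≡⟨ ∑-map (shape ∘ interleave) good g ⟩
  ∑ good (g ∘ shape ∘ interleave) ≡⟨ ∑-filter Good? (runnerTuples L t) _ ⟩
  (∑[ cs ∈ runnerTuples L t ] (𝟙 ((ones (interleave cs) ≡ᵇ k) ∧ (inv (interleave cs) ≡ᵇ n)) * g (shape (interleave cs))))
    ≡⟨ ∑-cong (runnerTuples L t) (λ cs → 𝟙-∧ (ones (interleave cs) ≡ᵇ k) (inv (interleave cs) ≡ᵇ n)) ⟩
  (∑[ cs ∈ runnerTuples L t ] (δ (ones (interleave cs)) k * (δ (inv (interleave cs)) n * g (shape (interleave cs))))) ∎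
  where
  open ≡-Reasoning
  Good? : ∀ (cs : Vec (Word L) t) → Dec (ones (interleave cs) ≡ k × inv (interleave cs) ≡ n)
  Good? cs = (ones (interleave cs) ≟ k) ×-dec (inv (interleave cs) ≟ n)
  good = filter Good? (runnerTuples L t)
  𝟙-∧ : ∀ a b {x} → 𝟙 (a ∧ b) * x ≡ 𝟙 a * (𝟙 b * x)
  𝟙-∧ true  b = sym (+-identityʳ _)
  𝟙-∧ false b = refl
  tuples-unique = vecs-unique t (vecs-unique L bits-unique)
  good⁻ : ∀ {cs} → cs ∈ good → ones (interleave cs) ≡ k × inv (interleave cs) ≡ n
  good⁻ i = proj₂ (∈-filter⁻ Good? {xs = runnerTuples L t} i)
  zeros-good : ∀ {cs} → cs ∈ good → k + zeros (interleave cs) ≡ L * t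
  zeros-good {cs} i = trans (cong (_+ _) (sym (proj₁ (good⁻ i)))) (ones+zeros (interleave cs))
  image-unique : Unique (map (shape ∘ interleave) good)
  image-unique = map-unique
    (λ {cs} {ds} i j e → interleave-injective cs ds (shape-injective (interleave cs) (interleave ds)
       (+-cancelˡ-≡ k _ _ (trans (zeros-good i) (sym (zeros-good j)))) e))
    (Unique.filter⁺ Good? tuples-unique)
  from : ∀ {l} → l ∈ map (shape ∘ interleave) good → l ∈ partitions n
  from i with cs , j , refl ← ∈-map⁻ (shape ∘ interleave) i =
    ∈-partitions⁺ (subst (λ m → IsPartition m (shape (interleave cs))) (proj₂ (good⁻ j)) (shape-isPartition (interleave cs)))
  to : ∀ {l} → l ∈ partitions n → l ∈ map (shape ∘ interleave) good
  to {l} i with lk , ps , refl ← ∈-partitions⁻ {n} i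
    with w , o , z , refl ← shape-surjective (L * t) l k (L * t ∸ k) (m+[n∸m]≡n (≤-trans (m≤n+m k n) n+k≤)) lk ps
           (All.map (λ h → ≤-trans h (m+n≤o⇒m≤o∸n n n+k≤)) (sum-≥ l)) (≤-trans (length≤sum ps) n≤k)
    with cs , refl ← interleave-surjective {L} {t} w =
    ∈-map⁺ (shape ∘ interleave) (∈-filter⁺ Good? (∈-vecs (∈-vecs ∈-bits) cs) (o , sym (shape-sum (interleave cs))))

-- The coefficient of q^e in the Gaussian binomial coefficient of `L` over `c`.
wordCount : ℕ → ℕ → ℕ → ℕ
wordCount L c e = ∑[ u ∈ words L ] (δ (ones u) c * δ (inv u) e)

wordCount-> : ∀ {L c} e → L < c → wordCount L c e ≡ 0
wordCount-> {L} {c} e L<c = trans (∑-cong (words L) (λ u → cong (_* δ (inv u) e)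
    (δ-≢ (λ o → <⇒≱ L<c (subst (_≤ L) o (subst (ones u ≤_) (ones+zeros u) (m≤m+n _ _)))))))
  (∑-0 (words L))

wordCount-gaps : ∀ L c z e → c + z ≡ L →
  ∑[ u ∈ words L ] (δ (ones u) c * δ (zeros u + inv u) e) ≡ shift z (wordCount L c) e
wordCount-gaps L c z e eq = trans (∑-cong (words L) (λ u → δ-guard (ones u) c (λ o →
    cong (λ y → δ (y + inv u) e) (+-cancelˡ-≡ c _ _ (trans (cong (_+ zeros u) (sym o)) (trans (ones+zeros u) (sym eq)))))))
  (go z e)
  where
  go : ∀ z e → ∑[ u ∈ words L ] (δ (ones u) c * δ (z + inv u) e) ≡ shift z (wordCount L c) e
  go zero    e       = refl
  go (suc z) zero    = trans (∑-cong (words L) (λ u → *-zeroʳ (δ (ones u) c))) (∑-0 (words L))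
  go (suc z) (suc e) = go z e

-- The Gaussian recursion by the first letter becomes that of `pp` when the number of parts is no
-- constraint, for which `e ≤ c` suffices. Removing a bead lowers `e` by `z`, so the bound survives
-- if `z` is positive; for `z ≡ 0` it would not, hence the alternative.
wordCount≡pp : ∀ L c z e → c + z ≡ L → z ≡ 0 ⊎ e ≤ c → wordCount L c e ≡ pp z e
wordCount≡pp zero    zero    zero    e eq h = trans (+-identityʳ _) (+-identityʳ _)
wordCount≡pp (suc L) zero    (suc z) zero eq (inj₂ _) = begin
  wordCount (suc L) 0 0                     ≡⟨ ∑-words L _ ⟩
  wordCount L 0 0 + (∑[ u ∈ words L ] 0)      ≡⟨ cong₂ _+_ (wordCount≡pp L 0 z 0 (suc-injective eq) (inj₂ z≤n)) (∑-0 (words L)) ⟩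
  pp z 0 + 0                                ≡⟨ geom-unfold z (pp z) 0 ⟨
  pp (suc z) 0                              ∎
  where open ≡-Reasoning
wordCount≡pp (suc L) (suc c) zero e eq h = begin
  wordCount (suc L) (suc c) e               ≡⟨ ∑-words L _ ⟩
  wordCount L (suc c) e + (∑[ u ∈ words L ] (δ (ones u) c * δ (zeros u + inv u) e))
    ≡⟨ cong₂ _+_ (wordCount-> e (s≤s (≤-reflexive (sym c≡L)))) (wordCount-gaps L c 0 e (suc-injective eq)) ⟩
  wordCount L c e                           ≡⟨ wordCount≡pp L c 0 e (suc-injective eq) (inj₁ refl) ⟩
  pp 0 e                                    ∎
  where
  open ≡-Reasoning
  c≡L : c ≡ L
  c≡L = trans (sym (+-identityʳ c)) (suc-injective eq)
wordCount≡pp (suc L) (suc c) (suc z) e eq (inj₂ e≤c) = begin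
  wordCount (suc L) (suc c) e               ≡⟨ ∑-words L _ ⟩
  wordCount L (suc c) e + (∑[ u ∈ words L ] (δ (ones u) c * δ (zeros u + inv u) e))
    ≡⟨ cong₂ _+_ (wordCount≡pp L (suc c) z e (suc-injective (trans (sym (+-suc (suc c) z)) eq)) (inj₂ e≤c))
         (wordCount-gaps L c (suc z) e (suc-injective eq)) ⟩
  pp z e + shift (suc z) (wordCount L c) e
    ≡⟨ cong (pp z e +_) (shift-cong (suc z) e (λ m em → wordCount≡pp L c (suc z) m (suc-injective eq)
         (inj₂ (s≤s⁻¹ (≤-trans (≤-trans (s≤s (m≤n+m m z)) (≤-reflexive em)) e≤c))))) ⟩
  pp z e + shift (suc z) (pp (suc z)) e     ≡⟨ geom-unfold z (pp z) e ⟨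
  pp (suc z) e                              ∎
  where open ≡-Reasoning

weight : ∀ {t} → (ℕ → ℕ → ℕ) → Vec ℕ t → Vec ℕ t → ℕ
weight f []       []       = 1
weight f (c ∷ cs) (e ∷ es) = f c e * weight f cs es

module _ {L X Y} (L<X : L < X) (L²<Y : L * L < Y) where

  ones≤ : ∀ {n} (u : Word n) → ones u ≤ n
  ones≤ u = subst (ones u ≤_) (ones+zeros u) (m≤m+n _ _)

  inv≤ : ∀ {n} (u : Word n) → inv u ≤ n * n
  inv≤ []                  = z≤n
  inv≤ {suc n} (true ∷ u)  = +-mono-≤ (≤-trans (subst (zeros u ≤_) (ones+zeros u) (m≤n+m _ _)) (n≤1+n n))
                               (≤-trans (inv≤ u) (*-monoʳ-≤ n (n≤1+n n)))
  inv≤ {suc n} (false ∷ u) = ≤-trans (inv≤ u) (≤-trans (*-monoʳ-≤ n (n≤1+n n)) (m≤n+m _ (suc n)))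

  ∑-by-stats : ∀ (h : ℕ → ℕ → ℕ) →
    ∑[ u ∈ words L ] h (ones u) (inv u) ≡ ∑[ c ∈ upTo X ] ∑[ e ∈ upTo Y ] (wordCount L c e * h c e)
  ∑-by-stats h = begin
    (∑[ u ∈ words L ] h (ones u) (inv u))
      ≡⟨ ∑-cong (words L) (λ u → sym (trans
           (∑-cong (upTo X) (λ c → trans (∑-cong (upTo Y) (λ e → *-assoc (δ (ones u) c) _ _)) (∑-*ˡ (δ (ones u) c) (upTo Y) _)))
           (trans (∑-δ (λ c → ∑[ e ∈ upTo Y ] (δ (inv u) e * h c e)) (≤-trans (s≤s (ones≤ u)) L<X))
                  (∑-δ (h (ones u)) (≤-trans (s≤s (inv≤ u)) L²<Y))))) ⟩
    (∑[ u ∈ words L ] ∑[ c ∈ upTo X ] ∑[ e ∈ upTo Y ] (δ (ones u) c * δ (inv u) e * h c e))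
      ≡⟨ ∑-swap (words L) (upTo X) _ ⟩
    (∑[ c ∈ upTo X ] ∑[ u ∈ words L ] ∑[ e ∈ upTo Y ] (δ (ones u) c * δ (inv u) e * h c e))
      ≡⟨ ∑-cong (upTo X) (λ c → trans (∑-swap (words L) (upTo Y) _)
           (∑-cong (upTo Y) (λ e → ∑-*ʳ (words L) _ (h c e)))) ⟩
    (∑[ c ∈ upTo X ] ∑[ e ∈ upTo Y ] (wordCount L c e * h c e)) ∎
    where open ≡-Reasoning

  -- The runners are independent, so tuples with prescribed statistics are counted by a product with
  -- one Gaussian coefficient for each runner.
  ∑-runnerTuples : ∀ t (G : Vec ℕ t → Vec ℕ t → ℕ) →
    ∑[ cs ∈ runnerTuples L t ] G (mapᵛ ones cs) (mapᵛ inv cs)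
    ≡ ∑[ c ∈ vecs (upTo X) t ] ∑[ e ∈ vecs (upTo Y) t ] (weight (wordCount L) c e * G c e)
  ∑-runnerTuples zero    G = sym (trans (+-identityʳ _) (trans (+-identityʳ _) (trans (+-identityʳ _) (sym (+-identityʳ _)))))
  ∑-runnerTuples (suc t) G = begin
    ∑ (runnerTuples L (suc t)) (λ cs → G (mapᵛ ones cs) (mapᵛ inv cs))
      ≡⟨ ∑-vecs (words L) t _ ⟩
    (∑[ u ∈ words L ] ∑[ cs ∈ runnerTuples L t ] G (ones u ∷ mapᵛ ones cs) (inv u ∷ mapᵛ inv cs))
      ≡⟨ ∑-cong (words L) (λ u → ∑-runnerTuples t (λ c e → G (ones u ∷ c) (inv u ∷ e))) ⟩
    (∑[ u ∈ words L ] H (ones u) (inv u))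
      ≡⟨ ∑-by-stats H ⟩
    (∑[ c₀ ∈ upTo X ] ∑[ e₀ ∈ upTo Y ] (wordCount L c₀ e₀ * H c₀ e₀))
      ≡⟨ ∑-cong (upTo X) (λ c₀ → trans
           (∑-cong (upTo Y) (λ e₀ → trans (sym (∑-*ˡ (wordCount L c₀ e₀) (vecs (upTo X) t) _))
              (∑-cong (vecs (upTo X) t) (λ c → trans (sym (∑-*ˡ (wordCount L c₀ e₀) (vecs (upTo Y) t) _))
                 (∑-cong (vecs (upTo Y) t) (λ e → sym (*-assoc (wordCount L c₀ e₀) _ _)))))))
           (∑-swap (upTo Y) (vecs (upTo X) t) _)) ⟩
    (∑[ c₀ ∈ upTo X ] ∑[ c ∈ vecs (upTo X) t ] ∑[ e₀ ∈ upTo Y ] ∑[ e ∈ vecs (upTo Y) t ]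
       (weight (wordCount L) (c₀ ∷ c) (e₀ ∷ e) * G (c₀ ∷ c) (e₀ ∷ e)))
      ≡⟨ ∑-cong (upTo X) (λ c₀ → ∑-cong (vecs (upTo X) t) (λ c → sym (∑-vecs (upTo Y) t _))) ⟩
    (∑[ c₀ ∈ upTo X ] ∑[ c ∈ vecs (upTo X) t ] ∑[ e ∈ vecs (upTo Y) (suc t) ]
       (weight (wordCount L) (c₀ ∷ c) e * G (c₀ ∷ c) e))
      ≡⟨ ∑-vecs (upTo X) t _ ⟨
    (∑[ c ∈ vecs (upTo X) (suc t) ] ∑[ e ∈ vecs (upTo Y) (suc t) ] (weight (wordCount L) c e * G c e)) ∎
    where
    open ≡-Reasoning
    H : ℕ → ℕ → ℕ
    H c₀ e₀ = ∑[ c ∈ vecs (upTo X) t ] ∑[ e ∈ vecs (upTo Y) t ] (weight (wordCount L) c e * G (c₀ ∷ c) (e₀ ∷ e))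

-- The lattice of charges

tri-+ : ∀ a b → tri (a + b) ≡ tri a + tri b + a * b
tri-+ zero    b = sym (+-identityʳ (tri b))
tri-+ (suc a) b = trans (cong (a + b +_) (tri-+ a b)) (lemma a b (tri a) (tri b))
  where
  lemma : ∀ a b x y → a + b + (x + y + a * b) ≡ a + x + y + (b + a * b)
  lemma = solve-∀

square≡tri : ∀ v → v * v ≡ 2 * tri v + v
square≡tri zero    = refl
square≡tri (suc v) = trans (lemma₁ v) (trans (cong (λ s → s + 2 * v + 1) (square≡tri v)) (lemma₂ v (tri v)))
  where
  lemma₁ : ∀ v → suc v * suc v ≡ v * v + 2 * v + 1
  lemma₁ = solve-∀
  lemma₂ : ∀ v t → 2 * t + v + 2 * v + 1 ≡ 2 * (v + t) + suc v
  lemma₂ = solve-∀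

-- The ground energy lies above its tangent at the balanced charge C, with slope 2 T C - 1, by at
-- least the distance from C; both sides are moved so that no subtraction occurs.
tangent : ∀ {T m} c C → m < T →
  2 * (T * tri C + m * C) + 2 * (T * C) * c + C + ∣ c - C ∣ ≤ 2 * (T * tri c + m * c) + 2 * (T * C) * C + c
tangent {T} {m} c C m<T with ≤-total C c
... | inj₁ C≤c with v ← c ∸ C | refl ← sym (m+[n∸m]≡n C≤c) = begin
  2 * (T * tri C + m * C) + 2 * (T * C) * (C + v) + C + ∣ C + v - C ∣
    ≡⟨ cong (2 * (T * tri C + m * C) + 2 * (T * C) * (C + v) + C +_) (∣m+n-m∣≡n C v) ⟩
  2 * (T * tri C + m * C) + 2 * (T * C) * (C + v) + C + v
    -- The slack to the right of `C`. One slope serves all residues `m < T`: `2 T C - 1` lies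
    -- strictly between the left difference, at most `2 T C - 2`, and the right one, at least
    -- `2 T C`.
    ≤⟨ m≤m+n _ (2 * T * tri v + 2 * m * v) ⟩
  2 * (T * tri C + m * C) + 2 * (T * C) * (C + v) + C + v + (2 * T * tri v + 2 * m * v)
    ≡⟨ lemma T (tri C) m C v (tri v) ⟩
  2 * (T * (tri C + tri v + C * v) + m * (C + v)) + 2 * (T * C) * C + (C + v)
    ≡⟨ cong (λ x → 2 * (T * x + m * (C + v)) + 2 * (T * C) * C + (C + v)) (tri-+ C v) ⟨
  2 * (T * tri (C + v) + m * (C + v)) + 2 * (T * C) * C + (C + v) ∎
  where
  open ≤-Reasoning
  ∣m+n-m∣≡n : ∀ m n → ∣ m + n - m ∣ ≡ n
  ∣m+n-m∣≡n zero    n = ∣-∣-identityʳ n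
  ∣m+n-m∣≡n (suc m) n = ∣m+n-m∣≡n m n
  lemma : ∀ T x m C v y → 2 * (T * x + m * C) + 2 * (T * C) * (C + v) + C + v + (2 * T * y + 2 * m * v)
                        ≡ 2 * (T * (x + y + C * v) + m * (C + v)) + 2 * (T * C) * C + (C + v)
  lemma = solve-∀
... | inj₂ c≤C with v ← C ∸ c | refl ← sym (m+[n∸m]≡n c≤C) | d ← T ∸ suc m | refl ← sym (m+[n∸m]≡n m<T) = begin
  2 * (T′ * tri (c + v) + m * (c + v)) + 2 * (T′ * (c + v)) * c + (c + v) + ∣ c - (c + v) ∣
    ≡⟨ cong₂ (λ x y → 2 * (T′ * x + m * (c + v)) + 2 * (T′ * (c + v)) * c + (c + v) + y) (tri-+ c v) (∣m-m+n∣≡n c v) ⟩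
  2 * (T′ * (tri c + tri v + c * v) + m * (c + v)) + 2 * (T′ * (c + v)) * c + (c + v) + v
    ≤⟨ m≤m+n _ (2 * T′ * tri v + 2 * d * v) ⟩
  2 * (T′ * (tri c + tri v + c * v) + m * (c + v)) + 2 * (T′ * (c + v)) * c + (c + v) + v + (2 * T′ * tri v + 2 * d * v)
    ≡⟨ lemma m d (tri c) c v (tri v) ⟩
  2 * (T′ * tri c + m * c) + 2 * T′ * (c * c + 2 * c * v + (2 * tri v + v)) + c
    ≡⟨ cong (λ s → 2 * (T′ * tri c + m * c) + 2 * T′ * (c * c + 2 * c * v + s) + c) (square≡tri v) ⟨
  2 * (T′ * tri c + m * c) + 2 * T′ * (c * c + 2 * c * v + v * v) + c
    ≡⟨ lemma′ T′ (tri c) m c v ⟩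
  2 * (T′ * tri c + m * c) + 2 * (T′ * (c + v)) * (c + v) + c ∎
  where
  open ≤-Reasoning
  T′ = suc m + d
  lemma : ∀ m d x c v y →
    2 * ((suc m + d) * (x + y + c * v) + m * (c + v)) + 2 * ((suc m + d) * (c + v)) * c + (c + v) + v + (2 * (suc m + d) * y + 2 * d * v)
    ≡ 2 * ((suc m + d) * x + m * c) + 2 * (suc m + d) * (c * c + 2 * c * v + (2 * y + v)) + c
  lemma = solve-∀
  lemma′ : ∀ T x m c v → 2 * (T * x + m * c) + 2 * T * (c * c + 2 * c * v + v * v) + c
                       ≡ 2 * (T * x + m * c) + 2 * (T * (c + v)) * (c + v) + c
  lemma′ = solve-∀

deviation : ∀ {t} → ℕ → Vec ℕ t → ℕ
deviation C []       = 0
deviation C (c ∷ cs) = ∣ c - C ∣ + deviation C cs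

deviation-lookup : ∀ {t} C (c : Vec ℕ t) i → ∣ lookup c i - C ∣ ≤ deviation C c
deviation-lookup C (c ∷ cs) Fin.zero    = m≤m+n _ _
deviation-lookup C (c ∷ cs) (Fin.suc i) = ≤-trans (deviation-lookup C cs i) (m≤n+m _ _)

-- All runners share the slope at `C`, so the linear terms see the charges only through their sum,
-- which will be fixed.
tangents : ∀ {t T} (c : Vec ℕ t) C → t ≤ T →
  2 * (T * (t * tri C) + tri t * C) + 2 * (T * C) * sumᵛ c + t * C + deviation C c
  ≤ 2 * ground T c + 2 * (T * C) * (t * C) + sumᵛ c
tangents {T = T} [] C _ = ≤-trans (≤-reflexive (lemma T C)) z≤n
  where
  lemma : ∀ T C → 2 * (T * 0 + 0) + 2 * (T * C) * 0 + 0 + 0 ≡ 0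
  lemma = solve-∀
tangents {suc t} {T} (c ∷ cs) C t<T = begin
  2 * (T * (suc t * tri C) + (t + tri t) * C) + 2 * (T * C) * (c + sumᵛ cs) + suc t * C + (∣ c - C ∣ + deviation C cs)
    ≡⟨ lemma T t (tri C) (tri t) C c (sumᵛ cs) ∣ c - C ∣ (deviation C cs) ⟩
  (2 * (T * tri C + t * C) + 2 * (T * C) * c + C + ∣ c - C ∣)
    + (2 * (T * (t * tri C) + tri t * C) + 2 * (T * C) * sumᵛ cs + t * C + deviation C cs)
    ≤⟨ +-mono-≤ (tangent c C t<T) (tangents cs C (<⇒≤ t<T)) ⟩
  (2 * (T * tri c + t * c) + 2 * (T * C) * C + c) + (2 * ground T cs + 2 * (T * C) * (t * C) + sumᵛ cs)
    ≡⟨ lemma′ T t (tri c) C c (sumᵛ cs) (ground T cs) ⟩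
  2 * (T * tri c + t * c + ground T cs) + 2 * (T * C) * (suc t * C) + (c + sumᵛ cs) ∎
  where
  open ≤-Reasoning
  lemma : ∀ T t x y C c s a d → 2 * (T * (suc t * x) + (t + y) * C) + 2 * (T * C) * (c + s) + suc t * C + (a + d)
    ≡ (2 * (T * x + t * C) + 2 * (T * C) * c + C + a) + (2 * (T * (t * x) + y * C) + 2 * (T * C) * s + t * C + d)
  lemma = solve-∀
  lemma′ : ∀ T t x C c s g → (2 * (T * x + t * c) + 2 * (T * C) * C + c) + (2 * g + 2 * (T * C) * (t * C) + s)
    ≡ 2 * (T * x + t * c + g) + 2 * (T * C) * (suc t * C) + (c + s)
  lemma′ = solve-∀

-- Equal charges `C` on all runners are `T * C` beads pushed to the bottom of the word, the picture
-- of the empty partition.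
tri-* : ∀ T C → 2 * tri (T * C) ≡ 2 * (T * (T * tri C) + tri T * C)
tri-* T C = +-cancelʳ-≡ (T * C) _ _ (begin
  2 * tri (T * C) + T * C                             ≡⟨ square≡tri (T * C) ⟨
  T * C * (T * C)                                     ≡⟨ lemma₁ T C ⟩
  T * T * (C * C)                                     ≡⟨ cong (T * T *_) (square≡tri C) ⟩
  T * T * (2 * tri C + C)                             ≡⟨ lemma₂ T (tri C) C ⟩
  2 * (T * (T * tri C)) + T * T * C                   ≡⟨ cong (λ s → 2 * (T * (T * tri C)) + s * C) (square≡tri T) ⟩
  2 * (T * (T * tri C)) + (2 * tri T + T) * C         ≡⟨ lemma₃ T (tri C) (tri T) C ⟩
  2 * (T * (T * tri C) + tri T * C) + T * C           ∎)
  where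
  open ≡-Reasoning
  lemma₁ : ∀ T C → T * C * (T * C) ≡ T * T * (C * C)
  lemma₁ = solve-∀
  lemma₂ : ∀ T x C → T * T * (2 * x + C) ≡ 2 * (T * (T * x)) + T * T * C
  lemma₂ = solve-∀
  lemma₃ : ∀ T x y C → 2 * (T * (T * x)) + (2 * y + T) * C ≡ 2 * (T * (T * x) + y * C) + T * C
  lemma₃ = solve-∀

-- Confines the lattice: the distance of the charges from the balanced ones is paid for by the size
-- `n`, and so are the levels.
charge-bound : ∀ {T n S} (c : Vec ℕ T) C → sumᵛ c ≡ T * C → T * S + ground T c ≡ n + tri (T * C) →
               deviation C c + 2 * (T * S) ≤ 2 * n
charge-bound {T} {n} {S} c C sum≡ energy≡ = +-cancelʳ-≤ (2 * tri (T * C)) _ _ (begin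
  deviation C c + 2 * (T * S) + 2 * tri (T * C)  ≡⟨ shuffle (deviation C c) (2 * (T * S)) (2 * tri (T * C)) ⟩
  (2 * tri (T * C) + deviation C c) + 2 * (T * S) ≤⟨ +-monoˡ-≤ (2 * (T * S)) bound ⟩
  2 * ground T c + 2 * (T * S)                    ≡⟨ shuffle′ (ground T c) (T * S) ⟩
  2 * (T * S + ground T c)                        ≡⟨ cong (2 *_) energy≡ ⟩
  2 * (n + tri (T * C))                           ≡⟨ *-distribˡ-+ 2 n _ ⟩
  2 * n + 2 * tri (T * C)                         ∎)
  where
  open ≤-Reasoning
  shuffle : ∀ a b c → a + b + c ≡ (c + a) + b
  shuffle = solve-∀
  shuffle′ : ∀ a b → 2 * a + 2 * b ≡ 2 * (b + a)
  shuffle′ = solve-∀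
  R = 2 * (T * C) * (T * C) + T * C
  bound : 2 * tri (T * C) + deviation C c ≤ 2 * ground T c
  bound = +-cancelʳ-≤ R _ _ (begin
    2 * tri (T * C) + deviation C c + R
      ≡⟨ cong (λ x → x + deviation C c + R) (tri-* T C) ⟩
    2 * (T * (T * tri C) + tri T * C) + deviation C c + R
      ≡⟨ shuffle₁ (2 * (T * (T * tri C) + tri T * C)) (deviation C c) (2 * (T * C) * (T * C)) (T * C) ⟩
    2 * (T * (T * tri C) + tri T * C) + 2 * (T * C) * (T * C) + T * C + deviation C c
      ≡⟨ cong (λ s → 2 * (T * (T * tri C) + tri T * C) + 2 * (T * C) * s + T * C + deviation C c) (sym sum≡) ⟩
    2 * (T * (T * tri C) + tri T * C) + 2 * (T * C) * sumᵛ c + T * C + deviation C c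
      ≤⟨ tangents c C ≤-refl ⟩
    2 * ground T c + 2 * (T * C) * (T * C) + sumᵛ c
      ≡⟨ cong (2 * ground T c + 2 * (T * C) * (T * C) +_) sum≡ ⟩
    2 * ground T c + 2 * (T * C) * (T * C) + T * C
      ≡⟨ +-assoc (2 * ground T c) _ _ ⟩
    2 * ground T c + R ∎)
    where
    shuffle₁ : ∀ a b c d → a + b + (c + d) ≡ a + c + d + b
    shuffle₁ = solve-∀

∏P : ∀ {t} → Vec ℕ t → ℕ
∏P []       = 1
∏P (e ∷ es) = P e * ∏P es

weight≡∏P : ∀ {t f} (c e : Vec ℕ t) → (∀ i → f (lookup c i) (lookup e i) ≡ P (lookup e i)) → weight f c e ≡ ∏P e
weight≡∏P []      []      h = refl
weight≡∏P (_ ∷ c) (_ ∷ e) h = cong₂ _*_ (h Fin.zero) (weight≡∏P c e (h ∘ Fin.suc))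

lookup≤sum : ∀ {t} (e : Vec ℕ t) i → lookup e i ≤ sumᵛ e
lookup≤sum (e ∷ es) Fin.zero    = m≤m+n e _
lookup≤sum (e ∷ es) (Fin.suc i) = ≤-trans (lookup≤sum es i) (m≤n+m _ e)

-- T runners of length 8 N, each with about 4 N beads: long enough that no charge or partition
-- occurring for n ≤ N feels the ends.
module Lattice (T N : ℕ) (0<T : 0 < T) where

  C L K X Y : ℕ
  C = 4 * N
  L = 8 * N
  K = T * C
  X = suc L
  -- `L * L` bounds the inversions of a runner; `N + tri K` bounds every entry of a tuple that
  -- satisfies the energy equation, so that tuples may be enlarged without leaving the box.
  Y = suc (L * L + (N + tri K))

  box levels : List (Vec ℕ T)
  box    = vecs (upTo X) T
  levels = vecs (upTo Y) T

  -- The constraints on a partition of `n` with charges `c` and `S` hooks divisible by `T`. Heights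
  -- are added rather than inversions, whence `tri K`.
  record Balanced (n : ℕ) (c : Vec ℕ T) (S : ℕ) : Set where
    constructor balanced
    field
      charge : sumᵛ c ≡ K
      energy : T * S + ground T c ≡ n + tri K

  fill : ℕ → ℕ → ℕ
  fill M x = ∑[ e ∈ levels ] (δ (T * sumᵛ e + x) M * ∏P e)

  -- For `n ≤ N`, the number of partitions of `n` whose `T`-core has charges `c`; `fill` counts
  -- their `T`-quotients.
  mass : ℕ → Vec ℕ T → ℕ
  mass n c = δ (sumᵛ c) K * fill (n + tri K) (ground T c)

  T*-≥ : ∀ S → S ≤ T * S
  T*-≥ S = subst (_≤ T * S) (+-identityʳ S) (*-monoˡ-≤ S 0<T)

  balanced-level : ∀ {n c S} → Balanced n c S → S ≤ n
  balanced-level {n} {c} {S} (balanced s e) = ≤-trans (T*-≥ S) (*-cancelˡ-≤ 2 (≤-trans (m≤n+m _ (deviation C c)) (charge-bound c C s e)))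

  balanced-dev : ∀ {n c S} → Balanced n c S → ∀ i → ∣ lookup c i - C ∣ ≤ 2 * n
  balanced-dev {n} {c} {S} (balanced s e) i =
    ≤-trans (deviation-lookup C c i) (≤-trans (m≤m+n _ (2 * (T * S))) (charge-bound c C s e))

  balanced-≥ : ∀ {n c S} → n ≤ N → Balanced n c S → ∀ i → 2 * N ≤ lookup c i
  balanced-≥ {n} {c} n≤N b i = +-cancelʳ-≤ (2 * N) _ _ (begin
    2 * N + 2 * N                   ≡⟨ lemma N ⟩
    C                               ≤⟨ m≤n+∣n-m∣ C (lookup c i) ⟩
    lookup c i + ∣ lookup c i - C ∣ ≤⟨ +-monoʳ-≤ (lookup c i) (≤-trans (balanced-dev b i) (*-monoʳ-≤ 2 n≤N)) ⟩
    lookup c i + 2 * N              ∎)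
    where
    open ≤-Reasoning
    lemma : ∀ N → 2 * N + 2 * N ≡ 4 * N
    lemma = solve-∀

  balanced-≤ : ∀ {n c S} → n ≤ N → Balanced n c S → ∀ i → lookup c i ≤ 6 * N
  balanced-≤ {n} {c} n≤N b i = begin
    lookup c i              ≤⟨ m≤n+∣m-n∣ (lookup c i) C ⟩
    C + ∣ lookup c i - C ∣  ≤⟨ +-monoʳ-≤ C (≤-trans (balanced-dev b i) (*-monoʳ-≤ 2 n≤N)) ⟩
    4 * N + 2 * N           ≡⟨ lemma N ⟩
    6 * N                   ∎
    where
    open ≤-Reasoning
    lemma : ∀ N → 4 * N + 2 * N ≡ 6 * N
    lemma = solve-∀

  -- Between `2 * N` and `6 * N` beads among `8 * N` letters leave at least `2 * N` beads and
  -- `2 * N` gaps, while no level exceeds `N`; the Gaussian coefficient has stabilised to a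
  -- partition number.
  balanced-stable : ∀ {n c e} → n ≤ N → Balanced n c (sumᵛ e) → ∀ i → wordCount L (lookup c i) (lookup e i) ≡ P (lookup e i)
  balanced-stable {n} {c} {e} n≤N b i = trans
    (wordCount≡pp L (lookup c i) (L ∸ lookup c i) (lookup e i) (m+[n∸m]≡n c≤L) (inj₂ (≤-trans e≤2N (balanced-≥ n≤N b i))))
    (pp≡P (≤-trans e≤2N (m+n≤o⇒m≤o∸n (2 * N) (≤-trans (+-monoʳ-≤ (2 * N) (balanced-≤ n≤N b i)) (≤-reflexive (lemma N))))))
    where
    lemma : ∀ N → 2 * N + 6 * N ≡ 8 * N
    lemma = solve-∀
    c≤L : lookup c i ≤ L
    c≤L = ≤-trans (balanced-≤ n≤N b i) (*-monoˡ-≤ N (m≤m+n 6 2))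
    e≤2N : lookup e i ≤ 2 * N
    e≤2N = ≤-trans (lookup≤sum e i) (≤-trans (balanced-level b) (≤-trans n≤N (m≤m+n N _)))

  ∑-partitions-numHt : ∀ {n} (σ : ℕ → ℕ) → n ≤ N →
    ∑[ l ∈ partitions n ] σ (numHt T l)
    ≡ ∑[ c ∈ box ] (δ (sumᵛ c) K * ∑[ e ∈ levels ] (δ (T * sumᵛ e + ground T c) (n + tri K) * (σ (sumᵛ e) * ∏P e)))
  ∑-partitions-numHt {n} σ n≤N = begin
    (∑[ l ∈ partitions n ] σ (numHt T l))
      ≡⟨ ∑-partitions {L} {T} (σ ∘ numHt T) n≤K n+K≤ ⟩
    (∑[ cs ∈ runnerTuples L T ] (δ (ones (interleave cs)) K * (δ (inv (interleave cs)) n * σ (numHt T (shape (interleave cs))))))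
      ≡⟨ ∑-cong (runnerTuples L T) by-stats ⟩
    (∑[ cs ∈ runnerTuples L T ] G (mapᵛ ones cs) (mapᵛ inv cs))
      ≡⟨ ∑-runnerTuples {L} {X} {Y} ≤-refl (s≤s (m≤m+n (L * L) _)) T G ⟩
    (∑[ c ∈ box ] ∑[ e ∈ levels ] (weight (wordCount L) c e * G c e))
      ≡⟨ ∑-cong box (λ c → trans (∑-cong levels (stabilise c)) (∑-*ˡ (δ (sumᵛ c) K) levels _)) ⟩
    (∑[ c ∈ box ] (δ (sumᵛ c) K * ∑[ e ∈ levels ] (δ (T * sumᵛ e + ground T c) (n + tri K) * (σ (sumᵛ e) * ∏P e)))) ∎
    where
    open ≡-Reasoning
    G : Vec ℕ T → Vec ℕ T → ℕ
    G c e = δ (sumᵛ c) K * (δ (T * sumᵛ e + ground T c) (n + tri K) * σ (sumᵛ e))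
    N≤K : N ≤ K
    N≤K = ≤-trans (m≤m+n N _) (T*-≥ C)
    n≤K : n ≤ K
    n≤K = ≤-trans n≤N N≤K
    n+K≤ : n + K ≤ L * T
    n+K≤ = ≤-trans (+-monoˡ-≤ K n≤K) (≤-reflexive (lemma T N))
      where
      lemma : ∀ T N → T * (4 * N) + T * (4 * N) ≡ 8 * N * T
      lemma = solve-∀
    by-stats : ∀ cs → δ (ones (interleave cs)) K * (δ (inv (interleave cs)) n * σ (numHt T (shape (interleave cs))))
                    ≡ G (mapᵛ ones cs) (mapᵛ inv cs)
    by-stats cs = trans
      (δ-guard (ones (interleave cs)) K (λ o → cong₂ _*_
        (δ-iff (λ i → trans (sym (pos≡ o)) (cong (_+ tri K) i))
               (λ r → +-cancelʳ-≡ (tri K) _ _ (trans (pos≡ o) r)))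
        (cong σ (trans (numHt-shape T (interleave cs)) (hooksOf-interleave cs)))))
      (cong (λ s → δ s K * (δ (T * sumᵛ (mapᵛ inv cs) + ground T (mapᵛ ones cs)) (n + tri K) * σ (sumᵛ (mapᵛ inv cs))))
            (ones-interleave cs))
      where
      pos≡ : ones (interleave cs) ≡ K → inv (interleave cs) + tri K ≡ T * sumᵛ (mapᵛ inv cs) + ground T (mapᵛ ones cs)
      pos≡ o = trans (cong (λ m → inv (interleave cs) + tri m) (sym o))
        (trans (sym (pos≡inv+tri (interleave cs))) (trans (pos-interleave cs) (runners≡ T cs)))
    stabilise : ∀ c e → weight (wordCount L) c e * G c e
                      ≡ δ (sumᵛ c) K * (δ (T * sumᵛ e + ground T c) (n + tri K) * (σ (sumᵛ e) * ∏P e))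
    stabilise c e = trans (lemma (weight (wordCount L) c e) (δ (sumᵛ c) K) (δ (T * sumᵛ e + ground T c) (n + tri K)) (σ (sumᵛ e)))
      (δ-guard (sumᵛ c) K (λ s → δ-guard (T * sumᵛ e + ground T c) (n + tri K) (λ r →
        cong (σ (sumᵛ e) *_) (weight≡∏P {f = wordCount L} c e (balanced-stable {c = c} {e} n≤N (balanced s r))))))
      where
      lemma : ∀ w a b s → w * (a * (b * s)) ≡ a * (b * (s * w))
      lemma = solve-∀

  -- For statistics of the hook number that the charges determine. Its parity is one, since the
  -- energy equation fixes `S` once `n` and `c` are given.
  ∑-partitions-mass : ∀ {n} (σ : ℕ → ℕ) (q : Vec ℕ T → ℕ) → n ≤ N →
    (∀ c S → Balanced n c S → σ S ≡ q c) →
    ∑[ l ∈ partitions n ] σ (numHt T l) ≡ ∑[ c ∈ box ] (q c * mass n c)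
  ∑-partitions-mass {n} σ q n≤N h = trans (∑-partitions-numHt σ n≤N) (∑-cong box (λ c → begin
    δ (sumᵛ c) K * ∑[ e ∈ levels ] (δ (T * sumᵛ e + ground T c) (n + tri K) * (σ (sumᵛ e) * ∏P e))
      ≡⟨ δ-guard (sumᵛ c) K (λ s → ∑-cong levels (λ e → trans
           (δ-guard (T * sumᵛ e + ground T c) (n + tri K) (λ r → cong (_* ∏P e) (h c (sumᵛ e) (balanced s r))))
           (lemma (δ (T * sumᵛ e + ground T c) (n + tri K)) (q c) (∏P e)))) ⟩
    δ (sumᵛ c) K * ∑[ e ∈ levels ] (q c * (δ (T * sumᵛ e + ground T c) (n + tri K) * ∏P e))
      ≡⟨ cong (δ (sumᵛ c) K *_) (∑-*ˡ (q c) levels _) ⟩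
    δ (sumᵛ c) K * (q c * fill (n + tri K) (ground T c))
      ≡⟨ lemma (δ (sumᵛ c) K) (q c) _ ⟩
    q c * mass n c ∎))
    where
    open ≡-Reasoning
    lemma : ∀ a b c → a * (b * c) ≡ b * (a * c)
    lemma = solve-∀

  p≡∑mass : ∀ {n} → n ≤ N → p n ≡ ∑ box (mass n)
  p≡∑mass {n} n≤N = trans (length≡∑ (partitions n)) (trans (∑-partitions-mass (λ _ → 1) (λ _ → 1) n≤N (λ _ _ _ → refl))
    (∑-cong box (λ c → +-identityʳ _)))

  mass-support : ∀ {n} c i → n ≤ N → lookup c i < 2 * N ⊎ 6 * N < lookup c i → mass n c ≡ 0
  mass-support {n} c i n≤N out = trans (δ-guard (sumᵛ c) K {y = 0} (λ s →
      trans (∑-cong levels (λ e → trans (δ-guard (T * sumᵛ e + ground T c) (n + tri K) {y = 0} (λ r → ⊥-elim (clash out s r)))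
                                        (*-zeroʳ (δ (T * sumᵛ e + ground T c) (n + tri K)))))
            (∑-0 levels)))
    (*-zeroʳ (δ (sumᵛ c) K))
    where
    clash : lookup c i < 2 * N ⊎ 6 * N < lookup c i → ∀ {S} → sumᵛ c ≡ K → T * S + ground T c ≡ n + tri K → ⊥
    clash (inj₁ lo) {S} s r = <⇒≱ lo (balanced-≥ {c = c} {S} n≤N (balanced s r) i)
    clash (inj₂ hi) {S} s r = <⇒≱ hi (balanced-≤ {c = c} {S} n≤N (balanced s r) i)

-- Transferring beads between runners

bump : ∀ {t} → Fin t → ℕ → Vec ℕ t → Vec ℕ t
bump Fin.zero    m (x ∷ v) = (m + x) ∷ v
bump (Fin.suc i) m (x ∷ v) = x ∷ bump i m v

bump-bump : ∀ {t} (i : Fin t) m k v → bump i m (bump i k v) ≡ bump i (m + k) v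
bump-bump Fin.zero    m k (x ∷ v) = cong (_∷ v) (sym (+-assoc m k x))
bump-bump (Fin.suc i) m k (x ∷ v) = cong (x ∷_) (bump-bump i m k v)

bump-comm : ∀ {t} (i j : Fin t) m k v → bump i m (bump j k v) ≡ bump j k (bump i m v)
bump-comm Fin.zero    Fin.zero    m k (x ∷ v) = cong (_∷ v) (lemma m k x)
  where
  lemma : ∀ m k x → m + (k + x) ≡ k + (m + x)
  lemma = solve-∀
bump-comm Fin.zero    (Fin.suc j) m k (x ∷ v) = refl
bump-comm (Fin.suc i) Fin.zero    m k (x ∷ v) = refl
bump-comm (Fin.suc i) (Fin.suc j) m k (x ∷ v) = cong (x ∷_) (bump-comm i j m k v)

lookup-bump : ∀ {t} (i : Fin t) m v → lookup (bump i m v) i ≡ m + lookup v i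
lookup-bump Fin.zero    m (x ∷ v) = refl
lookup-bump (Fin.suc i) m (x ∷ v) = lookup-bump i m v

lookup-bump-≢ : ∀ {t} {i j : Fin t} m v → i ≢ j → lookup (bump i m v) j ≡ lookup v j
lookup-bump-≢ {i = Fin.zero}  {Fin.zero}  m (x ∷ v) ne = ⊥-elim (ne refl)
lookup-bump-≢ {i = Fin.zero}  {Fin.suc j} m (x ∷ v) ne = refl
lookup-bump-≢ {i = Fin.suc i} {Fin.zero}  m (x ∷ v) ne = refl
lookup-bump-≢ {i = Fin.suc i} {Fin.suc j} m (x ∷ v) ne = lookup-bump-≢ m v (ne ∘ cong Fin.suc)

sum-bump : ∀ {t} (i : Fin t) m v → sumᵛ (bump i m v) ≡ m + sumᵛ v
sum-bump Fin.zero    m (x ∷ v) = +-assoc m x _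
sum-bump (Fin.suc i) m (x ∷ v) = trans (cong (x +_) (sum-bump i m v)) (lemma x m _)
  where
  lemma : ∀ x m s → x + (m + s) ≡ m + (x + s)
  lemma = solve-∀

residue : ∀ {t} → Fin t → ℕ
residue {suc t} Fin.zero    = t
residue {suc t} (Fin.suc i) = residue i

ground-bump : ∀ {t} T (i : Fin t) m v →
              ground T (bump i m v) ≡ ground T v + (T * (tri m + m * lookup v i) + residue i * m)
ground-bump {suc t} T Fin.zero m (x ∷ v) = trans (cong (λ y → T * y + t * (m + x) + ground T v) (tri-+ m x))
  (lemma T t (tri m) (tri x) m x (ground T v))
  where
  lemma : ∀ T t y z m x g → T * (y + z + m * x) + t * (m + x) + g ≡ T * z + t * x + g + (T * (y + m * x) + t * m)
  lemma = solve-∀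
ground-bump T (Fin.suc i) m (x ∷ v) = trans (cong (_ +_) (ground-bump T i m v)) (sym (+-assoc (T * tri x + _) (ground T v) _))

Vanishes : ∀ {t} → ℕ → Fin t → ℕ → (Vec ℕ t → ℕ) → Set
Vanishes X i m F = ∀ v → lookup v i < m ⊎ X ≤ lookup v i → F v ≡ 0

∑-bump : ∀ {t X} (i : Fin t) m {F : Vec ℕ t → ℕ} → Vanishes X i m F →
         ∑ (vecs (upTo X) t) F ≡ ∑ (vecs (upTo X) t) (F ∘ bump i m)
∑-bump {suc t} {X} Fin.zero m {F} z = begin
  ∑ (vecs (upTo X) (suc t)) F                                  ≡⟨ ∑-vecs (upTo X) t F ⟩
  (∑[ x ∈ upTo X ] ∑[ v ∈ vecs (upTo X) t ] F (x ∷ v))         ≡⟨ ∑-upTo-shift X m (λ x out →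
      trans (∑-cong (vecs (upTo X) t) (λ v → z (x ∷ v) out)) (∑-0 (vecs (upTo X) t))) ⟩
  (∑[ x ∈ upTo X ] ∑[ v ∈ vecs (upTo X) t ] F ((m + x) ∷ v))   ≡⟨ ∑-vecs (upTo X) t (F ∘ bump Fin.zero m) ⟨
  ∑ (vecs (upTo X) (suc t)) (F ∘ bump Fin.zero m)              ∎
  where open ≡-Reasoning
∑-bump {suc t} {X} (Fin.suc i) m {F} z = begin
  ∑ (vecs (upTo X) (suc t)) F                                  ≡⟨ ∑-vecs (upTo X) t F ⟩
  (∑[ x ∈ upTo X ] ∑[ v ∈ vecs (upTo X) t ] F (x ∷ v))         ≡⟨ ∑-cong (upTo X) (λ x → ∑-bump i m (λ v → z (x ∷ v))) ⟩
  (∑[ x ∈ upTo X ] ∑[ v ∈ vecs (upTo X) t ] F (x ∷ bump i m v)) ≡⟨ ∑-vecs (upTo X) t (F ∘ bump (Fin.suc i) m) ⟨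
  ∑ (vecs (upTo X) (suc t)) (F ∘ bump (Fin.suc i) m)           ∎
  where open ≡-Reasoning

∑-bump₂ : ∀ {t X} {a b : Fin t} r s {F : Vec ℕ t → ℕ} → a ≢ b → Vanishes X a r F → Vanishes X b s F →
          ∑ (vecs (upTo X) t) F ≡ ∑[ c ∈ vecs (upTo X) t ] F (bump a r (bump b s c))
∑-bump₂ {a = a} {b} r s a≢b za zb = trans (∑-bump a r za)
  (∑-bump b s (λ v out → zb (bump a r v) (subst (λ x → x < s ⊎ _ ≤ x) (sym (lookup-bump-≢ r v a≢b)) out)))

∑-upTo-drop : ∀ X m {f : ℕ → ℕ} → (∀ x → X ≤ x → f x ≡ 0) → ∑[ x ∈ upTo X ] f (m + x) ≤ ∑ (upTo X) f
∑-upTo-drop X zero    z = ≤-refl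
∑-upTo-drop X (suc m) {f} z = ≤-trans (∑-upTo-drop X m (λ x X≤x → z (suc x) (m≤n⇒m≤1+n X≤x))) (begin
  ∑ (upTo X) (f ∘ suc)       ≤⟨ m≤n+m _ (f 0) ⟩
  f 0 + ∑ (upTo X) (f ∘ suc) ≡⟨ ∑-upTo-first X f ⟨
  ∑ (upTo (suc X)) f         ≡⟨ ∑-upTo-last X f ⟩
  ∑ (upTo X) f + f X         ≡⟨ cong (∑ (upTo X) f +_) (z X ≤-refl) ⟩
  ∑ (upTo X) f + 0           ≡⟨ +-identityʳ _ ⟩
  ∑ (upTo X) f               ∎)
  where open ≤-Reasoning

-- Energy saved in multiples of `T` is spent on enlarging the first partition of the tuple by `q`,
-- which does not lower its weight because `P` is nondecreasing.
fillings-mono : ∀ {t T Y M} q x → 0 < t → 0 < T → M < Y →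
  ∑[ e ∈ vecs (upTo Y) t ] (δ (T * sumᵛ e + (T * q + x)) M * ∏P e) ≤ ∑[ e ∈ vecs (upTo Y) t ] (δ (T * sumᵛ e + x) M * ∏P e)
fillings-mono {suc t} {T} {Y} {M} q x _ 0<T M<Y = begin
  (∑[ e ∈ vecs (upTo Y) (suc t) ] (δ (T * sumᵛ e + (T * q + x)) M * ∏P e))
    ≡⟨ ∑-vecs (upTo Y) t _ ⟩
  (∑[ e₀ ∈ upTo Y ] ∑[ e ∈ vecs (upTo Y) t ] (δ (T * (e₀ + sumᵛ e) + (T * q + x)) M * (P e₀ * ∏P e)))
    ≤⟨ ∑-mono (upTo Y) (λ e₀ → ∑-mono (vecs (upTo Y) t) (λ e → *-mono-≤
         (≤-reflexive (cong (λ y → δ y M) (lemma T e₀ (sumᵛ e) q x)))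
         (*-monoˡ-≤ (∏P e) (P-mono q e₀)))) ⟩
  (∑[ e₀ ∈ upTo Y ] h (q + e₀))
    ≤⟨ ∑-upTo-drop Y q h-vanishes ⟩
  ∑ (upTo Y) h
    ≡⟨ ∑-vecs (upTo Y) t _ ⟨
  (∑[ e ∈ vecs (upTo Y) (suc t) ] (δ (T * sumᵛ e + x) M * ∏P e)) ∎
  where
  open ≤-Reasoning
  h : ℕ → ℕ
  h e₀ = ∑[ e ∈ vecs (upTo Y) t ] (δ (T * (e₀ + sumᵛ e) + x) M * (P e₀ * ∏P e))
  lemma : ∀ T a s q x → T * (a + s) + (T * q + x) ≡ T * (q + a + s) + x
  lemma = solve-∀
  h-vanishes : ∀ e₀ → Y ≤ e₀ → h e₀ ≡ 0
  h-vanishes e₀ Y≤e₀ = trans (∑-cong (vecs (upTo Y) t) (λ e → cong (_* (P e₀ * ∏P e)) (δ-≢ (λ eq →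
    <⇒≱ M<Y (≤-trans Y≤e₀ (≤-trans (≤-trans (m≤m+n e₀ (sumᵛ e)) (T*-≥ (e₀ + sumᵛ e))) (≤-trans (m≤m+n _ x) (≤-reflexive eq))))))))
    (∑-0 (vecs (upTo Y) t))
    where
    T*-≥ : ∀ S → S ≤ T * S
    T*-≥ S = subst (_≤ T * S) (+-identityʳ S) (*-monoˡ-≤ S 0<T)

∑-telescope : ∀ J (f : ℕ → ℕ) → (∀ j → j < J → f (suc j) ≤ f j) → ∑[ j ∈ upTo J ] (f j ∸ f (suc j)) + f J ≡ f 0
∑-telescope zero    f h = refl
∑-telescope (suc J) f h = begin
  (∑[ j ∈ upTo (suc J) ] (f j ∸ f (suc j))) + f (suc J)
    ≡⟨ cong (_+ f (suc J)) (∑-upTo-last J _) ⟩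
  (∑[ j ∈ upTo J ] (f j ∸ f (suc j))) + (f J ∸ f (suc J)) + f (suc J)
    ≡⟨ +-assoc (∑[ j ∈ upTo J ] (f j ∸ f (suc j))) _ _ ⟩
  (∑[ j ∈ upTo J ] (f j ∸ f (suc j))) + (f J ∸ f (suc J) + f (suc J))
    ≡⟨ cong ((∑[ j ∈ upTo J ] (f j ∸ f (suc j))) +_) (m∸n+n≡m (h J ≤-refl)) ⟩
  (∑[ j ∈ upTo J ] (f j ∸ f (suc j))) + f J
    ≡⟨ ∑-telescope J f (λ j j<J → h j (m≤n⇒m≤1+n j<J)) ⟩
  f 0 ∎
  where open ≡-Reasoning

∑-∸ : ∀ {A : Set} (xs : List A) (f g : A → ℕ) → (∀ x → g x ≤ f x) → ∑[ x ∈ xs ] (f x ∸ g x) ≡ ∑ xs f ∸ ∑ xs g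
∑-∸ xs f g h = sym (trans (cong (_∸ ∑ xs g) (sym (trans (sym (∑-+ xs (λ x → f x ∸ g x) g)) (∑-cong xs (λ x → m∸n+n≡m (h x))))))
  (m+n∸n≡m _ (∑ xs g)))

module Transfer (T N : ℕ) (0<T : 0 < T) where

  open Lattice T N 0<T

  fill-mono : ∀ {n} q x → n ≤ N → fill (n + tri K) (T * q + x) ≤ fill (n + tri K) x
  fill-mono q x n≤N = fillings-mono {T} {T} q x 0<T 0<T (s≤s (≤-trans (+-monoˡ-≤ (tri K) n≤N) (m≤n+m _ (L * L))))

  fill-≤ : ∀ {n} x y A B → n ≤ N → x + T * A ≡ y + T * B → A ≤ B → fill (n + tri K) x ≤ fill (n + tri K) y
  fill-≤ {n} x y A B n≤N eq A≤B = subst (λ z → fill (n + tri K) z ≤ fill (n + tri K) y) (sym x≡) (fill-mono (B ∸ A) y n≤N)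
    where
    x≡ : x ≡ T * (B ∸ A) + y
    x≡ = +-cancelʳ-≡ (T * A) _ _ (trans eq (trans (cong (λ z → y + T * z) (sym (m∸n+n≡m A≤B))) (lemma y T (B ∸ A) A)))
      where
      lemma : ∀ y T d A → y + T * (d + A) ≡ T * d + y + T * A
      lemma = solve-∀

  -- Only the energy left above the ground counts, so a ground raised by `T * q` amounts to a size
  -- lowered by `T * q`.
  fill-lower : ∀ q n x → fill (n + tri K) x ≡ fill (T * q + n + tri K) (T * q + x)
  fill-lower q n x = ∑-cong levels (λ e → cong (_* ∏P e) (δ-iff
    (λ eq → trans (lemma (T * sumᵛ e) (T * q) x) (trans (cong (T * q +_) eq) (sym (+-assoc (T * q) n (tri K)))))
    (λ eq → +-cancelˡ-≡ (T * q) _ _ (trans (sym (lemma (T * sumᵛ e) (T * q) x)) (trans eq (+-assoc (T * q) n (tri K)))))))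
    where
    lemma : ∀ s q x → s + (q + x) ≡ q + (s + x)
    lemma = solve-∀

  mass-lower-≤ : ∀ q n c → T * q + n ≤ N → mass n c ≤ mass (T * q + n) c
  mass-lower-≤ q n c h = *-monoʳ-≤ (δ (sumᵛ c) K)
    (subst (_≤ fill (T * q + n + tri K) (ground T c)) (sym (fill-lower q n (ground T c))) (fill-mono q (ground T c) h))

  mass-vanishes : ∀ {n r} i → n ≤ N → r ≤ 2 * N → Vanishes X i r (mass n)
  mass-vanishes i n≤N r≤ v (inj₁ lo) = mass-support v i n≤N (inj₁ (≤-trans lo r≤))
  mass-vanishes i n≤N r≤ v (inj₂ hi) = mass-support v i n≤N (inj₂ (≤-trans (s≤s (*-monoˡ-≤ N (m≤m+n 6 2))) hi))

  -- The residue equation makes the energies on both sides of a move of `m` beads congruent modulo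
  -- `T`; `u` and `v` express the signed quotient in natural numbers.
  module Pair {a b : Fin T} {m u v : ℕ} (a≢b : a ≢ b) (residues : residue a * m + T * u ≡ residue b * m + T * v)
              {n : ℕ} (n≤N : n ≤ N) where

    -- Both ends of a move are reached from a point `c` lacking the `m` beads, so that no charge is
    -- ever subtracted from.
    loss : Vec ℕ T → ℕ
    loss c = mass n (bump b m c) ∸ mass n (bump a m c)

    transfer-energy : ∀ c → ground T (bump a m c) + T * (m * lookup c b + u) ≡ ground T (bump b m c) + T * (m * lookup c a + v)
    transfer-energy c = begin
      ground T (bump a m c) + T * (m * lookup c b + u)
        ≡⟨ cong (_+ T * (m * lookup c b + u)) (ground-bump T a m c) ⟩
      ground T c + (T * (tri m + m * lookup c a) + residue a * m) + T * (m * lookup c b + u)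
        ≡⟨ lemma (ground T c) T (tri m) (m * lookup c a) (residue a * m) (m * lookup c b) u ⟩
      ground T c + T * (tri m + m * lookup c a) + T * (m * lookup c b) + (residue a * m + T * u)
        ≡⟨ cong (ground T c + T * (tri m + m * lookup c a) + T * (m * lookup c b) +_) residues ⟩
      ground T c + T * (tri m + m * lookup c a) + T * (m * lookup c b) + (residue b * m + T * v)
        ≡⟨ lemma′ (ground T c) T (tri m) (m * lookup c a) (residue b * m) (m * lookup c b) v ⟩
      ground T c + (T * (tri m + m * lookup c b) + residue b * m) + T * (m * lookup c a + v)
        ≡⟨ cong (_+ T * (m * lookup c a + v)) (ground-bump T b m c) ⟨
      ground T (bump b m c) + T * (m * lookup c a + v) ∎
      where
      open ≡-Reasoning
      lemma : ∀ g T t x r y u → g + (T * (t + x) + r) + T * (y + u) ≡ g + T * (t + x) + T * y + (r + T * u)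
      lemma = solve-∀
      lemma′ : ∀ g T t x r y v → g + T * (t + x) + T * y + (r + T * v) ≡ g + (T * (t + y) + r) + T * (x + v)
      lemma′ = solve-∀

    sum-transfer : ∀ c → sumᵛ (bump a m c) ≡ sumᵛ (bump b m c)
    sum-transfer c = trans (sum-bump a m c) (sym (sum-bump b m c))

    module Steps (J : ℕ) (mJ≤2N : m * J ≤ 2 * N) {n₀ : ℕ} (n≡ : n ≡ T * (2 * (m * m * J)) + n₀) where

      -- In units of `T` the energy increment grows by `2 * m * m` per move, so within `J` moves
      -- none exceeds the first by more than `q`.
      q = 2 * (m * m * J)

      -- `y c j` is the point of the chain after `j` moves from `b` to `a`; `z c j` is the common
      -- base of `y c j` and `y c (suc j)`.
      y z : Vec ℕ T → ℕ → Vec ℕ T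
      y c j = bump a (m * j) (bump b (m * (J ∸ j)) c)
      z c j = bump a (m * j) (bump b (m * (J ∸ suc j)) c)

      bump-a-z : ∀ c j → bump a m (z c j) ≡ y c (suc j)
      bump-a-z c j = trans (bump-bump a m (m * j) _) (cong (λ r → bump a r (bump b (m * (J ∸ suc j)) c)) (sym (*-suc m j)))

      bump-b-z : ∀ c j → j < J → bump b m (z c j) ≡ y c j
      bump-b-z c j j<J = trans (bump-comm b a m (m * j) _) (cong (bump a (m * j)) (trans (bump-bump b m _ c)
        (cong (λ r → bump b r c) (trans (sym (*-suc m (J ∸ suc j))) (cong (m *_) (sym (∸-suc′ j<J)))))))
        where
        ∸-suc′ : ∀ {J j} → j < J → J ∸ j ≡ suc (J ∸ suc j)
        ∸-suc′ {suc J} {zero}  _         = refl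
        ∸-suc′ {suc J} {suc j} (s≤s j<J) = ∸-suc′ j<J

      lookup-z-a : ∀ c j → lookup (z c j) a ≡ m * j + lookup c a
      lookup-z-a c j = trans (lookup-bump a (m * j) _) (cong (m * j +_) (lookup-bump-≢ _ c (a≢b ∘ sym)))

      lookup-z-b : ∀ c j → lookup (z c j) b ≡ m * (J ∸ suc j) + lookup c b
      lookup-z-b c j = trans (lookup-bump-≢ _ _ a≢b) (lookup-bump b _ c)

      -- Along the chain of transfers the energy is a convex sequence. If it is increasing, the losses telescope;
      -- otherwise each step costs at most T * q in energy.
      chain-loss : ∀ c → ∑[ j ∈ upTo J ] loss (z c j) ≤ mass n (y c 0) + ∑[ j ∈ upTo J ] (mass n (y c j) ∸ mass n₀ (y c j))
      -- The sign of the first energy increment, with `m * m` added to both sides to avoid `J - 1`.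
      -- By convexity a nonnegative first increment makes all of them nonnegative.
      chain-loss c with ≤-total (m * (m * J + lookup c b) + u) (m * (m * 1 + lookup c a) + v)
      ... | inj₁ incr = ≤-trans (≤-trans (≤-reflexive (∑-upTo-cong J (λ j j<J →
              cong₂ (λ r s → mass n r ∸ mass n s) (bump-b-z c j j<J) (bump-a-z c j))))
            (≤-trans (m≤m+n _ (mass n (y c J))) (≤-reflexive (∑-telescope J (mass n ∘ y c) decreasing)))) (m≤m+n _ _)
        where
        ordered : ∀ j → j < J → m * lookup (z c j) b + u ≤ m * lookup (z c j) a + v
        ordered j j<J rewrite lookup-z-a c j | lookup-z-b c j = +-cancelˡ-≤ (m * m) _ _ (begin
          m * m + (m * (m * (J ∸ suc j) + lookup c b) + u)  ≡⟨ lemma m (J ∸ suc j) (lookup c b) u ⟩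
          m * (m * suc (J ∸ suc j) + lookup c b) + u        ≤⟨ +-monoˡ-≤ u (*-monoʳ-≤ m (+-monoˡ-≤ (lookup c b) (*-monoʳ-≤ m
                                                               (subst (_≤ J) (+-comm (J ∸ suc j) 1) (≤-trans (+-monoʳ-≤ (J ∸ suc j) (s≤s (z≤n {j}))) (≤-reflexive (m∸n+n≡m j<J))))))) ⟩
          m * (m * J + lookup c b) + u                      ≤⟨ incr ⟩
          m * (m * 1 + lookup c a) + v                      ≤⟨ m≤m+n _ (m * (m * j)) ⟩
          m * (m * 1 + lookup c a) + v + m * (m * j)        ≡⟨ lemma′ m j (lookup c a) v ⟩
          m * m + (m * (m * j + lookup c a) + v)            ∎)
          where
          open ≤-Reasoning
          lemma : ∀ m i x u → m * m + (m * (m * i + x) + u) ≡ m * (m * suc i + x) + u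
          lemma = solve-∀
          lemma′ : ∀ m j x v → m * (m * 1 + x) + v + m * (m * j) ≡ m * m + (m * (m * j + x) + v)
          lemma′ = solve-∀
        decreasing : ∀ j → j < J → mass n (y c (suc j)) ≤ mass n (y c j)
        decreasing j j<J = subst₂ (λ r s → mass n r ≤ mass n s) (bump-a-z c j) (bump-b-z c j j<J)
          (subst (λ s → δ s K * fill (n + tri K) (ground T (bump a m (z c j))) ≤ mass n (bump b m (z c j)))
            (sym (sum-transfer (z c j)))
            (*-monoʳ-≤ (δ (sumᵛ (bump b m (z c j))) K)
              (fill-≤ _ _ _ _ n≤N (transfer-energy (z c j)) (ordered j j<J))))
      ... | inj₂ decr = ≤-trans (∑-upTo-mono J small) (m≤n+m _ (mass n (y c 0)))
        where
        close : ∀ j → j < J → m * lookup (z c j) a + v ≤ (m * lookup (z c j) b + u) + q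
        close j j<J rewrite lookup-z-a c j | lookup-z-b c j = begin
          m * (m * j + lookup c a) + v                     ≤⟨ m≤m+n _ (m * m) ⟩
          m * (m * j + lookup c a) + v + m * m             ≡⟨ lemma m j (lookup c a) v ⟩
          m * (m * j) + (m * (m * 1 + lookup c a) + v)     ≤⟨ +-mono-≤ (*-monoʳ-≤ m (*-monoʳ-≤ m (<⇒≤ j<J))) decr ⟩
          m * (m * J) + (m * (m * J + lookup c b) + u)     ≤⟨ m≤m+n _ (m * (m * (J ∸ suc j))) ⟩
          m * (m * J) + (m * (m * J + lookup c b) + u) + m * (m * (J ∸ suc j)) ≡⟨ lemma′ m J (lookup c b) u (J ∸ suc j) ⟩
          m * (m * (J ∸ suc j) + lookup c b) + u + q       ∎
          where
          open ≤-Reasoning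
          lemma : ∀ m j x v → m * (m * j + x) + v + m * m ≡ m * (m * j) + (m * (m * 1 + x) + v)
          lemma = solve-∀
          lemma′ : ∀ m J x u i → m * (m * J) + (m * (m * J + x) + u) + m * (m * i) ≡ m * (m * i + x) + u + 2 * (m * m * J)
          lemma′ = solve-∀
        small : ∀ j → j < J → loss (z c j) ≤ mass n (y c j) ∸ mass n₀ (y c j)
        small j j<J = subst (λ r → loss (z c j) ≤ mass n r ∸ mass n₀ r) (bump-b-z c j j<J)
          (∸-monoʳ-≤ (mass n (bump b m (z c j)))
            (subst (λ s → mass n₀ (bump b m (z c j)) ≤ δ s K * fill (n + tri K) (ground T (bump a m (z c j)))) (sym (sum-transfer (z c j)))
              (*-monoʳ-≤ (δ (sumᵛ (bump b m (z c j))) K) (≤-trans (≤-reflexive lower) step))))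
          where
          x = ground T (bump b m (z c j))
          α = m * lookup (z c j) b + u
          β = m * lookup (z c j) a + v
          lower : fill (n₀ + tri K) x ≡ fill (n + tri K) (T * q + x)
          lower = trans (fill-lower q n₀ x) (cong (λ n → fill (n + tri K) (T * q + x)) (sym n≡))
          step : fill (n + tri K) (T * q + x) ≤ fill (n + tri K) (ground T (bump a m (z c j)))
          step = fill-≤ _ _ β (α + q) n≤N (trans (lemma T q x β) (trans (cong (T * q +_) (sym (transfer-energy (z c j))))
                   (lemma′ T q (ground T (bump a m (z c j))) α))) (close j j<J)
            where
            lemma : ∀ T q x B → T * q + x + T * B ≡ T * q + (x + T * B)
            lemma = solve-∀
            lemma′ : ∀ T q e A → T * q + (e + T * A) ≡ e + T * (A + q)
            lemma′ = solve-∀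

      n₀≤N : n₀ ≤ N
      n₀≤N = ≤-trans (m≤n+m n₀ _) (≤-trans (≤-reflexive (sym n≡)) n≤N)

      shift≤ : ∀ {j} → j ≤ J → m * j ≤ 2 * N
      shift≤ j≤J = ≤-trans (*-monoʳ-≤ m j≤J) mJ≤2N

      ∑-y : ∀ {n′} j → n′ ≤ N → j ≤ J → ∑[ c ∈ box ] mass n′ (y c j) ≡ p n′
      ∑-y j n′≤N j≤J = trans (sym (∑-bump₂ (m * j) (m * (J ∸ j)) a≢b
          (mass-vanishes a n′≤N (shift≤ j≤J)) (mass-vanishes b n′≤N (shift≤ (m∸n≤m J j)))))
        (sym (p≡∑mass n′≤N))

      ∑-z : ∀ j → j < J → ∑[ c ∈ box ] loss (z c j) ≡ ∑ box loss
      ∑-z j j<J = sym (∑-bump₂ (m * j) (m * (J ∸ suc j)) a≢b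
        (λ v out → vanish v (mass-vanishes a n≤N (shift≤ (<⇒≤ j<J)) (bump b m v)
          (subst (λ x → x < m * j ⊎ X ≤ x) (sym (lookup-bump-≢ m v (a≢b ∘ sym))) out)))
        (λ v out → vanish v (mass-vanishes b n≤N mJ≤2N (bump b m v)
          (subst (λ x → x < m * J ⊎ X ≤ x) (sym (lookup-bump b m v)) (after (lookup v b) out)))))
        where
        vanish : ∀ v → mass n (bump b m v) ≡ 0 → loss v ≡ 0
        vanish v e = trans (cong (_∸ mass n (bump a m v)) e) (0∸n≡0 (mass n (bump a m v)))
        after : ∀ x → x < m * (J ∸ suc j) ⊎ X ≤ x → m + x < m * J ⊎ X ≤ m + x
        after x (inj₂ hi) = inj₂ (≤-trans hi (m≤n+m x m))
        after x (inj₁ lo) = inj₁ (≤-trans (≤-trans (≤-reflexive (sym (+-suc m x))) (+-monoʳ-≤ m lo))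
          (≤-trans (≤-reflexive (sym (*-suc m _))) (*-monoʳ-≤ m (≤-trans (≤-trans (≤-reflexive (+-comm 1 (J ∸ suc j)))
            (+-monoʳ-≤ (J ∸ suc j) (s≤s (z≤n {j})))) (≤-reflexive (m∸n+n≡m j<J))))))

      -- Averaging: by translation each of the `J` places in the chain contributes the same sum over
      -- the lattice, while `chain-loss` bounds all places together.
      loss-bound : J * ∑ box loss ≤ p n + J * (p n ∸ p n₀)
      loss-bound = begin
        J * ∑ box loss
          ≡⟨ ∑-upTo-const J (∑ box loss) ⟨
        (∑[ j ∈ upTo J ] ∑ box loss)
          ≡⟨ ∑-upTo-cong J (λ j j<J → sym (∑-z j j<J)) ⟩
        (∑[ j ∈ upTo J ] ∑[ c ∈ box ] loss (z c j))
          ≡⟨ ∑-swap (upTo J) box _ ⟩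
        (∑[ c ∈ box ] ∑[ j ∈ upTo J ] loss (z c j))
          ≤⟨ ∑-mono box chain-loss ⟩
        (∑[ c ∈ box ] (mass n (y c 0) + ∑[ j ∈ upTo J ] (mass n (y c j) ∸ mass n₀ (y c j))))
          ≡⟨ ∑-+ box (λ c → mass n (y c 0)) _ ⟩
        (∑[ c ∈ box ] mass n (y c 0)) + (∑[ c ∈ box ] ∑[ j ∈ upTo J ] (mass n (y c j) ∸ mass n₀ (y c j)))
          ≡⟨ cong₂ _+_ (∑-y 0 n≤N z≤n) (trans (∑-swap box (upTo J) _) (trans (∑-upTo-cong J drop) (∑-upTo-const J (p n ∸ p n₀)))) ⟩
        p n + J * (p n ∸ p n₀) ∎
        where
        open ≤-Reasoning
        lower≤ : ∀ c → mass n₀ c ≤ mass n c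
        lower≤ c = subst (λ n → mass n₀ c ≤ mass n c) (sym n≡) (mass-lower-≤ q n₀ c (≤-trans (≤-reflexive (sym n≡)) n≤N))
        drop : ∀ j → j < J → ∑[ c ∈ box ] (mass n (y c j) ∸ mass n₀ (y c j)) ≡ p n ∸ p n₀
        drop j j<J = trans (∑-∸ box (λ c → mass n (y c j)) (λ c → mass n₀ (y c j)) (λ c → lower≤ (y c j)))
          (cong₂ _∸_ (∑-y j n≤N (<⇒≤ j<J)) (∑-y j n₀≤N (<⇒≤ j<J)))

      -- The move carries the selection `f` to the selection `g`; all that can be missing on the
      -- right is the mass lost in the move.
      transfer-≤ : (f g : Vec ℕ T → ℕ) → (∀ c → f c ≤ 1) → (∀ c → f (bump b m c) ≡ g (bump a m c)) → m ≤ 2 * N →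
        J * (∑[ c ∈ box ] (f c * mass n c)) ≤ J * (∑[ c ∈ box ] (g c * mass n c)) + (p n + J * (p n ∸ p n₀))
      transfer-≤ f g f≤1 fg m≤2N = begin
        J * (∑[ c ∈ box ] (f c * mass n c))
          ≡⟨ cong (J *_) (∑-bump b m (vanishes b f)) ⟩
        J * (∑[ c ∈ box ] (f (bump b m c) * mass n (bump b m c)))
          ≤⟨ *-monoʳ-≤ J (∑-mono box pointwise) ⟩
        J * (∑[ c ∈ box ] (g (bump a m c) * mass n (bump a m c) + loss c))
          ≡⟨ cong (J *_) (∑-+ box _ loss) ⟩
        J * ((∑[ c ∈ box ] (g (bump a m c) * mass n (bump a m c))) + ∑ box loss)
          ≡⟨ *-distribˡ-+ J _ (∑ box loss) ⟩
        J * (∑[ c ∈ box ] (g (bump a m c) * mass n (bump a m c))) + J * ∑ box loss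
          ≤⟨ +-mono-≤ (≤-reflexive (cong (J *_) (sym (∑-bump a m (vanishes a g))))) loss-bound ⟩
        J * (∑[ c ∈ box ] (g c * mass n c)) + (p n + J * (p n ∸ p n₀)) ∎
        where
        open ≤-Reasoning
        vanishes : ∀ i (h : Vec ℕ T → ℕ) → Vanishes X i m (λ c → h c * mass n c)
        vanishes i h v out = trans (cong (h v *_) (mass-vanishes i n≤N m≤2N v out)) (*-zeroʳ (h v))
        pointwise : ∀ c → f (bump b m c) * mass n (bump b m c) ≤ g (bump a m c) * mass n (bump a m c) + loss c
        pointwise c = ≤-trans (*-monoʳ-≤ (f (bump b m c)) (m≤n+m∸n (mass n (bump b m c)) (mass n (bump a m c))))
          (≤-trans (≤-reflexive (*-distribˡ-+ (f (bump b m c)) (mass n (bump a m c)) (loss c)))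
            (+-mono-≤ (≤-reflexive (cong (_* mass n (bump a m c)) (fg c)))
              (≤-trans (*-monoˡ-≤ (loss c) (f≤1 (bump b m c))) (≤-reflexive (+-identityʳ (loss c))))))

-- Slow growth of the partition function

∑-shift : ∀ {A : Set} a (xs : _) (f : A → ℕ → ℕ) n → shift a (λ m → ∑[ x ∈ xs ] f x m) n ≡ ∑[ x ∈ xs ] shift a (f x) n
∑-shift zero    xs f n       = refl
∑-shift (suc a) xs f zero    = sym (∑-0 xs)
∑-shift (suc a) xs f (suc n) = ∑-shift a xs f n

-- Splits by the number of copies of the part `suc a`: exactly `j` for some `j < K`, or at least
-- `K`.
geom-blocks : ∀ a f K n → geom a f n ≡ ∑[ j ∈ upTo K ] shift (j * suc a) f n + shift (K * suc a) (geom a f) n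
geom-blocks a f zero    n = refl
geom-blocks a f (suc K) n = begin
  geom a f n
    ≡⟨ geom-blocks a f K n ⟩
  (∑[ j ∈ upTo K ] shift (j * suc a) f n) + shift (K * suc a) (geom a f) n
    ≡⟨ cong (∑[ j ∈ upTo K ] shift (j * suc a) f n +_) (begin
        shift (K * suc a) (geom a f) n
          ≡⟨ shift-cong (K * suc a) n (λ m _ → geom-unfold a f m) ⟩
        shift (K * suc a) (λ m → f m + shift (suc a) (geom a f) m) n
          ≡⟨ shift-add (K * suc a) f _ n ⟩
        shift (K * suc a) f n + shift (K * suc a) (shift (suc a) (geom a f)) n
          ≡⟨ cong (shift (K * suc a) f n +_) (trans (shift-shift (K * suc a) (suc a) (geom a f) n)
               (cong (λ b → shift b (geom a f) n) (+-comm (K * suc a) (suc a)))) ⟩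
        shift (K * suc a) f n + shift (suc K * suc a) (geom a f) n ∎) ⟩
  (∑[ j ∈ upTo K ] shift (j * suc a) f n) + (shift (K * suc a) f n + shift (suc K * suc a) (geom a f) n)
    ≡⟨ +-assoc (∑[ j ∈ upTo K ] shift (j * suc a) f n) _ _ ⟨
  (∑[ j ∈ upTo K ] shift (j * suc a) f n) + shift (K * suc a) f n + shift (suc K * suc a) (geom a f) n
    ≡⟨ cong (_+ shift (suc K * suc a) (geom a f) n) (∑-upTo-last K _) ⟨
  (∑[ j ∈ upTo (suc K) ] shift (j * suc a) f n) + shift (suc K * suc a) (geom a f) n ∎
  where open ≡-Reasoning

∑-shifts≤geom : ∀ d f m → ∑[ j ∈ upTo d ] shift j f m ≤ geom 0 f m
∑-shifts≤geom zero    f m = z≤n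
∑-shifts≤geom (suc d) f zero rewrite ∑-upTo-first d (λ j → shift j f 0) | ∑-0 (upTo d) = ≤-trans (≤-reflexive (+-identityʳ (f 0))) (geom-≥ 0 f 0)
∑-shifts≤geom (suc d) f (suc m) rewrite ∑-upTo-first d (λ j → shift j f (suc m)) =
  ≤-trans (+-monoʳ-≤ (f (suc m)) (∑-shifts≤geom d f m)) (≤-reflexive (sym (geom-step 0 f m)))

geom-mono-step : ∀ a f m → geom a f m ≤ geom a f (suc a + m)
geom-mono-step a f m = subst (geom a f m ≤_) (sym (geom-step a f m)) (m≤n+m _ (f (suc a + m)))

geom-mono-steps : ∀ a f k m → geom a f m ≤ geom a f (k * suc a + m)
geom-mono-steps a f zero    m = ≤-refl
geom-mono-steps a f (suc k) m = ≤-trans (geom-mono-steps a f k m)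
  (≤-trans (geom-mono-step a f (k * suc a + m)) (≤-reflexive (cong (geom a f) (sym (+-assoc (suc a) (k * suc a) m)))))

geom0-mono : ∀ f {m n} → m ≤ n → geom 0 f m ≤ geom 0 f n
geom0-mono f {m} {n} m≤n = ≤-trans (geom-mono-steps 0 f (n ∸ m) m)
  (≤-reflexive (cong (geom 0 f) (trans (cong (_+ m) (*-identityʳ (n ∸ m))) (m∸n+n≡m m≤n))))

-- Partitions into parts of sizes 3, …, z + 2.
parts≥3 : ℕ → ℕ → ℕ
parts≥3 zero    = δ 0
parts≥3 (suc z) = geom (suc (suc z)) (parts≥3 z)

parts≥3-mono : ∀ z d n → parts≥3 z n ≤ parts≥3 (d + z) n
parts≥3-mono z zero    n = ≤-refl
parts≥3-mono z (suc d) n = ≤-trans (parts≥3-mono z d n) (geom-≥ (suc (suc (d + z))) (parts≥3 (d + z)) n)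

-- Brings the parts 1 and 2 to the outside, where other parts can be traded for them.
pp≡geom : ∀ z n → pp (suc (suc z)) n ≡ geom 0 (geom 1 (parts≥3 z)) n
pp≡geom zero    n = geom-comm 1 0 (δ 0) n
pp≡geom (suc z) n = begin
  geom (suc (suc z)) (pp (suc (suc z))) n               ≡⟨ geom-cong (suc (suc z)) (pp≡geom z) n ⟩
  geom (suc (suc z)) (geom 0 (geom 1 (parts≥3 z))) n    ≡⟨ geom-comm (suc (suc z)) 0 (geom 1 (parts≥3 z)) n ⟩
  geom 0 (geom (suc (suc z)) (geom 1 (parts≥3 z))) n    ≡⟨ geom-cong 0 (geom-comm (suc (suc z)) 1 (parts≥3 z)) n ⟩
  geom 0 (geom 1 (parts≥3 (suc z))) n                   ∎
  where open ≡-Reasoning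

module Growth (z : ℕ) where

  -- Among partitions into parts at most `z + 2`: parts at least 3 for `s`, at least 2 for `r`,
  -- different from 2 for `S`, arbitrary for `p̂`. The increments of `p̂` are values of `r`, which
  -- therefore has to be small against `p̂`.
  s r S p̂ : ℕ → ℕ
  s  = parts≥3 z
  r  = geom 1 s
  S  = geom 0 s
  p̂  = geom 0 r

  p̂-mono : ∀ {m n} → m ≤ n → p̂ m ≤ p̂ n
  p̂-mono = geom0-mono r

  -- Take any number of twos up to `B` and partition the rest without twos. The rest is at least
  -- `m`, and `S` is nondecreasing since ones are allowed.
  S-bound : ∀ B m → suc B * S m ≤ p̂ (B * 2 + m)
  S-bound B m = subst (suc B * S m ≤_) (geom-comm 1 0 s (B * 2 + m)) (go B)
    where
    go : ∀ B → suc B * S m ≤ geom 1 S (B * 2 + m)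
    go zero    = subst (_≤ geom 1 S m) (sym (+-identityʳ (S m))) (geom-≥ 1 S m)
    go (suc B) = subst (suc (suc B) * S m ≤_) (sym (geom-step 1 S (B * 2 + m)))
      (+-mono-≤ (geom0-mono s (m≤n+m m (2 + B * 2))) (go B))

  -- `p̂` is the running sum of `r`, and the values of `r` at `m`, `m + 2`, up to `m + 2 M` are at
  -- least `r m`, by adding twos.
  r-bound : ∀ M m → suc M * r m ≤ p̂ (M * 2 + m)
  r-bound zero    m = subst (_≤ p̂ m) (sym (+-identityʳ (r m))) (geom-≥ 0 r m)
  r-bound (suc M) m = begin
    r m + suc M * r m                    ≤⟨ +-mono-≤ (geom-mono-steps 1 s (suc M) m) (r-bound M m) ⟩
    r (suc M * 2 + m) + p̂ (M * 2 + m)    ≤⟨ +-monoʳ-≤ (r (suc M * 2 + m)) (p̂-mono (n≤1+n (M * 2 + m))) ⟩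
    r (suc M * 2 + m) + p̂ (suc (M * 2 + m)) ≡⟨ geom-step 0 r (suc (M * 2 + m)) ⟨
    p̂ (suc M * 2 + m)                    ∎
    where open ≤-Reasoning

  -- Split off the largest part when it exceeds B + 2.
  largest-part : ∀ B d → B + d ≡ z → ∀ n → s n ≤ parts≥3 B n + shift (3 + B) S n
  largest-part B d refl n = begin
    parts≥3 (B + d) n                                                ≡⟨ cong (λ y → parts≥3 y n) (+-comm B d) ⟩
    parts≥3 (d + B) n                                                ≤⟨ go d ≤-refl ⟩
    parts≥3 B n + (∑[ j ∈ upTo d ] shift ((3 + B) + j) s n)          ≡⟨ cong (parts≥3 B n +_) (∑-cong (upTo d) (λ j → sym (shift-shift (3 + B) j s n))) ⟩
    parts≥3 B n + (∑[ j ∈ upTo d ] shift (3 + B) (shift j s) n)      ≡⟨ cong (parts≥3 B n +_) (∑-shift (3 + B) (upTo d) (λ j → shift j s) n) ⟨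
    parts≥3 B n + shift (3 + B) (λ m → ∑[ j ∈ upTo d ] shift j s m) n ≤⟨ +-monoʳ-≤ (parts≥3 B n) (shift-mono (3 + B) n (∑-shifts≤geom d s)) ⟩
    parts≥3 B n + shift (3 + B) S n ∎
    where
    open ≤-Reasoning
    go : ∀ e → e ≤ d → parts≥3 (e + B) n ≤ parts≥3 B n + (∑[ j ∈ upTo e ] shift ((3 + B) + j) s n)
    go zero    _   = m≤m+n _ _
    go (suc e) e<d = begin
      parts≥3 (suc e + B) n
        ≡⟨ geom-unfold (suc (suc (e + B))) (parts≥3 (e + B)) n ⟩
      parts≥3 (e + B) n + shift (3 + (e + B)) (parts≥3 (suc e + B)) n
        ≤⟨ +-mono-≤ (go e (<⇒≤ e<d)) (shift-mono (3 + (e + B)) n (λ m → subst (λ y → parts≥3 (suc e + B) m ≤ parts≥3 y m)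
             (trans (sym (+-assoc (d ∸ suc e) (suc e) B)) (trans (cong (_+ B) (m∸n+n≡m e<d)) (+-comm d B)))
             (parts≥3-mono (suc e + B) (d ∸ suc e) m))) ⟩
      parts≥3 B n + (∑[ j ∈ upTo e ] shift ((3 + B) + j) s n) + shift (3 + (e + B)) s n
        ≡⟨ trans (+-assoc (parts≥3 B n) _ _) (cong (λ b → parts≥3 B n + ((∑[ j ∈ upTo e ] shift ((3 + B) + j) s n) + shift (3 + b) s n)) (+-comm e B)) ⟩
      parts≥3 B n + ((∑[ j ∈ upTo e ] shift ((3 + B) + j) s n) + shift ((3 + B) + e) s n)
        ≡⟨ cong (parts≥3 B n +_) (∑-upTo-last e _) ⟨
      parts≥3 B n + (∑[ j ∈ upTo (suc e) ] shift ((3 + B) + j) s n) ∎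

  -- One more than the sum of `K` copies of each size from 3 to `B + 2`; partitions into these sizes
  -- with fewer than `K` copies of each stay below it.
  threshold : ℕ → ℕ → ℕ
  threshold K zero    = 1
  threshold K (suc B) = K * (3 + B) + threshold K B

  -- A large number partitioned into boundedly many sizes has a part b + 3 repeated K times.
  pigeonhole : ∀ K B n → threshold K B ≤ n → parts≥3 B n ≤ ∑[ b ∈ upTo B ] shift (K * (3 + b)) (parts≥3 B) n
  pigeonhole K zero    (suc n) _ = z≤n
  pigeonhole K (suc B) n h = begin
    parts≥3 (suc B) n
      ≡⟨ geom-blocks (suc (suc B)) (parts≥3 B) K n ⟩
    (∑[ j ∈ upTo K ] shift (j * (3 + B)) (parts≥3 B) n) + last
      ≤⟨ +-monoˡ-≤ last (∑-upTo-mono K block) ⟩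
    (∑[ j ∈ upTo K ] ∑[ b ∈ upTo B ] shift (K * (3 + b)) (shift (j * (3 + B)) (parts≥3 B)) n) + last
      ≡⟨ cong (_+ last) (trans (∑-swap (upTo K) (upTo B) _) (∑-cong (upTo B) (λ b → sym (∑-shift (K * (3 + b)) (upTo K) _ n)))) ⟩
    (∑[ b ∈ upTo B ] shift (K * (3 + b)) (λ m → ∑[ j ∈ upTo K ] shift (j * (3 + B)) (parts≥3 B) m) n) + last
      ≤⟨ +-monoˡ-≤ last (∑-mono (upTo B) (λ b → shift-mono (K * (3 + b)) n (λ m →
           subst ((∑[ j ∈ upTo K ] shift (j * (3 + B)) (parts≥3 B) m) ≤_) (sym (geom-blocks (suc (suc B)) (parts≥3 B) K m)) (m≤m+n _ _)))) ⟩
    (∑[ b ∈ upTo B ] shift (K * (3 + b)) (parts≥3 (suc B)) n) + last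
      ≡⟨ ∑-upTo-last B _ ⟨
    (∑[ b ∈ upTo (suc B) ] shift (K * (3 + b)) (parts≥3 (suc B)) n) ∎
    where
    open ≤-Reasoning
    last = shift (K * (3 + B)) (parts≥3 (suc B)) n
    block : ∀ j → j < K → shift (j * (3 + B)) (parts≥3 B) n ≤ ∑[ b ∈ upTo B ] shift (K * (3 + b)) (shift (j * (3 + B)) (parts≥3 B)) n
    block j j<K = begin
      shift (j * (3 + B)) (parts≥3 B) n
        ≡⟨ shift-∸ (parts≥3 B) (≤-trans j≤ (≤-trans (m≤m+n _ _) h)) ⟩
      parts≥3 B (n ∸ j * (3 + B))
        ≤⟨ pigeonhole K B (n ∸ j * (3 + B)) (m+n≤o⇒m≤o∸n _ (≤-trans (≤-reflexive (+-comm (threshold K B) _)) (≤-trans (+-monoˡ-≤ (threshold K B) j≤) h))) ⟩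
      (∑[ b ∈ upTo B ] shift (K * (3 + b)) (parts≥3 B) (n ∸ j * (3 + B)))
        ≡⟨ ∑-cong (upTo B) (λ b → trans (sym (shift-∸ (shift (K * (3 + b)) (parts≥3 B)) (≤-trans j≤ (≤-trans (m≤m+n _ _) h))))
             (shift-comm (j * (3 + B)) (K * (3 + b)) (parts≥3 B) n)) ⟩
      (∑[ b ∈ upTo B ] shift (K * (3 + b)) (shift (j * (3 + B)) (parts≥3 B)) n) ∎
      where
      j≤ : j * (3 + B) ≤ K * (3 + B)
      j≤ = *-monoˡ-≤ (3 + B) (<⇒≤ j<K)

  -- `K` copies of a size `b + 3` make room for up to `K` twos, so `S-bound` gains a factor above
  -- `K`; `B` counts the choices of `b`.
  repeated : ∀ K B d n → B + d ≡ z → threshold K B ≤ n → K * parts≥3 B n ≤ B * p̂ n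
  repeated K B d n eq h = begin
    K * parts≥3 B n                                             ≤⟨ *-monoʳ-≤ K (pigeonhole K B n h) ⟩
    K * (∑[ b ∈ upTo B ] shift (K * (3 + b)) (parts≥3 B) n)     ≡⟨ ∑-*ˡ K (upTo B) _ ⟨
    (∑[ b ∈ upTo B ] (K * shift (K * (3 + b)) (parts≥3 B) n))   ≤⟨ ∑-mono (upTo B) term ⟩
    (∑[ b ∈ upTo B ] p̂ n)                                       ≡⟨ ∑-upTo-const B (p̂ n) ⟩
    B * p̂ n                                                     ∎
    where
    open ≤-Reasoning
    term : ∀ b → K * shift (K * (3 + b)) (parts≥3 B) n ≤ p̂ n
    term b with K * (3 + b) ≤? n
    ... | no  K≰n = ≤-trans (≤-reflexive (trans (cong (K *_) (shift-< (parts≥3 B) (≰⇒> K≰n))) (*-zeroʳ K))) z≤n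
    ... | yes K≤n = begin
      K * shift (K * (3 + b)) (parts≥3 B) n ≡⟨ cong (K *_) (shift-∸ (parts≥3 B) K≤n) ⟩
      K * parts≥3 B m                       ≤⟨ *-mono-≤ (n≤1+n K) (≤-trans (subst (λ y → parts≥3 B m ≤ parts≥3 y m)
                                                 (trans (+-comm d B) eq) (parts≥3-mono B d m)) (geom-≥ 0 s m)) ⟩
      suc K * S m                           ≤⟨ S-bound K m ⟩
      p̂ (K * 2 + m)                         ≤⟨ p̂-mono (≤-trans (+-monoˡ-≤ m (*-monoʳ-≤ K (s≤s (s≤s (z≤n {suc b}))))) (≤-reflexive (m+[n∸m]≡n K≤n))) ⟩
      p̂ n                                   ∎
      where m = n ∸ K * (3 + b)

  -- If all parts are at most `B + 2`, a size is repeated, and `suc Q * B` repetitions offset the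
  -- factor `B` in `repeated`. A larger part makes room for up to `Q` twos.
  s-bound : ∀ {Q B d n} → B ≡ suc Q * 2 → B + d ≡ z → threshold (suc Q * B) B ≤ n → suc Q * s n ≤ 2 * p̂ n
  s-bound {Q} {B} {d} {n} B≡ eq h = begin
    suc Q * s n                                          ≤⟨ *-monoʳ-≤ (suc Q) (largest-part B d eq n) ⟩
    suc Q * (parts≥3 B n + shift (3 + B) S n)            ≡⟨ *-distribˡ-+ (suc Q) (parts≥3 B n) _ ⟩
    suc Q * parts≥3 B n + suc Q * shift (3 + B) S n      ≤⟨ +-mono-≤ small big ⟩
    p̂ n + p̂ n                                            ≡⟨ cong (p̂ n +_) (+-identityʳ (p̂ n)) ⟨
    2 * p̂ n                                              ∎
    where
    open ≤-Reasoning
    small : suc Q * parts≥3 B n ≤ p̂ n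
    small = *-cancelˡ-≤ B {{subst NonZero (sym B≡) _}} (≤-trans (≤-reflexive (lemma B (suc Q) (parts≥3 B n))) (repeated (suc Q * B) B d n eq h))
      where
      lemma : ∀ b q x → b * (q * x) ≡ q * b * x
      lemma = solve-∀
    big : suc Q * shift (3 + B) S n ≤ p̂ n
    big with 3 + B ≤? n
    ... | no  B≰n = ≤-trans (≤-reflexive (trans (cong (suc Q *_) (shift-< S (≰⇒> B≰n))) (*-zeroʳ (suc Q)))) z≤n
    ... | yes B≤n = begin
      suc Q * shift (3 + B) S n   ≡⟨ cong (suc Q *_) (shift-∸ S B≤n) ⟩
      suc Q * S (n ∸ (3 + B))     ≤⟨ S-bound Q (n ∸ (3 + B)) ⟩
      p̂ (Q * 2 + (n ∸ (3 + B)))   ≤⟨ p̂-mono (≤-trans (+-monoˡ-≤ (n ∸ (3 + B)) (≤-trans (≤-trans (m≤n+m (Q * 2) 2) (≤-reflexive (sym B≡))) (m≤n+m B 3))) (≤-reflexive (m+[n∸m]≡n B≤n))) ⟩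
      p̂ n                         ∎

  -- With more than `M` twos `r-bound` applies. Otherwise `M + 1` values of `s` remain, each at most
  -- 2 / (Q + 1) of `p̂ n`; the choice of `Q` makes them together at most 1 / (M + 1) of it.
  r-small : ∀ {M Q B d n} → suc Q ≡ 2 * suc M * suc M → B ≡ suc Q * 2 → B + d ≡ z →
            threshold (suc Q * B) B + suc M * 2 ≤ n → suc M * r n ≤ 2 * p̂ n
  r-small {M} {Q} {B} {d} {n} Q≡ B≡ eq h = begin
    suc M * r n                                                               ≡⟨ cong (suc M *_) (geom-blocks 1 s (suc M) n) ⟩
    suc M * ((∑[ j ∈ upTo (suc M) ] shift (j * 2) s n) + shift (suc M * 2) r n) ≡⟨ *-distribˡ-+ (suc M) (∑[ j ∈ upTo (suc M) ] shift (j * 2) s n) _ ⟩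
    suc M * (∑[ j ∈ upTo (suc M) ] shift (j * 2) s n) + suc M * shift (suc M * 2) r n ≤⟨ +-mono-≤ few many ⟩
    p̂ n + p̂ n                                                                 ≡⟨ cong (p̂ n +_) (+-identityʳ (p̂ n)) ⟨
    2 * p̂ n                                                                   ∎
    where
    open ≤-Reasoning
    few : suc M * (∑[ j ∈ upTo (suc M) ] shift (j * 2) s n) ≤ p̂ n
    few = *-cancelˡ-≤ (2 * suc M) (begin
      2 * suc M * (suc M * (∑[ j ∈ upTo (suc M) ] shift (j * 2) s n))  ≡⟨ trans (sym (*-assoc (2 * suc M) (suc M) _)) (cong (_* (∑[ j ∈ upTo (suc M) ] shift (j * 2) s n)) (sym Q≡)) ⟩
      suc Q * (∑[ j ∈ upTo (suc M) ] shift (j * 2) s n)                ≡⟨ ∑-*ˡ (suc Q) (upTo (suc M)) _ ⟨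
      (∑[ j ∈ upTo (suc M) ] (suc Q * shift (j * 2) s n))              ≤⟨ ∑-upTo-mono (suc M) term ⟩
      (∑[ j ∈ upTo (suc M) ] (2 * p̂ n))                                ≡⟨ ∑-upTo-const (suc M) (2 * p̂ n) ⟩
      suc M * (2 * p̂ n)                                                ≡⟨ lemma (suc M) (p̂ n) ⟩
      2 * suc M * p̂ n                                                  ∎)
      where
      lemma : ∀ m x → m * (2 * x) ≡ 2 * m * x
      lemma = solve-∀
      term : ∀ j → j < suc M → suc Q * shift (j * 2) s n ≤ 2 * p̂ n
      term j j<M = begin
        suc Q * shift (j * 2) s n ≡⟨ cong (suc Q *_) (shift-∸ s (≤-trans j≤ (≤-trans (m≤n+m _ _) h))) ⟩
        suc Q * s (n ∸ j * 2)     ≤⟨ s-bound {Q} B≡ eq (m+n≤o⇒m≤o∸n _ (≤-trans (+-monoʳ-≤ _ j≤) h)) ⟩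
        2 * p̂ (n ∸ j * 2)         ≤⟨ *-monoʳ-≤ 2 (p̂-mono (m∸n≤m n (j * 2))) ⟩
        2 * p̂ n                   ∎
        where
        j≤ : j * 2 ≤ suc M * 2
        j≤ = *-monoˡ-≤ 2 (<⇒≤ j<M)
    many : suc M * shift (suc M * 2) r n ≤ p̂ n
    many = begin
      suc M * shift (suc M * 2) r n     ≡⟨ cong (suc M *_) (shift-∸ r 2M≤n) ⟩
      suc M * r (n ∸ suc M * 2)         ≤⟨ r-bound M (n ∸ suc M * 2) ⟩
      p̂ (M * 2 + (n ∸ suc M * 2))       ≤⟨ p̂-mono (≤-trans (+-monoˡ-≤ (n ∸ suc M * 2) (m≤n+m (M * 2) 2)) (≤-reflexive (m+[n∸m]≡n 2M≤n))) ⟩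
      p̂ n                               ∎
      where
      2M≤n : suc M * 2 ≤ n
      2M≤n = ≤-trans (m≤n+m (suc M * 2) _) h

private
  P-increment-from : ∀ M Q B → suc Q ≡ 2 * suc M * suc M → B ≡ suc Q * 2 →
                     ∃[ N ] (∀ n → N ≤ n → suc M * (P (suc n) ∸ P n) ≤ 2 * P (suc n))
  -- The value of `threshold` does not depend on the parameter of `Growth`; taking it at 0 makes the
  -- bound uniform in `n`, whereas the estimates use `Growth n`.
  P-increment-from M Q B Q≡ B≡ = Growth.threshold 0 (suc Q * B) B + suc M * 2 + B , bound
    where
    bound : ∀ n → Growth.threshold 0 (suc Q * B) B + suc M * 2 + B ≤ n → suc M * (P (suc n) ∸ P n) ≤ 2 * P (suc n)
    bound n N≤n = begin
      suc M * (P (suc n) ∸ P n)            ≡⟨ cong₂ (λ x y → suc M * (x ∸ y)) P≡ P≡′ ⟩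
      suc M * (p̂ (suc n) ∸ p̂ n)            ≡⟨ cong (λ x → suc M * (x ∸ p̂ n)) (geom-step 0 r n) ⟩
      suc M * (r (suc n) + p̂ n ∸ p̂ n)      ≡⟨ cong (suc M *_) (m+n∸n≡m (r (suc n)) (p̂ n)) ⟩
      suc M * r (suc n)                    ≤⟨ r-small {M} {Q} {B} {n ∸ B} {suc n} Q≡ B≡ (m+[n∸m]≡n (≤-trans (m≤n+m B _) N≤n))
                                                (≤-trans (≤-reflexive (cong (_+ suc M * 2) (threshold-irrelevant _ B)))
                                                  (≤-trans (≤-trans (m≤m+n _ B) N≤n) (n≤1+n n))) ⟩
      2 * p̂ (suc n)                        ≡⟨ cong (2 *_) P≡ ⟨
      2 * P (suc n)                        ∎
      where
      open ≤-Reasoning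
      open Growth n
      threshold-irrelevant : ∀ K B → Growth.threshold n K B ≡ Growth.threshold 0 K B
      threshold-irrelevant K zero    = refl
      threshold-irrelevant K (suc B) = cong (K * (3 + B) +_) (threshold-irrelevant K B)
      P≡ : P (suc n) ≡ p̂ (suc n)
      P≡ = trans (sym (pp≡P (n≤1+n (suc n)))) (pp≡geom n (suc n))
      P≡′ : P n ≡ p̂ n
      P≡′ = trans (sym (pp≡P (≤-trans (n≤1+n n) (n≤1+n (suc n))))) (pp≡geom n n)

P-increment : ∀ M → ∃[ N ] (∀ n → N ≤ n → suc M * (P (suc n) ∸ P n) ≤ 2 * P (suc n))
P-increment M = P-increment-from M (pred Q) (suc (pred Q) * 2) (suc-pred Q) refl
  where Q = 2 * suc M * suc M

-- Adds up `d` increments, each small enough that together they stay below 1 / J of the last value;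
-- the common factors `d` and 2 are cancelled afterwards.
P-drop : ∀ J d N → (∀ n → N ≤ n → suc (2 * (J * d)) * (P (suc n) ∸ P n) ≤ 2 * P (suc n)) →
         ∀ n → N ≤ n → d * (2 * (J * (P (d + n) ∸ P n))) ≤ d * (2 * P (d + n))
P-drop J d N bound n N≤n = ≤-trans (≤-reflexive (regroup d J (P (d + n) ∸ P n))) (steps d)
  where
  M = 2 * (J * d)
  regroup : ∀ d J x → d * (2 * (J * x)) ≡ 2 * (J * d) * x
  regroup = solve-∀
  steps : ∀ e → M * (P (e + n) ∸ P n) ≤ e * (2 * P (e + n))
  steps zero    = ≤-reflexive (trans (cong (M *_) (n∸n≡0 (P n))) (*-zeroʳ M))
  steps (suc e) = begin
    M * (P (suc e + n) ∸ P n)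
      ≤⟨ *-monoʳ-≤ M (triangle (P (suc e + n)) (P (e + n)) (P n)) ⟩
    M * ((P (suc e + n) ∸ P (e + n)) + (P (e + n) ∸ P n))
      ≡⟨ *-distribˡ-+ M (P (suc e + n) ∸ P (e + n)) _ ⟩
    M * (P (suc e + n) ∸ P (e + n)) + M * (P (e + n) ∸ P n)
      ≤⟨ +-mono-≤ (≤-trans (*-monoˡ-≤ _ (n≤1+n M)) (bound (e + n) (≤-trans N≤n (m≤n+m n e))))
           (≤-trans (steps e) (*-monoʳ-≤ e (*-monoʳ-≤ 2 (P-mono-suc (e + n))))) ⟩
    suc e * (2 * P (suc e + n)) ∎
    where
    open ≤-Reasoning
    triangle : ∀ x y w → x ∸ w ≤ (x ∸ y) + (y ∸ w)
    triangle x y w = m≤n+o⇒m∸n≤o x w (begin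
      x                           ≤⟨ m≤n+m∸n x y ⟩
      y + (x ∸ y)                 ≤⟨ +-monoˡ-≤ (x ∸ y) (m≤n+m∸n y w) ⟩
      w + (y ∸ w) + (x ∸ y)       ≡⟨ lemma w (y ∸ w) (x ∸ y) ⟩
      w + ((x ∸ y) + (y ∸ w))     ∎)
      where
      lemma : ∀ w a b → w + a + b ≡ w + (b + a)
      lemma = solve-∀

abstract
  P-slow : ∀ J d → ∃[ N ] (∀ n → N ≤ n → J * (P (d + n) ∸ P n) ≤ P (d + n))
  P-slow J zero      = 0 , λ n _ → ≤-trans (≤-reflexive (trans (cong (J *_) (n∸n≡0 (P n))) (*-zeroʳ J))) z≤n
  P-slow J (suc d)   = proj₁ (P-increment (2 * (J * suc d))) , λ n N≤n →
    *-cancelˡ-≤ 2 (*-cancelˡ-≤ (suc d) (P-drop J (suc d) _ (proj₂ (P-increment (2 * (J * suc d)))) n N≤n))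

-- Asymptotic equality

-- The case of a single runner: the charge is forced to be `K`, its ground energy is `tri K`, and
-- the level is `n` itself.
p≡P : ∀ n → p n ≡ P n
p≡P n = begin
  p n                                                ≡⟨ p≡∑mass ≤-refl ⟩
  ∑ box (mass n)                                     ≡⟨ ∑-vecs (upTo X) 0 (mass n) ⟩
  (∑[ c ∈ upTo X ] (mass n (c ∷ []) + 0))            ≡⟨ ∑-cong (upTo X) (λ c → trans (+-identityʳ _)
      (cong (_* fill (n + tri K) (ground 1 (c ∷ []))) (trans (cong (λ y → δ y K) (+-identityʳ c)) (δ-comm c K)))) ⟩
  (∑[ c ∈ upTo X ] (δ K c * fill (n + tri K) (ground 1 (c ∷ [])))) ≡⟨ ∑-δ _ K<X ⟩
  fill (n + tri K) (ground 1 (K ∷ []))               ≡⟨ ∑-vecs (upTo Y) 0 _ ⟩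
  (∑[ e ∈ upTo Y ] (δ (1 * (e + 0) + ground 1 (K ∷ [])) (n + tri K) * (P e * 1) + 0)) ≡⟨ ∑-cong (upTo Y) (λ e → trans (+-identityʳ _)
      (cong₂ _*_ (δ-iff {m′ = n} {e} (λ eq → sym (+-cancelʳ-≡ (tri K) e n (trans (sym (lemma e (tri K))) eq))) (λ { refl → lemma n (tri K) }))
        (*-identityʳ (P e)))) ⟩
  (∑[ e ∈ upTo Y ] (δ n e * P e))                    ≡⟨ ∑-δ P (s≤s (≤-trans (m≤m+n n (tri K)) (m≤n+m _ (L * L)))) ⟩
  P n                                                ∎
  where
  open ≡-Reasoning
  open Lattice 1 n (s≤s z≤n)
  lemma : ∀ e t → 1 * (e + 0) + (1 * t + 0 + 0) ≡ e + t
  lemma = solve-∀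
  K<X : K < X
  K<X = s≤s (≤-trans (≤-reflexive (+-identityʳ (4 * n))) (*-monoˡ-≤ n (m≤m+n 4 4)))

P-positive : ∀ e → 1 ≤ P e
P-positive e = ≤-trans (P-mono e 0) (≤-reflexive (cong P (+-identityʳ e)))

infix 4 _≈_

-- The difference is o(p(n)), with `J` in the role of 1 / ε so that only natural numbers occur.
record _≈_ (A B : ℕ → ℕ) : Set where
  constructor eventually
  field close : ∀ J → ∃[ N ] (∀ n → N ≤ n → J * ∣ A n - B n ∣ ≤ p n)

open _≈_

≈-≡ : ∀ {A B} → (∀ n → A n ≡ B n) → A ≈ B
≈-≡ {A} {B} e .close J = 0 , λ n _ → ≤-trans (≤-reflexive (trans (cong (J *_) (m≡n⇒∣m-n∣≡0 (e n))) (*-zeroʳ J))) z≤n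

≈-refl : ∀ {A} → A ≈ A
≈-refl = ≈-≡ (λ _ → refl)

≈-sym : ∀ {A B} → A ≈ B → B ≈ A
≈-sym {A} {B} h .close J = proj₁ (close h J) , λ n N≤n → subst (λ x → J * x ≤ p n) (∣-∣-comm (A n) (B n)) (proj₂ (close h J) n N≤n)

private
  halve : ∀ {J x a b q} → x ≤ a + b → 2 * J * a ≤ q → 2 * J * b ≤ q → J * x ≤ q
  halve {J} {x} {a} {b} {q} h ha hb = *-cancelˡ-≤ 2 (begin
    2 * (J * x)             ≡⟨ *-assoc 2 J x ⟨
    2 * J * x               ≤⟨ *-monoʳ-≤ (2 * J) h ⟩
    2 * J * (a + b)         ≡⟨ *-distribˡ-+ (2 * J) a b ⟩
    2 * J * a + 2 * J * b   ≤⟨ +-mono-≤ ha hb ⟩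
    q + q                   ≡⟨ cong (q +_) (+-identityʳ q) ⟨
    2 * q                   ∎)
    where open ≤-Reasoning

∣-∣-+-≤ : ∀ a b c d → ∣ a + b - c + d ∣ ≤ ∣ a - c ∣ + ∣ b - d ∣
∣-∣-+-≤ a b c d = ≤-trans (∣-∣-triangle (a + b) (c + b) (c + d))
  (+-mono-≤ (≤-reflexive (trans (cong₂ ∣_-_∣ (+-comm a b) (+-comm c b)) (∣m+n-m+o∣≡∣n-o∣ b a c)))
            (≤-reflexive (∣m+n-m+o∣≡∣n-o∣ c b d)))

≈-trans : ∀ {A B C} → A ≈ B → B ≈ C → A ≈ C
≈-trans {A} {B} {C} h k .close J = proj₁ (close h (2 * J)) + proj₁ (close k (2 * J)) , λ n N≤n →
  halve {J} (∣-∣-triangle (A n) (B n) (C n))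
    (proj₂ (close h (2 * J)) n (m+n≤o⇒m≤o _ N≤n)) (proj₂ (close k (2 * J)) n (m+n≤o⇒n≤o (proj₁ (close h (2 * J))) N≤n))

≈-+ : ∀ {A B C D} → A ≈ B → C ≈ D → (λ n → A n + C n) ≈ (λ n → B n + D n)
≈-+ {A} {B} {C} {D} h k .close J = proj₁ (close h (2 * J)) + proj₁ (close k (2 * J)) , λ n N≤n →
  halve {J} (∣-∣-+-≤ (A n) (C n) (B n) (D n))
    (proj₂ (close h (2 * J)) n (m+n≤o⇒m≤o _ N≤n)) (proj₂ (close k (2 * J)) n (m+n≤o⇒n≤o (proj₁ (close h (2 * J))) N≤n))

≈-* : ∀ k {A B} → A ≈ B → (λ n → k * A n) ≈ (λ n → k * B n)
≈-* k {A} {B} h .close J = proj₁ (close h (J * k)) , λ n N≤n →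
  subst (_≤ p n) (trans (*-assoc J k _) (cong (J *_) (*-distribˡ-∣-∣ k (A n) (B n)))) (proj₂ (close h (J * k)) n N≤n)

≈-cancelʳ : ∀ (C : ℕ → ℕ) {A B} → (λ n → A n + C n) ≈ (λ n → B n + C n) → A ≈ B
≈-cancelʳ C {A} {B} h .close J = proj₁ (close h J) , λ n N≤n → subst (λ x → J * x ≤ p n)
  {x = ∣ A n + C n - B n + C n ∣} {∣ A n - B n ∣}
  (trans (cong₂ ∣_-_∣ (+-comm (A n) (C n)) (+-comm (B n) (C n))) (∣m+n-m+o∣≡∣n-o∣ (C n) (A n) (B n))) (proj₂ (close h J) n N≤n)

p-slow : ∀ J d → ∃[ N ] (∀ n → N ≤ n → J * (p (d + n) ∸ p n) ≤ p (d + n))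
p-slow J d = proj₁ (P-slow J d) , λ n N≤n → subst₂ (λ x y → J * (x ∸ y) ≤ x) (sym (p≡P (d + n))) (sym (p≡P n)) (proj₂ (P-slow J d) n N≤n)

module Asymptotics (T : ℕ) (0<T : 0 < T) where

  box : ℕ → List (Vec ℕ T)
  box n = Lattice.box T n 0<T

  mass : ℕ → Vec ℕ T → ℕ
  mass n = Lattice.mass T n 0<T n

  sumOver : (Vec ℕ T → Bool) → ℕ → ℕ
  sumOver f n = ∑[ c ∈ box n ] (𝟙 (f c) * mass n c)

  sumOver-cong : ∀ {f g} → (∀ c → f c ≡ g c) → ∀ n → sumOver f n ≡ sumOver g n
  sumOver-cong e n = ∑-cong (box n) (λ c → cong (λ b → 𝟙 b * mass n c) (e c))

  sumOver-split : ∀ (f g : Vec ℕ T → Bool) n → sumOver f n ≡ sumOver (λ c → g c ∧ f c) n + sumOver (λ c → not (g c) ∧ f c) n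
  sumOver-split f g n = trans (∑-cong (box n) (λ c → split (g c) (f c) (mass n c))) (∑-+ (box n) (λ c → 𝟙 (g c ∧ f c) * mass n c) (λ c → 𝟙 (not (g c) ∧ f c) * mass n c))
    where
    split : ∀ a b m → 𝟙 b * m ≡ 𝟙 (a ∧ b) * m + 𝟙 (not a ∧ b) * m
    split true  b m = sym (+-identityʳ _)
    split false b m = refl

  sumOver-true : ∀ n → sumOver (λ _ → true) n ≡ p n
  sumOver-true n = trans (∑-cong (box n) (λ c → +-identityʳ (mass n c))) (sym (Lattice.p≡∑mass T n 0<T ≤-refl))

  private
    ∣-∣-bound : ∀ J {x y e} → J * x ≤ J * y + e → J * y ≤ J * x + e → J * ∣ x - y ∣ ≤ e
    ∣-∣-bound J {x} {y} {e} h k = subst (_≤ e) (sym (*-distribˡ-∣-∣ J x y)) (go (J * x) (J * y) h k)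
      where
      go : ∀ a b → a ≤ b + e → b ≤ a + e → ∣ a - b ∣ ≤ e
      go a b h k with ≤-total a b
      ... | inj₁ a≤b = subst (_≤ e) (sym (m≤n⇒∣m-n∣≡n∸m a≤b)) (m≤n+o⇒m∸n≤o b a k)
      ... | inj₂ b≤a = subst (_≤ e) (sym (m≤n⇒∣n-m∣≡n∸m b≤a)) (m≤n+o⇒m∸n≤o a b h)

    -- A move controls losses only, so the absolute difference needs the move from `b` to `a` and
    -- its reverse.
    transfer-bound : ∀ {a b : Fin T} {m u v} J → a ≢ b → residue a * m + T * u ≡ residue b * m + T * v →
      (f g : Vec ℕ T → Bool) → (∀ c → f (bump b m c) ≡ g (bump a m c)) →
      ∀ n₀ → m + m * J ≤ n₀ → let n = T * (2 * (m * m * J)) + n₀ in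
      J * (p n ∸ p n₀) ≤ p n → J * ∣ sumOver f n - sumOver g n ∣ ≤ 2 * p n
    transfer-bound {a} {b} {m} {u} {v} J a≢b res f g fg n₀ big slow =
      ∣-∣-bound J {sumOver f n} {sumOver g n}
        (≤-trans (Transfer.Pair.Steps.transfer-≤ T n 0<T a≢b res ≤-refl J mJ≤ refl (𝟙 ∘ f) (𝟙 ∘ g) (𝟙≤1 ∘ f) (λ c → cong 𝟙 (fg c)) m≤)
          (+-monoʳ-≤ (J * sumOver g n) error))
        (≤-trans (Transfer.Pair.Steps.transfer-≤ T n 0<T (a≢b ∘ sym) (sym res) ≤-refl J mJ≤ refl (𝟙 ∘ g) (𝟙 ∘ f) (𝟙≤1 ∘ g) (λ c → cong 𝟙 (sym (fg c))) m≤)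
          (+-monoʳ-≤ (J * sumOver f n) error))
      where
      n = T * (2 * (m * m * J)) + n₀
      n₀≤2n : n₀ ≤ 2 * n
      n₀≤2n = ≤-trans (m≤n+m n₀ _) (m≤m+n n _)
      mJ≤ : m * J ≤ 2 * n
      mJ≤ = ≤-trans (m+n≤o⇒n≤o m big) n₀≤2n
      m≤ : m ≤ 2 * n
      m≤ = ≤-trans (m+n≤o⇒m≤o m big) n₀≤2n
      𝟙≤1 : ∀ x → 𝟙 x ≤ 1
      𝟙≤1 true  = ≤-refl
      𝟙≤1 false = z≤n
      error : p n + J * (p n ∸ p n₀) ≤ 2 * p n
      error = +-monoʳ-≤ (p n) (≤-trans slow (≤-reflexive (sym (+-identityʳ (p n)))))

  transfer : ∀ {a b : Fin T} {m u v} → a ≢ b → residue a * m + T * u ≡ residue b * m + T * v →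
    (f g : Vec ℕ T → Bool) → (∀ c → f (bump b m c) ≡ g (bump a m c)) → sumOver f ≈ sumOver g
  transfer {a} {b} {m} a≢b res f g fg .close J = d + (m + m * J₂ + N) , bound
    where
    -- Doubled because `transfer-bound` leaves the error `2 * p n`.
    J₂ = 2 * J
    d = T * (2 * (m * m * J₂))
    N = proj₁ (p-slow J₂ d)
    bound : ∀ n → d + (m + m * J₂ + N) ≤ n → J * ∣ sumOver f n - sumOver g n ∣ ≤ p n
    bound n h = *-cancelˡ-≤ 2 (subst (λ n → 2 * (J * ∣ sumOver f n - sumOver g n ∣) ≤ 2 * p n) (m+[n∸m]≡n (m+n≤o⇒m≤o d h))
      (≤-trans (≤-reflexive (sym (*-assoc 2 J _)))
        (transfer-bound J₂ a≢b res f g fg (n ∸ d) (m+n≤o⇒m≤o (m + m * J₂) large)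
          (proj₂ (p-slow J₂ d) (n ∸ d) (m+n≤o⇒n≤o (m + m * J₂) large)))))
      where
      large : m + m * J₂ + N ≤ n ∸ d
      large = m+n≤o⇒m≤o∸n _ (≤-trans (≤-reflexive (+-comm (m + m * J₂ + N) d)) h)

-- Parities

odd : ℕ → Bool
odd zero    = false
odd (suc n) = not (odd n)

odd-+ : ∀ a b → odd (a + b) ≡ odd a xor odd b
odd-+ zero    b = refl
odd-+ (suc a) b = trans (cong not (odd-+ a b)) (not-distribˡ-xor (odd a) (odd b))

odd-* : ∀ a b → odd (a * b) ≡ odd a ∧ odd b
odd-* zero    b = refl
odd-* (suc a) b = trans (odd-+ b (a * b)) (trans (cong (odd b xor_) (odd-* a b)) (step (odd a) (odd b)))
  where
  step : ∀ x y → y xor (x ∧ y) ≡ not x ∧ y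
  step true  y = xor-same y
  step false y = xor-identityʳ y

odd-2* : ∀ k → odd (k * 2) ≡ false
odd-2* k = trans (odd-* k 2) (∧-zeroʳ (odd k))

halves : ∀ n → ∃[ k ] (n ≡ 𝟙 (odd n) + k * 2)
halves zero = 0 , refl
halves (suc n) with odd n | halves n
... | true  | k , e = suc k , cong suc e
... | false | k , e = k , cong suc e

2∣⇔even : ∀ n → does (2 ∣? n) ≡ not (odd n)
2∣⇔even n with odd n in eq | halves n
... | false | k , e = dec-true (2 ∣? n) (divides k e)
... | true  | _     = dec-false (2 ∣? n) λ { (divides k e) → case (trans (sym eq) (trans (cong odd e) (odd-2* k))) }
  where
  case : ¬ (true ≡ false)
  case ()

2∣⇒even : ∀ {n} → 2 ∣ n → odd n ≡ false
2∣⇒even (divides k refl) = odd-2* k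

2∤⇒odd : ∀ {n} → ¬ (2 ∣ n) → odd n ≡ true
2∤⇒odd {n} h with odd n in eq | halves n
... | true  | _     = refl
... | false | k , e = ⊥-elim (h (divides k e))

pe≡∑ : ∀ t n → pe t n ≡ ∑[ l ∈ partitions n ] 𝟙 (not (odd (numHt t l)))
pe≡∑ t n = trans (length-filter _ (partitions n)) (∑-cong (partitions n) (λ l → cong 𝟙 (2∣⇔even (numHt t l))))

po≡∑ : ∀ t n → po t n ≡ ∑[ l ∈ partitions n ] 𝟙 (odd (numHt t l))
po≡∑ t n = trans (length-filter _ (partitions n)) (∑-cong (partitions n) (λ l →
  cong 𝟙 (trans (cong not (2∣⇔even (numHt t l))) (not-involutive (odd (numHt t l))))))

pe+po≡p : ∀ t n → pe t n + po t n ≡ p n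
pe+po≡p t n = trans (cong₂ _+_ (pe≡∑ t n) (po≡∑ t n)) (trans (sym (∑-+ (partitions n) _ _))
  (trans (∑-cong (partitions n) (λ l → trans (+-comm (𝟙 (not (odd (numHt t l)))) _) (𝟙+𝟙-not (odd (numHt t l))))) (sym (length≡∑ (partitions n)))))

p-positive : ∀ n → 1 ≤ p n
p-positive n = subst (1 ≤_) (sym (p≡P n)) (P-positive n)

residue-surjective : ∀ t r → r < t → Σ[ i ∈ Fin t ] (residue i ≡ r)
residue-surjective (suc t) r r<t with r ≟ t
... | yes refl = Fin.zero , refl
... | no  r≢t with i , e ← residue-surjective t r (≤∧≢⇒< (s≤s⁻¹ r<t) r≢t) = Fin.suc i , e

-- Even t: two colours of charges exchanged by one transfer

module Even (h : ℕ) where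

  T = 2 * suc h
  0<T : 0 < T
  0<T = s≤s z≤n

  open Asymptotics T 0<T

  quotient-+ : ∀ x k → (x + T * k) / T ≡ x / T + k
  quotient-+ x k = trans (+-distrib-/-∣ʳ x (divides k (*-comm T k))) (cong (x / T +_) (trans (cong (_/ T) (*-comm T k)) (m*n/n≡m k T)))

  -- Modulo 2, the quotient of the ground energy by T is the number of T-hooks up to a constant;
  -- moving two beads between runners half a period apart changes it by an odd number.
  colour : Bool → Vec ℕ T → Bool
  colour s c = odd (ground T c / T) xor s

  colours-≈ : sumOver (colour true) ≈ sumOver (colour false)
  colours-≈ = transfer {a} {b} {2} {0} {1} a≢b residues (colour true) (colour false) flip
    where
    a b : Fin T
    a = proj₁ (residue-surjective T (h + suc h) (s≤s (≤-reflexive (cong (h +_) (sym (+-identityʳ (suc h)))))))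
    b = proj₁ (residue-surjective T h (s≤s (m≤m+n h (suc h + 0))))
    ra : residue a ≡ h + suc h
    ra = proj₂ (residue-surjective T (h + suc h) (s≤s (≤-reflexive (cong (h +_) (sym (+-identityʳ (suc h)))))))
    rb : residue b ≡ h
    rb = proj₂ (residue-surjective T h (s≤s (m≤m+n h (suc h + 0))))
    a≢b : a ≢ b
    a≢b e = m≢1+m+n h (trans (trans (sym rb) (trans (cong residue (sym e)) ra)) (+-suc h h))
    residues : residue a * 2 + T * 0 ≡ residue b * 2 + T * 1
    residues rewrite ra | rb = lemma h
      where
      lemma : ∀ h → (h + suc h) * 2 + 2 * suc h * 0 ≡ h * 2 + 2 * suc h * 1
      lemma = solve-∀
    flip : ∀ c → colour true (bump b 2 c) ≡ colour false (bump a 2 c)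
    flip c = begin
      odd y xor true                           ≡⟨ xor-comm (odd y) true ⟩
      not (odd y)                              ≡⟨ same ⟨
      odd x                                    ≡⟨ xor-identityʳ (odd x) ⟨
      odd x xor false                          ∎
      where
      open ≡-Reasoning
      x = ground T (bump a 2 c) / T
      y = ground T (bump b 2 c) / T
      levels : x + (2 * lookup c b + 0) ≡ y + (2 * lookup c a + 1)
      levels = trans (sym (quotient-+ (ground T (bump a 2 c)) _)) (trans (cong (_/ T)
        -- The energy identity does not involve the truncation, so the parameter 0 is an arbitrary
        -- choice.
        (Transfer.Pair.transfer-energy T 0 0<T {a} {b} {2} {0} {1} a≢b residues ≤-refl c)) (quotient-+ (ground T (bump b 2 c)) _))
      parity-2* : ∀ x k e → odd (x + (2 * k + e)) ≡ odd x xor odd e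
      parity-2* x k e = trans (odd-+ x (2 * k + e)) (cong (odd x xor_) (trans (odd-+ (2 * k) e) (cong (_xor odd e) (odd-* 2 k))))
      same : odd x ≡ not (odd y)
      same = trans (sym (xor-identityʳ (odd x))) (trans (sym (parity-2* x (lookup c b) 0)) (trans (cong odd levels)
        (trans (parity-2* y (lookup c a) 1) (xor-comm (odd y) true))))

  module _ (n : ℕ) where
    open Lattice T n 0<T using (K; Balanced; balanced; ∑-partitions-mass)

    -- Which colour means an odd hook number varies with `n`; since the colours are asymptotically
    -- equal, both assignments give the same limit.
    top : Bool
    top = odd ((n + tri K) / T)

    level-parity : ∀ c S → Balanced n c S → odd S ≡ colour top c
    level-parity c S (balanced _ e) = begin
      odd S                                 ≡⟨ cancel (odd g) (odd S) ⟩
      odd g xor (odd g xor odd S)           ≡⟨ cong (odd g xor_) (odd-+ g S) ⟨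
      odd g xor odd (g + S)                 ≡⟨ cong (λ x → odd g xor odd x) (quotient-+ (ground T c) S) ⟨
      odd g xor odd ((ground T c + T * S) / T) ≡⟨ cong (λ x → odd g xor odd (x / T)) (trans (+-comm (ground T c) (T * S)) e) ⟩
      odd g xor top                         ∎
      where
      open ≡-Reasoning
      g = ground T c / T
      cancel : ∀ a b → b ≡ a xor (a xor b)
      cancel a b = sym (trans (sym (xor-assoc a a b)) (cong (_xor b) (xor-same a)))

    po≡sumOver : po T n ≡ sumOver (colour top) n
    po≡sumOver = trans (po≡∑ T n) (∑-partitions-mass (𝟙 ∘ odd) (𝟙 ∘ colour top) ≤-refl (λ c S b → cong 𝟙 (level-parity c S b)))

    pe≡sumOver : pe T n ≡ sumOver (colour (not top)) n
    pe≡sumOver = trans (pe≡∑ T n) (∑-partitions-mass (𝟙 ∘ not ∘ odd) (𝟙 ∘ colour (not top)) ≤-refl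
      (λ c S b → cong 𝟙 (trans (cong not (level-parity c S b)) (not-distribʳ-xor (odd (ground T c / T)) top))))

  pe≈po : pe T ≈ po T
  pe≈po ._≈_.close J = proj₁ (_≈_.close colours-≈ J) , λ n N≤n → subst₂ (λ x y → J * ∣ x - y ∣ ≤ p n) (sym (pe≡sumOver n)) (sym (po≡sumOver n))
    (bound n (top n) (proj₂ (_≈_.close colours-≈ J) n N≤n))
    where
    bound : ∀ n s → J * ∣ sumOver (colour true) n - sumOver (colour false) n ∣ ≤ p n →
            J * ∣ sumOver (colour (not s)) n - sumOver (colour s) n ∣ ≤ p n
    bound n false h = h
    bound n true  h = subst (λ x → J * x ≤ p n) (∣-∣-comm (sumOver (colour true) n) (sumOver (colour false) n)) h

  pe+pe≈p : (λ n → pe T n + pe T n) ≈ p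
  pe+pe≈p = ≈-trans (≈-+ {pe T} {pe T} {pe T} {po T} ≈-refl pe≈po) (≈-≡ (pe+po≡p T))

  po+po≈p : (λ n → po T n + po T n) ≈ p
  po+po≈p = ≈-trans (≈-+ {po T} {pe T} {po T} {po T} (≈-sym {pe T} {po T} pe≈po) ≈-refl) (≈-≡ (pe+po≡p T))

-- Odd t: the quadratic form of a path in the parities of partial sums

tailSum : ∀ {t} → ℕ → Vec ℕ t → ℕ
tailSum zero    c       = sumᵛ c
tailSum (suc i) []      = 0
tailSum (suc i) (x ∷ c) = tailSum i c

tailSum-bump-≤ : ∀ {t} i (k : Fin t) m c → i ≤ toℕ k → tailSum i (bump k m c) ≡ m + tailSum i c
tailSum-bump-≤ zero    k           m c       _       = sum-bump k m c
tailSum-bump-≤ (suc i) (Fin.suc k) m (x ∷ c) (s≤s h) = tailSum-bump-≤ i k m c h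

tailSum-bump-> : ∀ {t} i (k : Fin t) m c → toℕ k < i → tailSum i (bump k m c) ≡ tailSum i c
tailSum-bump-> (suc i) Fin.zero    m (x ∷ c) _       = refl
tailSum-bump-> (suc i) (Fin.suc k) m (x ∷ c) (s≤s h) = tailSum-bump-> i k m c h

parities : ∀ {t} → Vec ℕ t → ℕ → Bool
parities c i = odd (tailSum i c)

pathForm : ℕ → ℕ → (ℕ → Bool) → Bool
pathForm zero    j x = false
pathForm (suc e) j x = (x j ∧ x (suc j)) xor pathForm e (suc j) x

pathForm-cong : ∀ e j {x y} → (∀ i → j ≤ i → x i ≡ y i) → pathForm e j x ≡ pathForm e j y
pathForm-cong zero    j h = refl
pathForm-cong (suc e) j h = cong₂ _xor_ (cong₂ _∧_ (h j ≤-refl) (h (suc j) (n≤1+n j)))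
  (pathForm-cong e (suc j) (λ i j<i → h i (<⇒≤ j<i)))

pathForm-∷ : ∀ {t} e j x (c : Vec ℕ t) → pathForm e (suc j) (parities (x ∷ c)) ≡ pathForm e j (parities c)
pathForm-∷ zero    j x c = refl
pathForm-∷ (suc e) j x c = cong ((parities c j ∧ parities c (suc j)) xor_) (pathForm-∷ e (suc j) x c)

-- Modulo 2 the cross term of `tri (c + s)` is `c s = (c + s) s + s`, a product of consecutive tail
-- sums plus a linear term. The linear terms combine with those of `ground` into the last summand.
odd-ground : ∀ {t} T (c : Vec ℕ t) → odd T ≡ true →
  odd (ground T c) ≡ odd (tri (sumᵛ c)) xor (pathForm t 0 (parities c) xor (not (odd t) ∧ odd (sumᵛ c)))
odd-ground T []      oT = refl
odd-ground {suc t} T (c ∷ cs) oT = begin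
  odd (T * tri c + t * c + ground T cs)
    ≡⟨ trans (odd-+ (T * tri c + t * c) _) (cong₂ _xor_ (trans (odd-+ (T * tri c) (t * c)) (cong₂ _xor_ (trans (odd-* T (tri c)) (cong (_∧ odd (tri c)) oT)) (odd-* t c))) (odd-ground T cs oT)) ⟩
  (odd (tri c) xor (odd t ∧ odd c)) xor (odd (tri s) xor (Z xor (not (odd t) ∧ odd s)))
    ≡⟨ boolean (odd (tri c)) (odd t) (odd c) (odd (tri s)) Z (odd s) ⟩
  (odd (tri c) xor odd (tri s) xor (odd c ∧ odd s)) xor ((((odd c xor odd s) ∧ odd s) xor Z) xor (not (not (odd t)) ∧ (odd c xor odd s)))
    ≡⟨ cong₂ _xor_ (sym (trans (cong odd (tri-+ c s)) (trans (odd-+ (tri c + tri s) (c * s)) (trans (cong₂ _xor_ (odd-+ (tri c) (tri s)) (odd-* c s)) (xor-assoc (odd (tri c)) _ _)))))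
         (cong₂ (λ u z → ((u ∧ odd s) xor z) xor (not (not (odd t)) ∧ u)) (sym (odd-+ c s)) (sym (pathForm-∷ t 0 c cs))) ⟩
  odd (tri (c + s)) xor (((odd (c + s) ∧ odd s) xor pathForm t 1 (parities (c ∷ cs))) xor (not (not (odd t)) ∧ odd (c + s))) ∎
  where
  open ≡-Reasoning
  s = sumᵛ cs
  Z = pathForm t 0 (parities cs)
  boolean : ∀ a t c b z s → (a xor (t ∧ c)) xor (b xor (z xor (not t ∧ s)))
          ≡ (a xor b xor (c ∧ s)) xor ((((c xor s) ∧ s) xor z) xor (not (not t) ∧ (c xor s)))
  boolean a t c b z s rewrite not-involutive t | ∧-distribʳ-xor s c s | ∧-idem s = solve 6 (λ a t c b z s →
      (a :+ (t :* c)) :+ (b :+ (z :+ ((con true :+ t) :* s)))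
      := (a :+ (b :+ (c :* s))) :+ ((((c :* s) :+ s) :+ z) :+ (t :* (c :+ s)))) refl a t c b z s
    where open xor-∧-Solver

module Odd (d : ℕ) where

  T = suc (d * 2)
  0<T : 0 < T
  0<T = s≤s z≤n

  odd-T : odd T ≡ true
  odd-T = cong not (odd-2* d)

  open Asymptotics T 0<T

  -- The path starts at index 1, since the parity at 0 is that of the total charge, which is even.
  -- The last product contains the parity of the empty tail, which is zero.
  form : Vec ℕ T → Bool
  form c = pathForm (d * 2) 1 (parities c)

  module _ (n : ℕ) where
    open Lattice T n 0<T using (C; K; Balanced; balanced; ∑-partitions-mass)

    odd-K : odd K ≡ false
    odd-K = trans (cong odd (lemma T n)) (odd-2* (T * (2 * n)))
      where
      lemma : ∀ T n → T * (4 * n) ≡ T * (2 * n) * 2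
      lemma = solve-∀

    -- As `T` is odd, `T * S` has the parity of `S`, so the energy equation can be reduced modulo 2
    -- without dividing by `T`; `tri K` cancels.
    level-parity : ∀ c S → Balanced n c S → odd S ≡ odd n xor form c
    level-parity c S (balanced s e) = cancel {odd S} {odd (tri K)} {form c} {odd n} (trans (sym (trans (odd-+ (T * S) _) (cong₂ _xor_ (trans (odd-* T S) (cong (_∧ odd S) odd-T)) ground≡)))
        (trans (cong odd e) (odd-+ n (tri K))))
      where
      ground≡ : odd (ground T c) ≡ odd (tri K) xor form c
      ground≡ = trans (odd-ground T c odd-T) (cong₂ _xor_ (cong (odd ∘ tri) s)
        (trans (cong₂ (λ x y → ((x ∧ parities c 1) xor form c) xor (not (odd T) ∧ y)) odd-sum odd-sum)
          (trans (cong (form c xor_) (∧-zeroʳ (not (odd T)))) (xor-identityʳ (form c)))))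
        where
        odd-sum : odd (sumᵛ c) ≡ false
        odd-sum = trans (cong odd s) odd-K
      cancel : ∀ {a b f n} → a xor (b xor f) ≡ n xor b → a ≡ n xor f
      cancel {a} {b} {f} {n} h = trans (solve 3 (λ a b f → a := (a :+ (b :+ f)) :+ (b :+ f)) refl a b f)
        (trans (cong (_xor (b xor f)) h) (solve 3 (λ n b f → (n :+ b) :+ (b :+ f) := n :+ f) refl n b f))
        where open xor-∧-Solver

    po≡sumOver : po T n ≡ sumOver (λ c → odd n xor form c) n
    po≡sumOver = trans (po≡∑ T n) (∑-partitions-mass (𝟙 ∘ odd) (λ c → 𝟙 (odd n xor form c)) ≤-refl (λ c S b → cong 𝟙 (level-parity c S b)))

    pe≡sumOver : pe T n ≡ sumOver (λ c → not (odd n xor form c)) n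
    pe≡sumOver = trans (pe≡∑ T n) (∑-partitions-mass (𝟙 ∘ not ∘ odd) (λ c → 𝟙 (not (odd n xor form c))) ≤-refl
      (λ c S b → cong (𝟙 ∘ not) (level-parity c S b)))

  -- Moving T beads from runner i to runner i - 1 changes only the i-th parity.
  flip-≈ : ∀ i → suc i < T → (Φ Ψ : (ℕ → Bool) → Bool) →
    (∀ x y → (∀ j → j ≢ suc i → x j ≡ y j) → x (suc i) ≡ not (y (suc i)) → Φ x ≡ Ψ y) →
    sumOver (Φ ∘ parities) ≈ sumOver (Ψ ∘ parities)
  -- Moving exactly `T` beads satisfies the residue equation for any two runners, and `T` being odd
  -- flips a parity.
  flip-≈ i i<T Φ Ψ h = transfer {a} {b} {T} {residue b} {residue a} a≢b (lemma T (residue a) (residue b)) (Φ ∘ parities) (Ψ ∘ parities)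
    (λ c → h _ _ (λ j j≢ → cong odd (same c j j≢)) (flipped c))
    where
    a b : Fin T
    a = Fin.fromℕ< (<⇒≤ i<T)
    b = Fin.fromℕ< i<T
    toℕ-a : toℕ a ≡ i
    toℕ-a = Fin.toℕ-fromℕ< (<⇒≤ i<T)
    toℕ-b : toℕ b ≡ suc i
    toℕ-b = Fin.toℕ-fromℕ< i<T
    a≢b : a ≢ b
    a≢b e = 1+n≢n (trans (sym toℕ-b) (trans (cong toℕ (sym e)) toℕ-a))
    lemma : ∀ T x y → x * T + T * y ≡ y * T + T * x
    lemma = solve-∀
    same : ∀ c j → j ≢ suc i → tailSum j (bump b T c) ≡ tailSum j (bump a T c)
    same c j j≢ with j ≤? i
    ... | yes j≤i = trans (tailSum-bump-≤ j b T c (≤-trans (m≤n⇒m≤1+n j≤i) (≤-reflexive (sym toℕ-b))))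
                      (sym (tailSum-bump-≤ j a T c (≤-trans j≤i (≤-reflexive (sym toℕ-a)))))
    ... | no  j≰i = trans (tailSum-bump-> j b T c (≤-trans (s≤s (≤-reflexive toℕ-b)) (≤∧≢⇒< (≰⇒> j≰i) (j≢ ∘ sym))))
                      (sym (tailSum-bump-> j a T c (≤-trans (s≤s (≤-reflexive toℕ-a)) (≰⇒> j≰i))))
    flipped : ∀ c → parities (bump b T c) (suc i) ≡ not (parities (bump a T c) (suc i))
    flipped c = trans (cong odd (tailSum-bump-≤ (suc i) b T c (≤-reflexive (sym toℕ-b))))
      (trans (odd-+ T _) (trans (cong (_xor odd (tailSum (suc i) c)) odd-T)
        (cong (not ∘ odd) (sym (tailSum-bump-> (suc i) a T c (≤-reflexive (cong suc toℕ-a)))))))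

  evenForm : ℕ → ℕ → ℕ → ℕ
  evenForm e j = sumOver (λ c → not (pathForm e j (parities c)))

  double : ∀ {A B D} → A ≈ B → (∀ n → A n + B n ≡ D n) → (λ n → A n + A n) ≈ D
  double {A} {B} {D} h e = ≈-trans (≈-+ {A} {A} {A} {B} ≈-refl h) (≈-≡ e)

  -- If x_{j+1} = 1 then flipping x_j flips the form; if x_{j+1} = 0 the form loses its first two terms.
  peel : ∀ e i → 2 + i < T → (λ n → 4 * evenForm (2 + e) (suc i) n) ≈ (λ n → p n + 2 * evenForm e (3 + i) n)
  peel e i i<T = ≈-trans (≈-≡ split₄) (≈-trans (≈-+ {λ n → (U n + U n) + (U n + U n)} {p} 4U 4V)
      (≈-≡ (λ n → cong (λ y → p n + (evenForm e (3 + i) n + y)) (sym (+-identityʳ (evenForm e (3 + i) n))))))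
    where
    x₂ q q′ : (ℕ → Bool) → Bool
    x₂ x = x (2 + i)
    q x  = pathForm (2 + e) (suc i) x
    q′ x = pathForm e (3 + i) x
    U U′ V V′ W W′ : ℕ → ℕ
    U  = sumOver ((λ x → x₂ x ∧ not (q x)) ∘ parities)
    U′ = sumOver ((λ x → x₂ x ∧ q x) ∘ parities)
    V  = sumOver ((λ x → not (x₂ x) ∧ not (q′ x)) ∘ parities)
    V′ = sumOver ((λ x → x₂ x ∧ not (q′ x)) ∘ parities)
    W  = sumOver (x₂ ∘ parities)
    W′ = sumOver (not ∘ x₂ ∘ parities)
    split : ∀ n → evenForm (2 + e) (suc i) n ≡ U n + V n
    split n = trans (sumOver-split _ (x₂ ∘ parities) n) (cong (U n +_) (sumOver-cong (λ c → drop (parities c (suc i)) (x₂ (parities c)) _ _) n))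
      where
      drop : ∀ a b c z → not b ∧ not ((a ∧ b) xor ((b ∧ c) xor z)) ≡ not b ∧ not z
      drop a     true  c z = refl
      drop true  false c z = refl
      drop false false c z = refl
    split₄ : ∀ n → 4 * evenForm (2 + e) (suc i) n ≡ ((U n + U n) + (U n + U n)) + ((V n + V n) + (V n + V n))
    split₄ n = trans (cong (4 *_) (split n)) (lemma (U n) (V n))
      where
      lemma : ∀ u v → 4 * (u + v) ≡ ((u + u) + (u + u)) + ((v + v) + (v + v))
      lemma = solve-∀
    U≈U′ : U ≈ U′
    U≈U′ = flip-≈ i (<⇒≤ i<T) _ _ (λ x y same flipped → flip-first (x₂ x) (same (2 + i) λ ()) flipped
        (cong₂ _xor_ (cong₂ _∧_ (same (2 + i) λ ()) (same (3 + i) λ ())) (pathForm-cong e (3 + i) (λ k h → same k (λ { refl → <⇒≱ h (n≤1+n _) })))))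
      where
      flip-first : ∀ {a a′ b′ r r′} b → b ≡ b′ → a ≡ not a′ → r ≡ r′ →
        b ∧ not ((a ∧ b) xor r) ≡ b′ ∧ ((a′ ∧ b′) xor r′)
      flip-first false refl refl refl = refl
      flip-first {a′ = true}  {r = r} true refl refl refl = refl
      flip-first {a′ = false} {r = r} true refl refl refl = not-involutive r
    -- `q′` starts at index `3 + i`, so flipping the parity at `2 + i` leaves it alone.
    V≈V′ : V ≈ V′
    V≈V′ = flip-≈ (suc i) i<T _ _ (λ x y same flipped → cong₂ _∧_ (trans (cong not flipped) (not-involutive (x₂ y)))
      (cong not (pathForm-cong e (3 + i) (λ k h → same k (λ { refl → <⇒≱ h ≤-refl })))))
    W≈W′ : W ≈ W′
    W≈W′ = flip-≈ (suc i) i<T _ _ (λ x y same flipped → flipped)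
    U+U≈W : (λ n → U n + U n) ≈ W
    U+U≈W = double {U} {U′} U≈U′ (λ n → trans (+-comm (U n) (U′ n)) (sym (trans (sumOver-split (x₂ ∘ parities) (q ∘ parities) n)
      (cong₂ _+_ (sumOver-cong (λ c → ∧-comm (q (parities c)) _) n) (sumOver-cong (λ c → ∧-comm (not (q (parities c))) _) n)))))
    W+W≈p : (λ n → W n + W n) ≈ p
    W+W≈p = double {W} {W′} W≈W′ (λ n → trans (sym (trans (sumOver-split (λ _ → true) (x₂ ∘ parities) n)
      (cong₂ _+_ (sumOver-cong (λ c → ∧-comm (x₂ (parities c)) true) n) (sumOver-cong (λ c → ∧-comm (not (x₂ (parities c))) true) n)))) (sumOver-true n))
    4U : (λ n → (U n + U n) + (U n + U n)) ≈ p
    4U = ≈-trans (≈-+ {λ n → U n + U n} {W} U+U≈W U+U≈W) W+W≈p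
    V+V≈ : (λ n → V n + V n) ≈ evenForm e (3 + i)
    V+V≈ = double {V} {V′} V≈V′ (λ n → trans (+-comm (V n) (V′ n)) (sym (sumOver-split _ (x₂ ∘ parities) n)))
    4V : (λ n → (V n + V n) + (V n + V n)) ≈ (λ n → evenForm e (3 + i) n + evenForm e (3 + i) n)
    4V = ≈-+ {λ n → V n + V n} {evenForm e (3 + i)} V+V≈ V+V≈

  -- By `peel` the excess of the even share over 1/2 is halved with every two terms of the form; it
  -- starts at 1/2 for the empty form.
  evenForm-≈ : ∀ e i → suc i + e * 2 ≡ T → (λ n → 2 ^ suc e * evenForm (e * 2) (suc i) n) ≈ (λ n → (2 ^ e + 1) * p n)
  evenForm-≈ zero    i _  = ≈-≡ (λ n → cong (2 *_) (sumOver-true n))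
  evenForm-≈ (suc e) i eq = ≈-trans
    (≈-≡ (λ n → lemma (2 ^ e) (evenForm (2 + e * 2) (suc i) n)))
    (≈-trans (≈-* (2 ^ e) {λ n → 4 * evenForm (2 + e * 2) (suc i) n} (peel (e * 2) i
        (≤-trans (≤-trans (m≤m+n (3 + i) (e * 2)) (≤-reflexive (lemma₂ i (e * 2)))) (≤-reflexive eq))))
    (≈-trans (≈-≡ (λ n → lemma₃ (2 ^ e) (p n) (evenForm (e * 2) (3 + i) n)))
    (≈-trans (≈-+ {λ n → 2 ^ e * p n} {λ n → 2 ^ e * p n} ≈-refl (evenForm-≈ e (2 + i) (trans (lemma₂ i (e * 2)) eq)))
      (≈-≡ (λ n → lemma₄ (2 ^ e) (p n))))))
    where
    lemma : ∀ b x → 2 * (2 * b) * x ≡ b * (4 * x)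
    lemma = solve-∀
    lemma₂ : ∀ i e → 3 + i + e ≡ suc i + (2 + e)
    lemma₂ = solve-∀
    lemma₃ : ∀ b x y → b * (x + 2 * y) ≡ b * x + 2 * b * y
    lemma₃ = solve-∀
    lemma₄ : ∀ b x → b * x + (b + 1) * x ≡ (2 * b + 1) * x
    lemma₄ = solve-∀

  evens odds : ℕ → ℕ
  evens = sumOver (not ∘ form)
  odds  = sumOver form

  evens-≈ : (λ n → 2 ^ suc d * evens n) ≈ (λ n → (2 ^ d + 1) * p n)
  evens-≈ = evenForm-≈ d 0 refl

  -- Complementary to `evens-≈`, as 2^(d+1) is the sum of 2^d - 1 and 2^d + 1.
  odds-≈ : (λ n → 2 ^ suc d * odds n) ≈ (λ n → (2 ^ d ∸ 1) * p n)
  odds-≈ = ≈-cancelʳ (λ n → (2 ^ d + 1) * p n) (≈-trans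
    (≈-+ {λ n → 2 ^ suc d * odds n} {λ n → 2 ^ suc d * odds n} ≈-refl (≈-sym {λ n → 2 ^ suc d * evens n} evens-≈))
    (≈-≡ (λ n → trans (sym (*-distribˡ-+ (2 ^ suc d) (odds n) (evens n)))
       (trans (cong (2 ^ suc d *_) (total n)) (trans (cong (λ b → 2 * b * p n) (sym 2^d≡)) (trans (lemma (2 ^ d ∸ 1) (p n))
         (cong (λ b → (2 ^ d ∸ 1) * p n + (b + 1) * p n) 2^d≡)))))))
    where
    2^d≡ : 2 ^ d ∸ 1 + 1 ≡ 2 ^ d
    2^d≡ = m∸n+n≡m (m^n>0 2 d)
    lemma : ∀ b x → 2 * (b + 1) * x ≡ b * x + (b + 1 + 1) * x
    lemma = solve-∀
    total : ∀ n → odds n + evens n ≡ p n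
    total n = trans (sym (trans (sumOver-split (λ _ → true) form n)
      (cong₂ _+_ (sumOver-cong (λ c → ∧-comm (form c) true) n) (sumOver-cong (λ c → ∧-comm (not (form c)) true) n)))) (sumOver-true n)

  pe-even : ∀ n → odd n ≡ false → pe T n ≡ evens n
  pe-even n e = trans (pe≡sumOver n) (sumOver-cong (λ c → cong (λ b → not (b xor form c)) e) n)

  po-even : ∀ n → odd n ≡ false → po T n ≡ odds n
  po-even n e = trans (po≡sumOver n) (sumOver-cong (λ c → cong (λ b → b xor form c) e) n)

  pe-odd : ∀ n → odd n ≡ true → pe T n ≡ odds n
  pe-odd n e = trans (pe≡sumOver n) (sumOver-cong (λ c → trans (cong (λ b → not (b xor form c)) e) (not-involutive (form c))) n)

  po-odd : ∀ n → odd n ≡ true → po T n ≡ evens n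
  po-odd n e = trans (po≡sumOver n) (sumOver-cong (λ c → cong (λ b → b xor form c) e) n)

-- Limits of ratios

open import Data.Integer as ℤ using (ℤ; +_; +<+)
open import Data.Rational using (½; _-_)

∣⊖∣≡∣-∣ : ∀ m n → ℤ.∣ m ℤ.⊖ n ∣ ≡ ℕ.∣ m - n ∣
∣⊖∣≡∣-∣ m n with ℕ.≤-total m n
... | inj₁ m≤n = trans (ℤ.∣⊖∣-≤ m≤n) (sym (ℕ.m≤n⇒∣m-n∣≡n∸m m≤n))
... | inj₂ n≤m = trans (ℤ.∣m⊖n∣≡∣n⊖m∣ m n) (trans (ℤ.∣⊖∣-≤ n≤m) (sym (ℕ.m≤n⇒∣n-m∣≡n∸m n≤m)))

-- The distance is `v / ((q + 1) (D + 1))` with `v` the difference of cross products, and ε is at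
-- least the inverse of its denominator. The multiplier is one more than that denominator, which
-- makes the inequality strict.
fraction-close : ∀ a q c D (ε L : ℚ) → ℚ.Positive ε → toℚᵘ L ≃ᵘ mkℚᵘ (+ c) D →
  suc (suc (ℚ.denominator-1 ε)) ℕ.* ℕ.∣ suc D ℕ.* a - c ℕ.* suc q ∣ ≤ suc q →
  ℚ.∣ ratio a (suc q) - L ∣ ℚ.< ε
fraction-close a q c D ε@(mkℚ (+ suc e) d _) L _ L≃ h = ℚ.toℚᵘ-cancel-< (ℚᵘ.<-respˡ-≃ (ℚᵘ.≃-sym distance) (*<* bound))
  where
  x y : ℚᵘ.ℚᵘ
  x = mkℚᵘ (+ a) q
  y = mkℚᵘ (+ c) D
  r = ratio a (suc q)
  num = ℤ.∣ (+ a) ℤ.* (+ suc D) ℤ.+ (ℤ.- (+ c)) ℤ.* (+ suc q) ∣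
  distance : toℚᵘ ℚ.∣ r - L ∣ ≃ᵘ ℚᵘ.∣ x ℚᵘ.- y ∣
  distance = ℚᵘ.≃-trans (ℚ.toℚᵘ-homo-∣-∣ (r - L)) (ℚᵘ.∣-∣-cong
    (ℚᵘ.≃-trans (ℚ.toℚᵘ-homo-+ r (ℚ.- L)) (ℚᵘ.+-cong (ℚ.toℚᵘ-fromℚᵘ x) (ℚᵘ.≃-trans (ℚ.toℚᵘ-homo‿- L) (ℚᵘ.-‿cong L≃)))))
  num≡ : num ≡ ℕ.∣ suc D ℕ.* a - c ℕ.* suc q ∣
  num≡ = trans (cong ℤ.∣_∣ (trans (cong₂ ℤ._+_ (trans (sym (ℤ.pos-* a (suc D))) (cong +_ (ℕ.*-comm a (suc D))))
      (trans (sym (ℤ.neg-distribˡ-* (+ c) (+ suc q))) (cong ℤ.-_ (sym (ℤ.pos-* c (suc q))))))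
    (ℤ.m-n≡m⊖n (suc D ℕ.* a) (c ℕ.* suc q)))) (∣⊖∣≡∣-∣ (suc D ℕ.* a) (c ℕ.* suc q))
  small : ∀ v → suc (suc d) ℕ.* v ≤ suc q → v ℕ.* suc d ℕ.< suc q
  small zero    _ = s≤s z≤n
  small (suc v) h = ℕ.≤-trans (ℕ.≤-reflexive (cong suc (ℕ.*-comm (suc v) (suc d))))
    (ℕ.≤-trans (ℕ.+-monoˡ-≤ (suc d ℕ.* suc v) (s≤s (z≤n {v}))) h)
  bound : (+ num) ℤ.* (+ suc d) ℤ.< (+ suc e) ℤ.* (+ (suc q ℕ.* suc D))
  bound = subst₂ ℤ._<_ (ℤ.pos-* num (suc d)) (ℤ.pos-* (suc e) (suc q ℕ.* suc D)) (+<+ (ℕ.<-≤-trans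
    (small num (subst (λ v → suc (suc d) ℕ.* v ≤ suc q) (sym num≡) h))
    (ℕ.≤-trans (ℕ.m≤m*n (suc q) (suc D)) (ℕ.m≤n*m (suc q ℕ.* suc D) (suc e)))))
fraction-close a q c D (mkℚ (+ zero) d _)     L ε>0 L≃ h = ⊥-elim (ℤ.<-irrefl refl (ℤ.positive⁻¹ (+ zero) {{ε>0}}))
fraction-close a q c D (mkℚ (ℤ.-[1+ e ]) d _) L ε>0 L≃ h with () ← ℤ.positive⁻¹ (ℤ.-[1+ e ]) {{ε>0}}

-- `a` and `A` are compared on `Q` only: for odd t the same numerator follows different sequences on
-- the two parity classes of `n`.
converges : ∀ {Q : ℕ → Set} {a A : ℕ → ℕ} {D c L} → toℚᵘ L ≃ᵘ mkℚᵘ (+ c) D →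
  (λ n → suc D ℕ.* A n) ≈ (λ n → c ℕ.* p n) → (∀ n → Q n → a n ≡ A n) →
  ConvergesAlong Q (λ n → ratio (a n) (p n)) L
converges {Q} {a} {A} {D} {c} {L} L≃ h aA ε ε>0 = proj₁ (_≈_.close h scale) , λ n N≤n Qn →
  go n (p n) (p-positive n) (subst (λ x → scale ℕ.* ℕ.∣ suc D ℕ.* x - c ℕ.* p n ∣ ≤ p n) (sym (aA n Qn)) (proj₂ (_≈_.close h scale) n N≤n))
  where
  scale = suc (suc (ℚ.denominator-1 ε))
  go : ∀ n q → 1 ≤ q → scale ℕ.* ℕ.∣ suc D ℕ.* a n - c ℕ.* q ∣ ≤ q → ℚ.∣ ratio (a n) q - L ∣ ℚ.< ε
  go n (suc q) _ = fraction-close (a n) q c D ε L (ℚ.positive ε>0) L≃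

halfPow-≃ : ∀ k b → 2 ^ k ≡ suc b → toℚᵘ (halfPow k) ≃ᵘ mkℚᵘ (+ 1) b
halfPow-≃ zero    b e rewrite sym (ℕ.suc-injective e) = *≡* refl
halfPow-≃ (suc k) b e = ℚᵘ.≃-trans (ℚ.toℚᵘ-homo-* ½ (halfPow k))
  (ℚᵘ.≃-trans (ℚᵘ.*-cong (ℚᵘ.≃-refl {toℚᵘ ½}) (halfPow-≃ k b′ (sym (ℕ.suc-pred (2 ^ k) {{ℕ.m^n≢0 2 k}}))))
    (*≡* (cong (λ m → (+ 1) ℤ.* (+ m)) (trans (sym e) (cong (2 ℕ.*_) (sym (ℕ.suc-pred (2 ^ k) {{ℕ.m^n≢0 2 k}})))))))
  where b′ = pred (2 ^ k)

module _ (d b : ℕ) (2^d≡ : 2 ^ d ≡ suc b) where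

  private
    -- Written so that `suc D` unfolds to `2 * suc b`, the common denominator 2^(d+1).
    D = b ℕ.+ 1 ℕ.* suc b
    2^sd≡ : 2 ^ suc d ≡ suc D
    2^sd≡ = cong (2 ℕ.*_) 2^d≡
    ⅟ : toℚᵘ (halfPow (suc d)) ≃ᵘ mkℚᵘ (+ 1) D
    ⅟ = halfPow-≃ (suc d) D 2^sd≡
    D≡ : + suc D ≡ (+ 2) ℤ.* (+ suc b)
    D≡ = ℤ.pos-* 2 (suc b)
    2D≡ : + (2 ℕ.* suc D) ≡ (+ 2) ℤ.* ((+ 2) ℤ.* (+ suc b))
    2D≡ = trans (ℤ.pos-* 2 (suc D)) (cong ((+ 2) ℤ.*_) D≡)

  ½+halfPow-≃ : toℚᵘ (½ ℚ.+ halfPow (suc d)) ≃ᵘ mkℚᵘ (+ (2 ^ d ℕ.+ 1)) D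
  ½+halfPow-≃ = ℚᵘ.≃-trans (ℚ.toℚᵘ-homo-+ ½ (halfPow (suc d)))
    (ℚᵘ.≃-trans (ℚᵘ.+-cong (ℚᵘ.≃-refl {toℚᵘ ½}) ⅟) (*≡* (begin
      ((+ 1) ℤ.* (+ suc D) ℤ.+ (+ 1) ℤ.* (+ 2)) ℤ.* (+ suc D)       ≡⟨ cong (λ z → ((+ 1) ℤ.* z ℤ.+ (+ 1) ℤ.* (+ 2)) ℤ.* z) D≡ ⟩
      ((+ 1) ℤ.* ((+ 2) ℤ.* x) ℤ.+ (+ 1) ℤ.* (+ 2)) ℤ.* ((+ 2) ℤ.* x) ≡⟨ lemma x ⟩
      (x ℤ.+ (+ 1)) ℤ.* ((+ 2) ℤ.* ((+ 2) ℤ.* x))                   ≡⟨ cong₂ ℤ._*_ (cong (λ m → + (m ℕ.+ 1)) (sym 2^d≡)) (sym 2D≡) ⟩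
      (+ (2 ^ d ℕ.+ 1)) ℤ.* (+ (2 ℕ.* suc D))                       ∎)))
    where
    open ≡-Reasoning
    x = + suc b
    lemma : ∀ x → ((+ 1) ℤ.* ((+ 2) ℤ.* x) ℤ.+ (+ 1) ℤ.* (+ 2)) ℤ.* ((+ 2) ℤ.* x) ≡ (x ℤ.+ (+ 1)) ℤ.* ((+ 2) ℤ.* ((+ 2) ℤ.* x))
    lemma = ℤ-solve-∀

  ½-halfPow-≃ : toℚᵘ (½ - halfPow (suc d)) ≃ᵘ mkℚᵘ (+ (2 ^ d ℕ.∸ 1)) D
  ½-halfPow-≃ = ℚᵘ.≃-trans (ℚ.toℚᵘ-homo-+ ½ (ℚ.- halfPow (suc d)))
    (ℚᵘ.≃-trans (ℚᵘ.+-cong (ℚᵘ.≃-refl {toℚᵘ ½}) (ℚᵘ.≃-trans (ℚ.toℚᵘ-homo‿- (halfPow (suc d))) (ℚᵘ.-‿cong ⅟))) (*≡* (begin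
      ((+ 1) ℤ.* (+ suc D) ℤ.+ (ℤ.- (+ 1)) ℤ.* (+ 2)) ℤ.* (+ suc D)       ≡⟨ cong (λ z → ((+ 1) ℤ.* z ℤ.+ (ℤ.- (+ 1)) ℤ.* (+ 2)) ℤ.* z) D≡ ⟩
      ((+ 1) ℤ.* ((+ 2) ℤ.* ((+ 1) ℤ.+ x)) ℤ.+ (ℤ.- (+ 1)) ℤ.* (+ 2)) ℤ.* ((+ 2) ℤ.* ((+ 1) ℤ.+ x)) ≡⟨ lemma x ⟩
      x ℤ.* ((+ 2) ℤ.* ((+ 2) ℤ.* ((+ 1) ℤ.+ x)))                         ≡⟨ cong₂ ℤ._*_ (cong (λ m → + (m ℕ.∸ 1)) (sym 2^d≡)) (sym 2D≡) ⟩
      (+ (2 ^ d ℕ.∸ 1)) ℤ.* (+ (2 ℕ.* suc D))                             ∎)))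
    where
    open ≡-Reasoning
    x = + b
    lemma : ∀ x → ((+ 1) ℤ.* ((+ 2) ℤ.* ((+ 1) ℤ.+ x)) ℤ.+ (ℤ.- (+ 1)) ℤ.* (+ 2)) ℤ.* ((+ 2) ℤ.* ((+ 1) ℤ.+ x))
                ≡ x ℤ.* ((+ 2) ℤ.* ((+ 2) ℤ.* ((+ 1) ℤ.+ x)))
    lemma = ℤ-solve-∀

  converges-+ : ∀ {Q a A} → (λ n → 2 ^ suc d ℕ.* A n) ≈ (λ n → (2 ^ d ℕ.+ 1) ℕ.* p n) → (∀ n → Q n → a n ≡ A n) →
    ConvergesAlong Q (λ n → ratio (a n) (p n)) (½ ℚ.+ halfPow (suc d))
  converges-+ {a = a} {A} h = converges {a = a} {A} ½+halfPow-≃ (subst (λ e → (λ n → e ℕ.* A n) ≈ (λ n → (2 ^ d ℕ.+ 1) ℕ.* p n)) 2^sd≡ h)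

  converges-- : ∀ {Q a A} → (λ n → 2 ^ suc d ℕ.* A n) ≈ (λ n → (2 ^ d ℕ.∸ 1) ℕ.* p n) → (∀ n → Q n → a n ≡ A n) →
    ConvergesAlong Q (λ n → ratio (a n) (p n)) (½ - halfPow (suc d))
  converges-- {a = a} {A} h = converges {a = a} {A} ½-halfPow-≃ (subst (λ e → (λ n → e ℕ.* A n) ≈ (λ n → (2 ^ d ℕ.∸ 1) ℕ.* p n)) 2^sd≡ h)

converges-½ : ∀ {a} → (λ n → a n ℕ.+ a n) ≈ p → ConvergesTo (λ n → ratio (a n) (p n)) ½
converges-½ {a} h = converges {A = a} {D = 1} {c = 1} ℚᵘ.≃-refl
  (≈-trans (≈-≡ (λ n → cong (a n ℕ.+_) (ℕ.+-identityʳ (a n)))) (≈-trans h (≈-≡ (λ n → sym (ℕ.+-identityʳ (p n)))))) (λ _ _ → refl)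

-- The limits for even and for odd t

EvenLimits : ℕ → Set
EvenLimits t = ConvergesTo (δe t) ½ × ConvergesTo (δo t) ½

even-limits : ∀ t → 2 ≤ t → 2 ∣ t → EvenLimits t
even-limits _ () (divides zero refl)
even-limits _ _  (divides (suc h) refl) = subst EvenLimits (ℕ.*-comm 2 (suc h))
  (converges-½ {a = pe (2 ℕ.* suc h)} (Even.pe+pe≈p h) , converges-½ {a = po (2 ℕ.* suc h)} (Even.po+po≈p h))

OddLimits : ℕ → ℕ → Set
OddLimits t k =
  ConvergesAlong (λ n → 2 ∣ n) (δe t) (½ ℚ.+ halfPow k)
  × ConvergesAlong (λ n → ¬ (2 ∣ n)) (δe t) (½ - halfPow k)
  × ConvergesAlong (λ n → 2 ∣ n) (δo t) (½ - halfPow k)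
  × ConvergesAlong (λ n → ¬ (2 ∣ n)) (δo t) (½ ℚ.+ halfPow k)

odd-limits : ∀ t → ¬ (2 ∣ t) → OddLimits t ((t ℕ.+ 1) / 2)
odd-limits t 2∤t = subst₂ OddLimits (sym t≡) (sym k≡) limits
  where
  d = proj₁ (halves t)
  b = pred (2 ^ d)
  T = suc (d ℕ.* 2)
  t≡ : t ≡ T
  t≡ = trans (proj₂ (halves t)) (cong (λ o → 𝟙 o ℕ.+ d ℕ.* 2) (2∤⇒odd 2∤t))
  k≡ : (t ℕ.+ 1) / 2 ≡ suc d
  k≡ = trans (cong (_/ 2) (trans (cong (ℕ._+ 1) t≡) (ℕ.+-comm (suc (d ℕ.* 2)) 1))) (m*n/n≡m (suc d) 2)
  2^d≡ : 2 ^ d ≡ suc b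
  2^d≡ = sym (ℕ.suc-pred (2 ^ d) {{ℕ.m^n≢0 2 d}})
  limits : OddLimits T (suc d)
  limits =
    converges-+ d b 2^d≡ {a = pe T} {Odd.evens d} (Odd.evens-≈ d) (λ n 2∣n → Odd.pe-even d n (2∣⇒even 2∣n)) ,
    converges-- d b 2^d≡ {a = pe T} {Odd.odds d} (Odd.odds-≈ d) (λ n 2∤n → Odd.pe-odd d n (2∤⇒odd 2∤n)) ,
    converges-- d b 2^d≡ {a = po T} {Odd.odds d} (Odd.odds-≈ d) (λ n 2∣n → Odd.po-even d n (2∣⇒even 2∣n)) ,
    converges-+ d b 2^d≡ {a = po T} {Odd.evens d} (Odd.evens-≈ d) (λ n 2∤n → Odd.po-odd d n (2∤⇒odd 2∤n))

open import Data.Rational using (_+_)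

theorem1p1 : (t : ℕ) → 2 ≤ t →
    (2 ∣ t → ConvergesTo (δe t) ½ × ConvergesTo (δo t) ½)
    × (¬ (2 ∣ t) →
    ConvergesAlong (λ n → 2 ∣ n) (δe t) (½ Data.Rational.+ halfPow ((t Data.Nat.+ 1) / 2))
    × ConvergesAlong (λ n → ¬ (2 ∣ n)) (δe t) (½ - halfPow ((t Data.Nat.+ 1) / 2))
    × ConvergesAlong (λ n → 2 ∣ n) (δo t) (½ - halfPow ((t Data.Nat.+ 1) / 2))
    × ConvergesAlong (λ n → ¬ (2 ∣ n)) (δo t) (½ Data.Rational.+ halfPow ((t Data.Nat.+ 1) / 2)))
theorem1p1 t 2≤t = even-limits t 2≤t , odd-limits t
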